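{- Let $\mathcal{H}=(V,\mathcal{E})$ be a hypergraph with fixed maximum vertex degree $\Delta$ and maximum edge size $\ell$, with $V=\{v_1,\dots,v_n\}$, let $b_1,\dots,b_n\in\mathbb{N}_{\ge 2}$ satisfy $b_i\le d(v_i)-1$ for all $i\in[n]$, and put $b=\min_{i\in[n]}b_i$ and $\delta=\Delta-b+1$. Let $k\in\mathbb{N}_{\ge2}$ be a constant and let $$\epsilon\in\left[\tfrac{\delta-1}{2\delta},\left(\tfrac{\delta-1}{2\delta}\right)^{1/k}\right],\qquad a_{k,\epsilon}=\frac{k(1-\epsilon)+(\delta-1)(1-\epsilon^k)}{2},\qquad \alpha=\frac{(b-1)\delta\epsilon^k}{6\ell}\exp(a_{k,\epsilon}).$$ Then the algorithm SET MULTICOVER (described in the context), run with these parameters, returns a set multicover $C$ such that $$|C|<\max\left\{\left(1-\tfrac12(1-\epsilon)\epsilon^k\right)\delta,\ \left(1-\frac{(b-1)\epsilon^k}{18\ell}\exp(a_{k,\epsilon})\right)\delta\right\}\cdot \mathrm{Opt}^{*}$$ with probability greater than $0.65$, where $\mathrm{Opt}^*$ is the optimal value of the linear programming relaxation of the set multicover problem for $(\mathcal{H},(b_1,\dots,b_n))$.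
   Context: A hypergraph $\mathcal{H}=(V,\mathcal{E})$ consists of a finite set $V=\{v_1,\dots,v_n\}$ of vertices and a family $\mathcal{E}=\{E_1,\dots,E_m\}\subseteq 2^V$ of edges. The degree $d(v)$ of a vertex is the number of edges containing it, $\Delta=\max_v d(v)$; the size of an edge is its number of vertices, and $\ell$ is the maximum edge size. $[n]=\{1,\dots,n\}$. Given $b_1,\dots,b_n$, a vertex $v_i$ is fully covered by $C\subseteq\mathcal{E}$ if it lies in at least $b_i$ edges of $C$; a set multicover is a set $C\subseteq\mathcal{E}$ fully covering every vertex. The set multicover problem is to find a set multicover of minimum cardinality. LP relaxation: minimize $\sum_{j=1}^m x_j$ subject to $\sum_{j:\,v_i\in E_j}x_j\ge b_i$ for all $i\in[n]$ and $x_j\in[0,1]$ for all $j\in[m]$. Its optimal value is $\mathrm{Opt}^*$. Algorithm SET MULTICOVER. Set $\lambda=\frac{\delta+1}{2}$, $\lambda_0=(1-\epsilon)\delta$, and $\alpha$ as in the claim. (1) Start with $C=\emptyset$ and compute an optimal solution $x^*\in[0,1]^m$ of the LP relaxation. (2) Set $C_1=\{E_j: x_j^*\ge \frac1\lambda\}$, $C_2=\{E_j:\frac1\lambda>x_j^*\ge\frac1\delta\}$, $C_3=\{E_j: 0<x_j^*<\frac1\delta\}$. (3) Put all edges of $C_1$ into $C$. (4) If $|C_1|\ge\alpha\cdot\mathrm{Opt}^*$, return $C=C_1\cup C_2$. (5) Otherwise: (a) for each $E_j\in C_2$, independently, perform $k$ independent biased coin flips each showing heads with probability $\lambda_0x_j^*$,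 and include $E_j$ in $C$ if at least one of them shows heads; (b) for each $E_j\in C_3$, independently, include $E_j$ in $C$ with probability $(1-\epsilon^k)\delta x_j^*$; (c) (repairing) if necessary, include in $C$ arbitrary edges from $C_2$ incident to vertices that are not fully covered, until all vertices are fully covered; (d) return $C$. -}

module Defs where

open import Algebra.Bundles using (CommutativeRing)
open import Data.Bool.Base using (Bool; true; false; if_then_else_; _∨_)
open import Data.Fin.Base using (Fin; zero; toℕ)
open import Data.Fin.Properties using (all?)
open import Data.Fin.Subset using (Subset; inside; outside; _∈_; _∉_; _⊆_; _∩_; _∪_; ⁅_⁆; ∣_∣)
import Data.List.Base as List
open import Data.List.Extrema.Nat using (max; min)
open import Data.Nat.Base as ℕ using (ℕ; zero; suc; _!)
import Data.Nat.Properties as ℕ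
open import Data.Product.Base using (∃; ∃-syntax; _×_; _,_)
open import Data.Vec.Base as Vec using (Vec; []; _∷_; lookup; tabulate)
open import Function.Base using (_∘_)
open import Function.Definitions using (Injective)
open import Level using (0ℓ)
open import Relation.Binary.Bundles using (DecTotalOrder)
open import Relation.Binary.Construct.Closure.ReflexiveTransitive using (Star)
open import Relation.Binary.Core using (Rel)
open import Relation.Binary.PropositionalEquality.Core using (_≡_)
open import Relation.Binary.Structures using (IsDecTotalOrder)
open import Relation.Nullary.Decidable.Core using (does; _×-dec_)
open import Relation.Nullary.Negation.Core using (¬_)
open import Relation.Unary using (Decidable)

-- The real numbers are characterised, as usual in classical mathematics, as a
-- complete ordered field.  The decidable order makes the threshold tests
-- of the algorithm meaningful; under excluded middle every model of the reals
-- satisfies these axioms.  The value of 0# ⁻¹ is unspecified.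

record CompleteOrderedField : Set₁ where
  infix  4 _≤_
  infix  8 _⁻¹
  field
    commutativeRing : CommutativeRing 0ℓ 0ℓ

  open CommutativeRing commutativeRing public

  field
    1≉0             : 1# ≉ 0#
    _⁻¹             : Carrier → Carrier
    ⁻¹-cong         : ∀ {x y} → x ≈ y → x ⁻¹ ≈ y ⁻¹
    ⁻¹-inverseʳ     : ∀ {x} → x ≉ 0# → x * x ⁻¹ ≈ 1#
    _≤_             : Rel Carrier 0ℓ
    isDecTotalOrder : IsDecTotalOrder _≈_ _≤_
    +-monoʳ-≤       : ∀ x {y z} → y ≤ z → x + y ≤ x + z
    *-nonNegative   : ∀ {x y} → 0# ≤ x → 0# ≤ y → 0# ≤ x * y

  UpperBound : (Carrier → Set) → Carrier → Set
  UpperBound P u = ∀ x → P x → x ≤ u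

  field
    completeness : (P : Carrier → Set) → ∃ P → ∃ (UpperBound P) →
      ∃[ s ] UpperBound P s × (∀ u → UpperBound P u → s ≤ u)

  decTotalOrder : DecTotalOrder 0ℓ 0ℓ 0ℓ
  decTotalOrder = record { isDecTotalOrder = isDecTotalOrder }

-- The edge set is a set of subsets of V = Fin n, so distinct indices give
-- distinct edges; subfamilies of it are represented by sets of indices.

record Hypergraph (n m : ℕ) : Set where
  field
    edge     : Fin m → Subset n
    distinct : Injective _≡_ _≡_ edge

  star : Fin n → Subset m
  star v = tabulate (λ j → lookup (edge j) v)

  degree : Fin n → ℕ
  degree v = ∣ star v ∣

  maxDegree : ℕ
  maxDegree = max 0 (List.tabulate degree)

  maxEdgeSize : ℕ
  maxEdgeSize = max 0 (List.tabulate (λ j → ∣ edge j ∣))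

  FullyCovered : (Fin n → ℕ) → Subset m → Fin n → Set
  FullyCovered b C v = b v ℕ.≤ ∣ star v ∩ C ∣

  IsMulticover : (Fin n → ℕ) → Subset m → Set
  IsMulticover b C = ∀ v → FullyCovered b C v

minimum : ∀ {n} → (Fin (suc n) → ℕ) → ℕ
minimum b = min (b zero) (List.tabulate b)

module Reals (ℝ : CompleteOrderedField) where

  open CompleteOrderedField ℝ public
    using (Carrier; _≈_; _≉_; _+_; _*_; _-_; -_; 0#; 1#; _⁻¹; _≤_)
  open CompleteOrderedField ℝ using (commutativeRing; decTotalOrder)
  open CommutativeRing commutativeRing using (semiring; +-commutativeMonoid)
  open DecTotalOrder decTotalOrder public using (_≤?_)
  open DecTotalOrder decTotalOrder using (totalOrder)
  open import Relation.Binary.Properties.DecTotalOrder decTotalOrder public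
    using (_<_; <-strictTotalOrder)
  open import Relation.Binary.Bundles using (StrictTotalOrder)
  open StrictTotalOrder <-strictTotalOrder public using (_<?_)
  open import Algebra.Construct.NaturalChoice.Max totalOrder public using (_⊔_)
  open import Algebra.Properties.Semiring.Exp semiring public using (_^_)
  open import Algebra.Properties.Semiring.Mult semiring using () renaming (_×_ to _×#_)
  open import Algebra.Properties.CommutativeMonoid.Sum +-commutativeMonoid public
    using (sum)

  infixl 7 _/_

  _/_ : Carrier → Carrier → Carrier
  x / y = x * y ⁻¹

  ⟦_⟧ : ℕ → Carrier
  ⟦ n ⟧ = n ×# 1#

  -- r = c^(1/k), for c ≥ 0 and k ≥ 1
  IsRoot : ℕ → Carrier → Carrier → Set
  IsRoot k c r = 0# ≤ r × r ^ k ≈ c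

  -- exp y = z, through the convergence of the exponential series
  expPartialSum : Carrier → ℕ → Carrier
  expPartialSum y N = sum {N} (λ i → y ^ toℕ i / ⟦ toℕ i ! ⟧)

  IsExp : Carrier → Carrier → Set
  IsExp y z = ∀ η → 0# < η → ∃[ N ] ∀ M → N ℕ.≤ M →
    (- η < expPartialSum y M - z) × (expPartialSum y M - z < η)

  -- A randomised computation is a decision tree whose inner nodes are
  -- mutually independent coins labelled by their probability of heads (true).

  data Rand (A : Set) : Set where
    return : A → Rand A
    coin   : Carrier → (Bool → Rand A) → Rand A

  flip : Carrier → Rand Bool
  flip p = coin p return

  infixl 1 _>>=_

  _>>=_ : ∀ {A B} → Rand A → (A → Rand B) → Rand B
  return a >>= g = g a
  coin p f >>= g = coin p (λ h → f h >>= g)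

  sequence : ∀ {A n} → Vec (Rand A) n → Rand (Vec A n)
  sequence []       = return []
  sequence (d ∷ ds) = do
    a  ← d
    as ← sequence ds
    return (a ∷ as)

  anyHeads : ℕ → Carrier → Rand Bool
  anyHeads zero    p = return false
  anyHeads (suc k) p = do
    h  ← flip p
    hs ← anyHeads k p
    return (h ∨ hs)

  Pr : ∀ {A} {P : A → Set} → Decidable P → Rand A → Carrier
  Pr P? (return a) = if does (P? a) then 1# else 0#
  Pr P? (coin p f) = p * Pr P? (f true) + (1# - p) * Pr P? (f false)

  Always : ∀ {A} → (A → Set) → Rand A → Set
  Always P (return a) = P a
  Always P (coin p f) = ∀ h → Always P (f h)

  module _ {n m} (H : Hypergraph n m) (b : Fin n → ℕ) where

    open Hypergraph H

    IsLPFeasible : (Fin m → Carrier) → Set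
    IsLPFeasible x =
      (∀ i → ⟦ b i ⟧ ≤ sum (λ j → if lookup (edge j) i then x j else 0#)) ×
      (∀ j → 0# ≤ x j × x j ≤ 1#)

    IsLPOptimal : (Fin m → Carrier) → Set
    IsLPOptimal x = IsLPFeasible x × (∀ y → IsLPFeasible y → sum x ≤ sum y)

  module SetMulticover
    {n m} (H : Hypergraph n m) (b : Fin n → ℕ)
    (δ : ℕ) (k : ℕ) (ε α : Carrier) (x* : Fin m → Carrier) where

    open Hypergraph H

    λ₁ λ₀ Opt* : Carrier
    λ₁   = (⟦ δ ⟧ + 1#) / ⟦ 2 ⟧
    λ₀   = (1# - ε) * ⟦ δ ⟧
    Opt* = sum x*

    subset : {P : Fin m → Set} → Decidable P → Subset m
    subset P? = tabulate (does ∘ P?)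

    C₁ C₂ C₃ : Subset m
    C₁ = subset (λ j → 1# / λ₁ ≤? x* j)
    C₂ = subset (λ j → (x* j <? 1# / λ₁) ×-dec (1# / ⟦ δ ⟧ ≤? x* j))
    C₃ = subset (λ j → (0# <? x* j) ×-dec (x* j <? 1# / ⟦ δ ⟧))

    include : Fin m → Rand Bool
    include j =
      if lookup C₁ j then return inside
      else if lookup C₂ j then anyHeads k (λ₀ * x* j)
      else if lookup C₃ j then flip ((1# - ε ^ k) * ⟦ δ ⟧ * x* j)
      else return outside

    RepairStep : Rel (Subset m) 0ℓ
    RepairStep C C′ = ∃[ v ] ∃[ j ]
      ¬ FullyCovered b C v × v ∈ edge j × j ∈ C₂ × j ∉ C × C′ ≡ C ∪ ⁅ j ⁆

    -- The edges added by the repairing step are arbitrary, so the algorithm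
    -- takes as argument a function making these choices.  Every set to be
    -- repaired contains C₁, and from other sets a repair need not exist.
    IsRepair : (Subset m → Subset m) → Set
    IsRepair repair = ∀ C → C₁ ⊆ C →
      Star RepairStep C (repair C) × IsMulticover b (repair C)

    -- Whatever was chosen before, the repairing step can always continue
    -- until all vertices are fully covered.
    RepairNeverStuck : Set
    RepairNeverStuck = ∀ C → C₁ ⊆ C → ¬ IsMulticover b C → ∃ (RepairStep C)

    algorithm : (Subset m → Subset m) → Rand (Subset m)
    algorithm repair =
      if does (α * Opt* ≤? ⟦ ∣ C₁ ∣ ⟧)
      then return (C₁ ∪ C₂)
      else (do
        C ← sequence (tabulate include)
        return (repair C))

{-# OPTIONS --safe #-}

-- Put z = εᵏ, G = z δ Opt*, let S be the size of the support of x*, and let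
-- K = δ Opt* - S.  The output is contained in the support, so the size bound
-- holds with certainty when 2 K > (1 - ε) G.  Otherwise use the optimality of
-- x*: a small step of the fractional x*_j in the direction θ x*_j - 1 keeps x*
-- feasible for θ = δ, whence K ≥ (δ - 1) #{j : x*_j = 1}, and also for
-- θ = (δ + 1)/2 if no x*_j equals 1, whence 2 K ≥ (δ - 1) Opt*.  The latter
-- exceeds (1 - ε) G, so some x*_j equals 1, K ≥ δ - 1, and 3 Opt* ≤ 4 n.
--
-- If |C₁| ≥ α Opt*, every edge of C₁ has δ x*_j ≥ 4/3, strictly when x*_j = 1,
-- which gives the second term of the maximum.  If |C₁| < α Opt*, double
-- counting gives 6 n < exp(a) G; together with 3 Opt* ≤ 4 n this is impossible
-- for δ ≤ 3.  For δ ≥ 4, a vertex is left uncovered by the coin flips with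
-- probability at most exp(-2a), and costs one repairing edge, so the expected
-- number of repairs is at most G / 18.  Combined with the second moment of the
-- number of chosen edges this bounds the failure probability by 34/99.

module Submission where

open import Defs
open import Algebra.Bundles using (CommutativeRing)
open import Algebra.Solver.Ring.AlmostCommutativeRing
  using (fromCommutativeRing; _-Raw-AlmostCommutative⟶_)
open import Data.Bool.Base using (Bool; true; false; if_then_else_; _∧_; not; _∨_)
import Data.Bool.Properties as Bool
open import Data.Fin.Base using (Fin; zero; suc; toℕ)
open import Data.Fin.Properties using (any?) renaming (_≟_ to _≟ᶠ_)
open import Data.Fin.Subset using (Subset; inside; outside; ∣_∣; _∈_; _∉_; _∩_; _∪_; _⊆_; _⊂_; ⁅_⁆)
open import Data.Fin.Subset.Properties
  using (p⊆q⇒∣p∣≤∣q∣; ∣p∩q∣≤∣q∣; x∈p∩q⁺; p⊂q⇒∣p∣<∣q∣; x∈p∩q⁻; x∈p∪q⁻; x∈p∪q⁺; p⊆p∪q; x∈⁅x⁆;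
    x∈⁅y⁆⇒x≡y; ∣⁅x⁆∣≡1; _∈?_; nonempty?; Empty-unique; ∣⊥∣≡0)
open import Data.Integer.Base as ℤ using (ℤ; +_; -[1+_]; +[1+_])
import Data.Integer.Properties as ℤ
import Data.List.Base as List
import Data.List.Extrema.Nat as Extrema
import Data.List.Relation.Unary.All.Properties as All
open import Data.Maybe.Base using (Maybe; just; nothing)
open import Data.Nat.Base as ℕ using (ℕ; zero; suc; _!; z≤n; s≤s; _∸_)
import Data.Nat.Properties as ℕ
open import Data.Product.Base using (_×_; _,_; proj₁; proj₂; ∃-syntax)
open import Data.Sum.Base using (_⊎_; inj₁; inj₂; [_,_]′)
open import Data.Unit.Base using (⊤; tt)
open import Data.Vec.Base using (Vec; []; _∷_; lookup; tabulate)
open import Data.Vec.Properties using (lookup∘tabulate; lookup-zipWith; []=⇒lookup; lookup⇒[]=)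
open import Relation.Binary.Bundles using (DecTotalOrder)
open import Relation.Binary.Construct.Closure.ReflexiveTransitive using (Star)
open import Relation.Binary.PropositionalEquality.Core as ≡ using (_≡_; _≢_)
open import Relation.Nullary.Decidable using (dec-true; dec-false)
open import Relation.Nullary.Decidable.Core
  using (yes; no; does; Dec; _×-dec_; ¬?; decidable-stable)
open import Relation.Nullary.Negation.Core using (¬_; contradiction)
open import Relation.Unary using (Decidable)

-- The obstacle is concentration without a lower bound on Opt*: Chebyshev needs the variance to be a
-- small fraction of the squared margin A between size bound and mean, and this can fail when A is
-- of constant order. K ≥ δ - 1 ≥ 3 repairs it: the variance is at most S - μ, hence at most (16 A -
-- 33) / 11, and this line lies below the parabola 2 A² / 11 for every A. The failure probability is
-- then 18/99 from the variance plus 16/99 from the repairs. Both enter through one pointwise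
-- inequality that is linear in the number of repairs, so only its expectation matters.
--
-- The exponential is known only by its value at a. The bound exp(-2a) is therefore obtained as Q²
-- with Q ≤ exp(-a), by means of 1 - p ≤ (1 - p/2)² for each coin, and Q ≤ exp(-e) is a relation
-- between partial sums that is closed under products, so that no functional equation of exp enters.
-- The square also supplies the slack: Q² ≤ 1 / (3 exp(a)) because exp(a) ≥ 3, and 6 n < exp(a) G
-- turns n / (3 exp(a)) into G / 18.

-- Ordered-field arithmetic and a ring solver with integer coefficients.

module OrderedField (ℝ : CompleteOrderedField) where

  open Reals ℝ
  open CompleteOrderedField ℝ public
    using (commutativeRing; decTotalOrder; semiring; ring; setoid; refl; sym; trans; reflexive;
           +-cong; +-congˡ; +-congʳ; *-cong; *-congˡ; *-congʳ; -‿cong;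
           +-assoc; +-comm; *-assoc; *-comm;
           +-identityˡ; +-identityʳ; *-identityˡ; *-identityʳ; zeroˡ; zeroʳ; -‿inverseʳ;
           1≉0; ⁻¹-inverseʳ; *-nonNegative; +-monoʳ-≤)
  open DecTotalOrder decTotalOrder public
    using (totalOrder) renaming
    (refl to ≤-refl; trans to ≤-trans; antisym to ≤-antisym; reflexive to ≤-reflexive;
     total to ≤-total; ≤-respˡ-≈ to ≤-respˡ; ≤-respʳ-≈ to ≤-respʳ)
  open import Relation.Binary.Properties.DecTotalOrder decTotalOrder public
    using (≰⇒>; ≮⇒≥; <⇒≱; <-irrefl; <-respʳ-≈; <-respˡ-≈)
  open import Algebra.Properties.Ring ring public using (-‿distribˡ-*; -‿distribʳ-*; -‿involutive; -‿+-comm; -0#≈0#)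
  open import Algebra.Properties.Semiring.Mult semiring public using (×-homo-+; ×1-homo-*)
  open import Algebra.Properties.Semiring.Exp semiring public using (^-congˡ)
  import Relation.Binary.Reasoning.Setoid setoid as ≈

  ⟦_⟧ℤ : ℤ → Carrier
  ⟦ + n ⟧ℤ      = ⟦ n ⟧
  ⟦ -[1+ n ] ⟧ℤ = - ⟦ suc n ⟧

  ⟦⊖⟧ : ∀ m n → ⟦ m ℤ.⊖ n ⟧ℤ ≈ ⟦ m ⟧ - ⟦ n ⟧
  ⟦⊖⟧ zero    zero    = sym (-‿inverseʳ 0#)
  ⟦⊖⟧ zero    (suc n) = sym (+-identityˡ _)
  ⟦⊖⟧ (suc m) zero    = sym (trans (+-congˡ -0#≈0#) (+-identityʳ _))
  ⟦⊖⟧ (suc m) (suc n) = ≈.begin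
    ⟦ suc m ℤ.⊖ suc n ⟧ℤ              ≈.≡⟨ ≡.cong ⟦_⟧ℤ (ℤ.[1+m]⊖[1+n]≡m⊖n m n) ⟩
    ⟦ m ℤ.⊖ n ⟧ℤ                      ≈.≈⟨ ⟦⊖⟧ m n ⟩
    ⟦ m ⟧ - ⟦ n ⟧                     ≈.≈⟨ +-identityˡ _ ⟨
    0# + (⟦ m ⟧ - ⟦ n ⟧)              ≈.≈⟨ +-congʳ (-‿inverseʳ 1#) ⟨
    (1# - 1#) + (⟦ m ⟧ - ⟦ n ⟧)       ≈.≈⟨ interchange 1# (- 1#) ⟦ m ⟧ (- ⟦ n ⟧) ⟩
    (1# + ⟦ m ⟧) + (- 1# - ⟦ n ⟧)     ≈.≈⟨ +-congˡ (-‿+-comm 1# ⟦ n ⟧) ⟩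
    ⟦ suc m ⟧ - ⟦ suc n ⟧             ≈.∎
    where
    open import Algebra.Properties.CommutativeSemigroup
      (CommutativeRing.+-commutativeSemigroup commutativeRing) using (interchange)

  ⟦⟧ℤ-homo-neg : ∀ i → ⟦ ℤ.- i ⟧ℤ ≈ - ⟦ i ⟧ℤ
  ⟦⟧ℤ-homo-neg (+ zero)  = sym -0#≈0#
  ⟦⟧ℤ-homo-neg +[1+ n ]  = refl
  ⟦⟧ℤ-homo-neg -[1+ n ]  = sym (-‿involutive _)

  ⟦⟧ℤ-homo-+ : ∀ i j → ⟦ i ℤ.+ j ⟧ℤ ≈ ⟦ i ⟧ℤ + ⟦ j ⟧ℤ
  ⟦⟧ℤ-homo-+ (+ m)    (+ n)    = ×-homo-+ 1# m n
  ⟦⟧ℤ-homo-+ (+ m)    -[1+ n ] = ⟦⊖⟧ m (suc n)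
  ⟦⟧ℤ-homo-+ -[1+ m ] (+ n)    = trans (⟦⊖⟧ n (suc m)) (+-comm _ _)
  ⟦⟧ℤ-homo-+ -[1+ m ] -[1+ n ] = ≈.begin
    - ⟦ suc (suc (m ℕ.+ n)) ⟧  ≈.≡⟨ ≡.cong (λ k → - ⟦ suc k ⟧) (ℕ.+-suc m n) ⟨
    - ⟦ suc m ℕ.+ suc n ⟧      ≈.≈⟨ -‿cong (×-homo-+ 1# (suc m) (suc n)) ⟩
    - (⟦ suc m ⟧ + ⟦ suc n ⟧)  ≈.≈⟨ -‿+-comm _ _ ⟨
    - ⟦ suc m ⟧ - ⟦ suc n ⟧    ≈.∎

  ⟦⟧ℤ-homo-*⁺⁺ : ∀ m n → ⟦ + m ℤ.* + n ⟧ℤ ≈ ⟦ m ⟧ * ⟦ n ⟧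
  ⟦⟧ℤ-homo-*⁺⁺ m n =
    trans (reflexive (≡.cong ⟦_⟧ℤ (≡.sym (ℤ.pos-* m n)))) (×1-homo-* m n)

  ⟦⟧ℤ-homo-*⁺ : ∀ m j → ⟦ + m ℤ.* j ⟧ℤ ≈ ⟦ m ⟧ * ⟦ j ⟧ℤ
  ⟦⟧ℤ-homo-*⁺ m (+ n)    = ⟦⟧ℤ-homo-*⁺⁺ m n
  ⟦⟧ℤ-homo-*⁺ m -[1+ n ] = ≈.begin
    ⟦ + m ℤ.* -[1+ n ] ⟧ℤ      ≈.≡⟨ ≡.cong ⟦_⟧ℤ (ℤ.neg-distribʳ-* (+ m) (+ suc n)) ⟨
    ⟦ ℤ.- (+ m ℤ.* + suc n) ⟧ℤ ≈.≈⟨ ⟦⟧ℤ-homo-neg (+ m ℤ.* + suc n) ⟩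
    - ⟦ + m ℤ.* + suc n ⟧ℤ     ≈.≈⟨ -‿cong (⟦⟧ℤ-homo-*⁺⁺ m (suc n)) ⟩
    - (⟦ m ⟧ * ⟦ suc n ⟧)      ≈.≈⟨ -‿distribʳ-* _ _ ⟩
    ⟦ m ⟧ * - ⟦ suc n ⟧        ≈.∎

  ⟦⟧ℤ-homo-* : ∀ i j → ⟦ i ℤ.* j ⟧ℤ ≈ ⟦ i ⟧ℤ * ⟦ j ⟧ℤ
  ⟦⟧ℤ-homo-* (+ m)    j = ⟦⟧ℤ-homo-*⁺ m j
  ⟦⟧ℤ-homo-* -[1+ m ] j = ≈.begin
    ⟦ -[1+ m ] ℤ.* j ⟧ℤ        ≈.≡⟨ ≡.cong ⟦_⟧ℤ (ℤ.neg-distribˡ-* (+ suc m) j) ⟨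
    ⟦ ℤ.- (+ suc m ℤ.* j) ⟧ℤ   ≈.≈⟨ ⟦⟧ℤ-homo-neg (+ suc m ℤ.* j) ⟩
    - ⟦ + suc m ℤ.* j ⟧ℤ       ≈.≈⟨ -‿cong (⟦⟧ℤ-homo-*⁺ (suc m) j) ⟩
    - (⟦ suc m ⟧ * ⟦ j ⟧ℤ)     ≈.≈⟨ -‿distribˡ-* _ _ ⟩
    - ⟦ suc m ⟧ * ⟦ j ⟧ℤ       ≈.∎

  ℤ-morphism : ℤ.+-*-rawRing -Raw-AlmostCommutative⟶ fromCommutativeRing commutativeRing
  ℤ-morphism = record
    { ⟦_⟧    = ⟦_⟧ℤ
    ; +-homo = ⟦⟧ℤ-homo-+
    ; *-homo = ⟦⟧ℤ-homo-*
    ; -‿homo = ⟦⟧ℤ-homo-neg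
    ; 0-homo = refl
    ; 1-homo = +-identityʳ 1#
    }

  ⟦⟧ℤ-≟ : ∀ i j → Maybe (⟦ i ⟧ℤ ≈ ⟦ j ⟧ℤ)
  ⟦⟧ℤ-≟ i j with i ℤ.≟ j
  ... | yes ≡.refl = just refl
  ... | no _       = nothing

  open import Algebra.Solver.Ring ℤ.+-*-rawRing (fromCommutativeRing commutativeRing) ℤ-morphism ⟦⟧ℤ-≟ public
    using (Polynomial; con; _:+_; _:*_; _:-_; :-_; _:^_; _:=_; solve)

  #_ : ∀ {n} → ℕ → Polynomial n
  # n = con (+ n)

  infix 9 #_

  -- con (+ 1) denotes 1# + 0#, whereas this polynomial denotes 1# itself.
  :1 : ∀ {n} → Polynomial n
  :1 = con (+ 0) :^ 0

  0≤y-x : ∀ {x y} → x ≤ y → 0# ≤ y - x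
  0≤y-x {x} {y} x≤y = ≤-respˡ (-‿inverseʳ x)
    (≤-respˡ (+-comm _ _) (≤-respʳ (+-comm _ _) (+-monoʳ-≤ (- x) x≤y)))

  -- Most inequalities below are certificates of this kind: a visibly nonnegative `e`, and a ring
  -- identity for `y - x` that the solver checks. The content of such a proof is the choice of `e`.
  ≤-by : ∀ {x y e} → 0# ≤ e → y - x ≈ e → x ≤ y
  ≤-by {x} {y} 0≤e y-x≈e =
    ≤-respˡ (+-identityʳ x) (≤-respʳ eq (+-monoʳ-≤ x (≤-respʳ (sym y-x≈e) 0≤e)))
    where
    eq : x + (y - x) ≈ y
    eq = solve 2 (λ x y → x :+ (y :- x) := y) refl x y

  <⇒≤ : ∀ {x y} → x < y → x ≤ y
  <⇒≤ = proj₁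

  <-≤-trans : ∀ {x y z} → x < y → y ≤ z → x < z
  <-≤-trans x<y y≤z =
    ≤-trans (<⇒≤ x<y) y≤z , λ x≈z → <⇒≱ x<y (≤-respʳ (sym x≈z) y≤z)

  ≤-<-trans : ∀ {x y z} → x ≤ y → y < z → x < z
  ≤-<-trans x≤y y<z =
    ≤-trans x≤y (<⇒≤ y<z) , λ x≈z → <⇒≱ y<z (≤-respˡ x≈z x≤y)

  0<y-x : ∀ {x y} → x < y → 0# < y - x
  0<y-x {x} {y} (x≤y , x≉y) = 0≤y-x x≤y , λ 0≈y-x → x≉y (sym (begin
    y            ≈⟨ solve 2 (λ x y → y := x :+ (y :- x)) refl x y ⟩
    x + (y - x)  ≈⟨ +-congˡ 0≈y-x ⟨
    x + 0#       ≈⟨ +-identityʳ x ⟩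
    x            ∎))
    where open ≈

  <-by : ∀ {x y e} → 0# < e → y - x ≈ e → x < y
  <-by {x} {y} 0<e y-x≈e = ≤-by (<⇒≤ 0<e) y-x≈e , λ x≈y →
    <-irrefl refl (<-respʳ-≈ (trans (sym y-x≈e) (trans (+-congˡ (-‿cong x≈y)) (-‿inverseʳ y))) 0<e)

  infixl 6 _0≤+_ _0≤+<_ _0<+≤_
  infixl 7 _0≤*_ _0<*_

  _0≤+_ : ∀ {x y} → 0# ≤ x → 0# ≤ y → 0# ≤ x + y
  _0≤+_ {x} {y} 0≤x 0≤y = ≤-trans 0≤x (≤-by 0≤y (solve 2 (λ x y → x :+ y :- x := y) refl x y))

  _0≤+<_ : ∀ {x y} → 0# ≤ x → 0# < y → 0# < x + y
  _0≤+<_ {x} {y} 0≤x 0<y = ≤-<-trans 0≤x (<-by 0<y (solve 2 (λ x y → x :+ y :- x := y) refl x y))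

  _0<+≤_ : ∀ {x y} → 0# < x → 0# ≤ y → 0# < x + y
  _0<+≤_ {x} {y} 0<x 0≤y = <-respʳ-≈ (+-comm y x) (0≤y 0≤+< 0<x)

  _0≤*_ : ∀ {x y} → 0# ≤ x → 0# ≤ y → 0# ≤ x * y
  _0≤*_ = *-nonNegative

  _0<*_ : ∀ {x y} → 0# < x → 0# < y → 0# < x * y
  _0<*_ {x} {y} (0≤x , 0≉x) (0≤y , 0≉y) = 0≤x 0≤* 0≤y , λ 0≈xy → 0≉y (sym (begin
    y               ≈⟨ *-identityʳ y ⟨
    y * 1#          ≈⟨ *-congˡ (⁻¹-inverseʳ (λ x≈0 → 0≉x (sym x≈0))) ⟨
    y * (x * x ⁻¹)  ≈⟨ solve 3 (λ x y z → y :* (x :* z) := x :* y :* z) refl x y (x ⁻¹) ⟩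
    x * y * x ⁻¹    ≈⟨ *-congʳ 0≈xy ⟨
    0# * x ⁻¹       ≈⟨ zeroˡ _ ⟩
    0#              ∎))
    where open ≈

  0≤-neg : ∀ {x} → x ≤ 0# → 0# ≤ - x
  0≤-neg x≤0 = ≤-respʳ (+-identityˡ _) (0≤y-x x≤0)

  0≤x² : ∀ x → 0# ≤ x * x
  0≤x² x with ≤-total 0# x
  ... | inj₁ 0≤x = 0≤x 0≤* 0≤x
  ... | inj₂ x≤0 = ≤-respʳ (solve 1 (λ x → :- x :* :- x := x :* x) refl x)
    (0≤-neg x≤0 0≤* 0≤-neg x≤0)

  0<1 : 0# < 1#
  0<1 = ≤-respʳ (*-identityʳ 1#) (0≤x² 1#) , λ 0≈1 → 1≉0 (sym 0≈1)

  0≤1 : 0# ≤ 1#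
  0≤1 = <⇒≤ 0<1

  0≤⟦_⟧ : ∀ n → 0# ≤ ⟦ n ⟧
  0≤⟦ zero ⟧  = ≤-refl
  0≤⟦ suc n ⟧ = 0≤1 0≤+ 0≤⟦ n ⟧

  0<⟦1+_⟧ : ∀ n → 0# < ⟦ suc n ⟧
  0<⟦1+ n ⟧ = 0<1 0<+≤ 0≤⟦ n ⟧

  ⟦⟧-mono-≤ : ∀ {m n} → m ℕ.≤ n → ⟦ m ⟧ ≤ ⟦ n ⟧
  ⟦⟧-mono-≤ {m} {n} m≤n = ≤-respʳ (begin
    ⟦ m ⟧ + ⟦ n ℕ.∸ m ⟧   ≈⟨ ×-homo-+ 1# m (n ℕ.∸ m) ⟨
    ⟦ m ℕ.+ (n ℕ.∸ m) ⟧   ≡⟨ ≡.cong ⟦_⟧ (ℕ.m+[n∸m]≡n m≤n) ⟩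
    ⟦ n ⟧                 ∎)
    (≤-by 0≤⟦ n ℕ.∸ m ⟧ (solve 2 (λ x y → x :+ y :- x := y) refl ⟦ m ⟧ ⟦ n ℕ.∸ m ⟧))
    where open ≈

  +-mono-≤ : ∀ {x y u v} → x ≤ y → u ≤ v → x + u ≤ y + v
  +-mono-≤ {x} {y} {u} {v} x≤y u≤v = ≤-by (0≤y-x x≤y 0≤+ 0≤y-x u≤v)
    (solve 4 (λ x y u v → y :+ v :- (x :+ u) := y :- x :+ (v :- u)) refl x y u v)

  *-monoʳ-≤ : ∀ {x y z} → 0# ≤ z → x ≤ y → z * x ≤ z * y
  *-monoʳ-≤ {x} {y} {z} 0≤z x≤y = ≤-by (0≤z 0≤* 0≤y-x x≤y)
    (solve 3 (λ x y z → z :* y :- z :* x := z :* (y :- x)) refl x y z)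

  *-mono-≤ : ∀ {x y u v} → 0# ≤ x → 0# ≤ v → x ≤ y → u ≤ v → x * u ≤ y * v
  *-mono-≤ {x} {y} {u} {v} 0≤x 0≤v x≤y u≤v =
    ≤-trans (*-monoʳ-≤ 0≤x u≤v) (≤-respˡ (*-comm v x) (≤-respʳ (*-comm v y) (*-monoʳ-≤ 0≤v x≤y)))

  *-cancelˡ-≤ : ∀ {x y z} → 0# < z → z * x ≤ z * y → x ≤ y
  *-cancelˡ-≤ {x} {y} {z} 0<z zx≤zy with x ≤? y
  ... | yes x≤y = x≤y
  ... | no  x≰y = contradiction zx≤zy (<⇒≱ (<-by (0<z 0<* 0<y-x (≰⇒> x≰y))
    (solve 3 (λ x y z → z :* x :- z :* y := z :* (x :- y)) refl x y z)))

  *-cancelˡ-< : ∀ {x y z} → 0# ≤ z → z * x < z * y → x < y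
  *-cancelˡ-< 0≤z zx<zy = ≰⇒> λ y≤x → <⇒≱ zx<zy (*-monoʳ-≤ 0≤z y≤x)

  *-inverseʳ : ∀ {x} → 0# < x → x * x ⁻¹ ≈ 1#
  *-inverseʳ (_ , 0≉x) = ⁻¹-inverseʳ λ x≈0 → 0≉x (sym x≈0)

  0<⁻¹ : ∀ {x} → 0# < x → 0# < x ⁻¹
  0<⁻¹ {x} 0<x = ≰⇒> λ x⁻¹≤0 → <⇒≱ 0<1
    (≤-respˡ (*-inverseʳ 0<x) (≤-respʳ (zeroʳ x) (*-monoʳ-≤ (<⇒≤ 0<x) x⁻¹≤0)))

  *-/-cancel : ∀ {l} y → 0# < l → l * (y / l) ≈ y
  *-/-cancel {l} y 0<l = begin
    l * (y * l ⁻¹)  ≈⟨ solve 3 (λ l y i → l :* (y :* i) := y :* (l :* i)) refl l y (l ⁻¹) ⟩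
    y * (l * l ⁻¹)  ≈⟨ *-congˡ (*-inverseʳ 0<l) ⟩
    y * 1#          ≈⟨ *-identityʳ y ⟩
    y               ∎
    where open ≈

  y/l≤x⇒y≤l*x : ∀ {l x y} → 0# < l → y / l ≤ x → y ≤ l * x
  y/l≤x⇒y≤l*x 0<l y/l≤x = ≤-respˡ (*-/-cancel _ 0<l) (*-monoʳ-≤ (<⇒≤ 0<l) y/l≤x)

  l*x≤y⇒x≤y/l : ∀ {l x y} → 0# < l → l * x ≤ y → x ≤ y / l
  l*x≤y⇒x≤y/l 0<l lx≤y = *-cancelˡ-≤ 0<l (≤-respʳ (sym (*-/-cancel _ 0<l)) lx≤y)

  y≤l*x⇒y/l≤x : ∀ {l x y} → 0# < l → y ≤ l * x → y / l ≤ x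
  y≤l*x⇒y/l≤x 0<l y≤lx = *-cancelˡ-≤ 0<l (≤-respˡ (sym (*-/-cancel _ 0<l)) y≤lx)

  y/l≰x⇒l*x<y : ∀ {l x y} → 0# < l → ¬ (y / l ≤ x) → l * x < y
  y/l≰x⇒l*x<y 0<l y/l≰x = ≰⇒> λ y≤lx → y/l≰x (y≤l*x⇒y/l≤x 0<l y≤lx)

  0≤/ : ∀ {x l} → 0# ≤ x → 0# < l → 0# ≤ x / l
  0≤/ 0≤x 0<l = 0≤x 0≤* <⇒≤ (0<⁻¹ 0<l)

  0≤^ : ∀ {x} n → 0# ≤ x → 0# ≤ x ^ n
  0≤^ zero    0≤x = 0≤1
  0≤^ (suc n) 0≤x = 0≤x 0≤* 0≤^ n 0≤x

  ^-monoˡ-≤ : ∀ {x y} n → 0# ≤ x → x ≤ y → x ^ n ≤ y ^ n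
  ^-monoˡ-≤ zero    0≤x x≤y = ≤-refl
  ^-monoˡ-≤ (suc n) 0≤x x≤y =
    *-mono-≤ 0≤x (0≤^ n (≤-trans 0≤x x≤y)) x≤y (^-monoˡ-≤ n 0≤x x≤y)

  ^-≤1 : ∀ {x} n → 0# ≤ x → x ≤ 1# → x ^ n ≤ 1#
  ^-≤1 zero    0≤x x≤1 = ≤-refl
  ^-≤1 (suc n) 0≤x x≤1 = ≤-respʳ (*-identityʳ 1#) (*-mono-≤ 0≤x 0≤1 x≤1 (^-≤1 n 0≤x x≤1))

  1≤^ : ∀ {x} n → 1# ≤ x → 1# ≤ x ^ n
  1≤^ zero    1≤x = ≤-refl
  1≤^ (suc n) 1≤x = ≤-respˡ (*-identityʳ 1#)
    (*-mono-≤ 0≤1 (≤-trans 0≤1 (1≤^ n 1≤x)) 1≤x (1≤^ n 1≤x))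

  ^-distrib-* : ∀ x y n → (x * y) ^ n ≈ x ^ n * y ^ n
  ^-distrib-* x y zero    = sym (*-identityˡ 1#)
  ^-distrib-* x y (suc n) = trans (*-congˡ (^-distrib-* x y n))
    (solve 4 (λ x y u v → x :* y :* (u :* v) := x :* u :* (y :* v)) refl x y (x ^ n) (y ^ n))

-- Finite sums, with cardinalities as sums of indicators.

module FiniteSums (ℝ : CompleteOrderedField) where

  open Reals ℝ
  open OrderedField ℝ
  open import Algebra.Properties.Semiring.Sum semiring public
    using (∑-comm; *-distribˡ-sum) renaming (sum-cong-≋ to sum-cong; ∑-distrib-+ to sum-+)
  import Relation.Binary.Reasoning.Setoid setoid as ≈

  infix 8 _when_

  _when_ : Carrier → Bool → Carrier
  x when s = if s then x else 0#

  sum-mono-≤ : ∀ {n} {f g : Fin n → Carrier} → (∀ i → f i ≤ g i) → sum f ≤ sum g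
  sum-mono-≤ {zero}  f≤g = ≤-refl
  sum-mono-≤ {suc n} f≤g = +-mono-≤ (f≤g zero) (sum-mono-≤ (λ i → f≤g (suc i)))

  sum-mono-< : ∀ {n} {f g : Fin n → Carrier} → (∀ i → f i ≤ g i) → ∀ i → f i < g i → sum f < sum g
  sum-mono-< {f = f} {g} f≤g zero    fi<gi =
    <-by (0<y-x fi<gi 0<+≤ 0≤y-x (sum-mono-≤ (λ i → f≤g (suc i))))
      (solve 4 (λ a b c d → c :+ d :- (a :+ b) := c :- a :+ (d :- b)) refl
        (f zero) (sum (λ i → f (suc i))) (g zero) (sum (λ i → g (suc i))))
  sum-mono-< {f = f} {g} f≤g (suc i) fi<gi =
    <-by (0≤y-x (f≤g zero) 0≤+< 0<y-x (sum-mono-< (λ i → f≤g (suc i)) i fi<gi))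
      (solve 4 (λ a b c d → c :+ d :- (a :+ b) := c :- a :+ (d :- b)) refl
        (f zero) (sum (λ i → f (suc i))) (g zero) (sum (λ i → g (suc i))))

  sum-nonneg : ∀ {n} {f : Fin n → Carrier} → (∀ i → 0# ≤ f i) → 0# ≤ sum f
  sum-nonneg {zero}  0≤f = ≤-refl
  sum-nonneg {suc n} 0≤f = 0≤f zero 0≤+ sum-nonneg (λ i → 0≤f (suc i))

  sum-≥-term : ∀ {n} {f : Fin n → Carrier} → (∀ i → 0# ≤ f i) → ∀ i → f i ≤ sum f
  sum-≥-term {f = f} 0≤f zero    = ≤-by (sum-nonneg (λ i → 0≤f (suc i)))
    (solve 2 (λ a b → a :+ b :- a := b) refl (f zero) _)
  sum-≥-term {f = f} 0≤f (suc i) = ≤-trans (sum-≥-term (λ i → 0≤f (suc i)) i)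
    (≤-by (0≤f zero) (solve 2 (λ a b → a :+ b :- b := a) refl (f zero) _))

  sum-* : ∀ {n} c (f : Fin n → Carrier) → sum (λ i → c * f i) ≈ c * sum f
  sum-* c f = sym (*-distribˡ-sum c f)

  sum-neg : ∀ {n} (f : Fin n → Carrier) → sum (λ i → - f i) ≈ - sum f
  sum-neg {zero}  f = sym -0#≈0#
  sum-neg {suc n} f = trans (+-congˡ (sum-neg (λ i → f (suc i)))) (-‿+-comm _ _)

  sum-- : ∀ {n} (f g : Fin n → Carrier) → sum (λ i → f i - g i) ≈ sum f - sum g
  sum-- f g = trans (sum-+ f (λ i → - g i)) (+-congˡ (sum-neg g))

  sum-const : ∀ {n} c → sum {n} (λ _ → c) ≈ ⟦ n ⟧ * c
  sum-const {zero}  c = sym (zeroˡ c)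
  sum-const {suc n} c = trans (+-congˡ (sum-const {n} c))
    (solve 2 (λ c n → c :+ n :* c := (:1 :+ n) :* c) refl c ⟦ n ⟧)

  ⟦∣∣⟧ : ∀ {n} (p : Subset n) → ⟦ ∣ p ∣ ⟧ ≈ sum (λ i → 1# when lookup p i)
  ⟦∣∣⟧ []            = refl
  ⟦∣∣⟧ (inside  ∷ p) = +-congˡ (⟦∣∣⟧ p)
  ⟦∣∣⟧ (outside ∷ p) = trans (⟦∣∣⟧ p) (sym (+-identityˡ _))

-- The exponential series and bounds of the form exp(-e).

module Exponential (ℝ : CompleteOrderedField) where

  open Reals ℝ
  open OrderedField ℝ
  open FiniteSums ℝ
  import Relation.Binary.Reasoning.Setoid setoid as ≈

  private
    E : ℕ → Carrier → Carrier
    E N y = expPartialSum y N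

    term : Carrier → ℕ → Carrier
    term y i = y ^ i / ⟦ i ! ⟧

  0<⟦_!⟧ : ∀ n → 0# < ⟦ n ! ⟧
  0<⟦ n !⟧ with n ! | ℕ.1≤n! n
  ... | suc m | _ = 0<⟦1+ m ⟧

  private
    0≤term : ∀ {y} i → 0# ≤ y → 0# ≤ term y i
    0≤term i 0≤y = 0≤/ (0≤^ i 0≤y) 0<⟦ i !⟧

    partialSum-mono : ∀ {M N} (f : ℕ → Carrier) → (∀ i → 0# ≤ f i) → M ℕ.≤ N →
                      sum {M} (λ i → f (toℕ i)) ≤ sum {N} (λ i → f (toℕ i))
    partialSum-mono {N = N} f 0≤f z≤n = sum-nonneg {N} (λ i → 0≤f (toℕ i))
    partialSum-mono f 0≤f (s≤s M≤N)   = +-mono-≤ ≤-refl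
      (partialSum-mono (λ i → f (suc i)) (λ i → 0≤f (suc i)) M≤N)

  expPartialSum-monoʳ : ∀ {y M N} → 0# ≤ y → M ℕ.≤ N → E M y ≤ E N y
  expPartialSum-monoʳ {y} 0≤y = partialSum-mono (term y) (λ i → 0≤term i 0≤y)

  expPartialSum-monoˡ : ∀ {x y} N → 0# ≤ x → x ≤ y → E N x ≤ E N y
  expPartialSum-monoˡ {x} {y} N 0≤x x≤y = sum-mono-≤ {N} λ i →
    *-mono-≤ (0≤^ (toℕ i) 0≤x) (<⇒≤ (0<⁻¹ 0<⟦ toℕ i !⟧)) (^-monoˡ-≤ (toℕ i) 0≤x x≤y) ≤-refl

  private
    expPartialSum-cong : ∀ {x y} N → x ≈ y → E N x ≈ E N y
    expPartialSum-cong N x≈y = sum-cong {N} λ i → *-congʳ (^-congˡ (toℕ i) x≈y)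

    power-increment : ∀ {x y} → 0# ≤ x → 0# ≤ y → ∀ i →
                      (x + y) ^ suc i ≤ x ^ suc i + ⟦ suc i ⟧ * (y * (x + y) ^ i)
    power-increment {x} {y} 0≤x 0≤y zero = ≤-reflexive
      (solve 2 (λ x y → (x :+ y) :* :1 := x :* :1 :+ (:1 :+ # 0) :* (y :* :1)) refl x y)
    power-increment {x} {y} 0≤x 0≤y (suc i) = ≤-by
      (0≤x 0≤* 0≤y-x (power-increment 0≤x 0≤y i) 0≤+
       0≤⟦ suc i ⟧ 0≤* (0≤y 0≤* 0≤y 0≤* 0≤^ i (0≤x 0≤+ 0≤y)))
      (solve 5 (λ x y p q n →
         x :* p :+ (:1 :+ n) :* (y :* ((x :+ y) :* q)) :- (x :+ y) :* ((x :+ y) :* q) :=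
         x :* (p :+ n :* (y :* q) :- (x :+ y) :* q) :+ n :* (y :* y :* q))
         refl x y (x ^ suc i) ((x + y) ^ i) ⟦ suc i ⟧)

    term-increment : ∀ {x y} → 0# ≤ x → 0# ≤ y → ∀ i →
                     term (x + y) (suc i) ≤ term x (suc i) + y * term (x + y) i
    term-increment {x} {y} 0≤x 0≤y i =
      ≤-respʳ (begin
        (x ^ suc i + ⟦ suc i ⟧ * (y * w)) * G
          ≈⟨ solve 5 (λ p n y w g → (p :+ n :* (y :* w)) :* g := p :* g :+ y :* (w :* (n :* g)))
          refl (x ^ suc i) ⟦ suc i ⟧ y w G ⟩
        x ^ suc i * G + y * (w * (⟦ suc i ⟧ * G)) ≈⟨ +-congˡ (*-congˡ (*-congˡ G≈F)) ⟩
        x ^ suc i * G + y * (w * F)              ∎)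
      (≤-by (0≤y-x (power-increment 0≤x 0≤y i) 0≤* <⇒≤ (0<⁻¹ 0<⟦ suc i !⟧))
        (solve 3 (λ a b g → b :* g :- a :* g := (b :- a) :* g) refl ((x + y) ^ suc i)
          (x ^ suc i + ⟦ suc i ⟧ * (y * w)) G))
      where
      open ≈
      w = (x + y) ^ i
      F = ⟦ i ! ⟧ ⁻¹
      G = ⟦ suc i ! ⟧ ⁻¹
      G≈F : ⟦ suc i ⟧ * G ≈ F
      G≈F = begin
        ⟦ suc i ⟧ * G                    ≈⟨ *-identityʳ _ ⟨
        ⟦ suc i ⟧ * G * 1#               ≈⟨ *-congˡ (*-inverseʳ 0<⟦ i !⟧) ⟨
        ⟦ suc i ⟧ * G * (⟦ i ! ⟧ * F)
          ≈⟨ solve 4 (λ n g m f → n :* g :* (m :* f) := n :* m :* g :* f) refl ⟦ suc i ⟧ G ⟦ i ! ⟧ F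
          ⟩
        ⟦ suc i ⟧ * ⟦ i ! ⟧ * G * F      ≈⟨ *-congʳ (*-congʳ (×1-homo-* (suc i) (i !))) ⟨
        ⟦ suc i ! ⟧ * G * F              ≈⟨ *-congʳ (*-inverseʳ 0<⟦ suc i !⟧) ⟩
        1# * F                           ≈⟨ *-identityˡ F ⟩
        F                                ∎

  -- By convexity (x + y)ⁱ⁺¹ - xⁱ⁺¹ ≤ (i + 1) y (x + y)ⁱ, so that
  -- E_N(x + y) ≤ E_N(x) + y E_{N-1}(x + y).
  expPartialSum-increment : ∀ {x y} → 0# ≤ x → 0# ≤ y → ∀ N →
                            (1# - y) * E N (x + y) ≤ E N x
  expPartialSum-increment {x} {y} 0≤x 0≤y zero = ≤-reflexive (zeroʳ _)
  expPartialSum-increment {x} {y} 0≤x 0≤y (suc N) = ≤-by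
    -- `term-increment` accounts for y E_N(x + y), while y E_{N+1}(x + y) is available; the surplus
    -- is nonnegative since partial sums increase.
    (0≤y 0≤* 0≤y-x (expPartialSum-monoʳ {M = N} (0≤x 0≤+ 0≤y) (ℕ.n≤1+n N)) 0≤+ 0≤y-x tail)
    (solve 5 (λ y t e′ e f → t :+ f :- (:1 :- y) :* (t :+ e′) := y :* (t :+ e′ :- e) :+
      (f :+ y :* e :- e′)) refl
      y (term x 0) (sum {N} (λ i → term (x + y) (suc (toℕ i)))) (E N (x + y))
        (sum {N} (λ i → term x (suc (toℕ i)))))
    where
    tail : sum {N} (λ i → term (x + y) (suc (toℕ i))) ≤ sum {N} (λ i → term x (suc (toℕ i))) + y * E
      N (x + y)
    tail = ≤-respʳ (trans (sum-+ {N} _ _) (+-congˡ (sum-* {N} y _)))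
      (sum-mono-≤ {N} (λ i → term-increment 0≤x 0≤y (toℕ i)))

  infix 4 _≼exp-_

  -- Q ≤ exp(-e), expressed through the partial sums of the series.
  record _≼exp-_ (Q e : Carrier) : Set where
    field
      0≤base     : 0# ≤ Q
      0≤exponent : 0# ≤ e
      bound      : ∀ N {s} → 0# ≤ s → Q * E N (s + e) ≤ E N s

  open _≼exp-_ public

  1-y≼ : ∀ {y} → 0# ≤ y → y ≤ 1# → 1# - y ≼exp- y
  1-y≼ 0≤y y≤1 = record
    { 0≤base = 0≤y-x y≤1 ; 0≤exponent = 0≤y ; bound = λ N 0≤s → expPartialSum-increment 0≤s 0≤y N }

  1≼0 : 1# ≼exp- 0#
  1≼0 = record
    { 0≤base = 0≤1 ; 0≤exponent = ≤-refl
    ; bound = λ N _ → ≤-reflexive (trans (*-identityˡ _) (expPartialSum-cong N (+-identityʳ _))) }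

  -- The shift `s` in `bound` is what makes the relation multiplicative: `q` is used at `s + d`,
  -- then `p` at `s`.
  ≼-* : ∀ {P Q d e} → P ≼exp- d → Q ≼exp- e → P * Q ≼exp- d + e
  ≼-* {P} {Q} {d} {e} p q = record
    { 0≤base = 0≤base p 0≤* 0≤base q
    ; 0≤exponent = 0≤exponent p 0≤+ 0≤exponent q
    ; bound = λ N {s} 0≤s → ≤-trans
        (≤-respˡ (trans (sym (*-assoc P Q _)) (*-congˡ (expPartialSum-cong N (+-assoc s d e))))
          (*-monoʳ-≤ (0≤base p) (bound q N (0≤s 0≤+ 0≤exponent p))))
        (bound p N 0≤s)
    }

  ≼-weaken : ∀ {Q d e} → 0# ≤ d → d ≤ e → Q ≼exp- e → Q ≼exp- d
  ≼-weaken 0≤d d≤e q = record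
    { 0≤base = 0≤base q ; 0≤exponent = 0≤d
    ; bound = λ N 0≤s → ≤-trans
        (*-monoʳ-≤ (0≤base q) (expPartialSum-monoˡ N (0≤s 0≤+ 0≤d) (+-mono-≤ ≤-refl d≤e)))
        (bound q N 0≤s)
    }

  ≼-^ : ∀ {Q e} n → Q ≼exp- e → Q ^ n ≼exp- ⟦ n ⟧ * e
  ≼-^ {e = e} zero q = ≼-weaken (≤-reflexive (sym (zeroˡ e))) (≤-reflexive (zeroˡ e)) 1≼0
  ≼-^ {e = e} (suc n) q = ≼-weaken (0≤⟦ suc n ⟧ 0≤* 0≤exponent q)
    (≤-reflexive (solve 2 (λ n e → (:1 :+ n) :* e := e :+ n :* e) refl ⟦ n ⟧ e)) (≼-* q (≼-^ n q))

  private
    expPartialSum-0 : ∀ N → E N 0# ≤ 1#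
    expPartialSum-0 zero    = 0≤1
    expPartialSum-0 (suc N) = ≤-reflexive (begin
      1# * (1# + 0#) ⁻¹ + sum {N} (λ i → term 0# (suc (toℕ i)))
        ≈⟨ +-cong (trans (*-congʳ (sym (+-identityʳ 1#))) (*-inverseʳ 0<⟦1+ 0 ⟧))
          (sum-cong {N} (λ i → trans (*-congʳ (zeroˡ _)) (zeroˡ _))) ⟩
      1# + sum {N} (λ _ → 0#)   ≈⟨ +-congˡ (trans (sum-const {N} 0#) (zeroʳ ⟦ N ⟧)) ⟩
      1# + 0#                   ≈⟨ +-identityʳ 1# ⟩
      1#                        ∎)
      where open ≈

  -- At s = 0 every partial sum satisfies Q E_N(e) ≤ E_N(0) ≤ 1. If Q z exceeded 1, a partial sum
  -- within (Q z - 1) / Q of z would violate this.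
  ≼-IsExp : ∀ {Q e z} → Q ≼exp- e → IsExp e z → Q * z ≤ 1#
  ≼-IsExp {Q} {e} {z} q exp with Q * z ≤? 1#
  ... | yes Qz≤1 = Qz≤1
  ... | no  Qz≰1 = contradiction QE≤1 (<⇒≱ 1<QE)
    where
    1<Qz = ≰⇒> Qz≰1
    0<Q : 0# < Q
    0<Q = 0≤base q , λ 0≈Q → <⇒≱ 1<Qz (≤-respˡ (trans (sym (zeroˡ z)) (*-congʳ 0≈Q)) 0≤1)
    η = (Q * z - 1#) / Q
    0<η : 0# < η
    0<η = 0<y-x 1<Qz 0<* 0<⁻¹ 0<Q
    N = proj₁ (exp η 0<η)
    close : - η < E N e - z
    close = proj₁ (proj₂ (exp η 0<η) N ℕ.≤-refl)
    1<QE : 1# < Q * E N e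
    1<QE = <-by (0<Q 0<* 0<y-x close) (begin
      Q * E N e - 1#                 ≈⟨ solve 4
        (λ q e z o → q :* e :- o := q :* (e :- z) :+ (q :* z :- o)) refl Q (E N e) z 1# ⟩
      Q * (E N e - z) + (Q * z - 1#) ≈⟨ +-congˡ (*-/-cancel _ 0<Q) ⟨
      Q * (E N e - z) + Q * η        ≈⟨ solve 3 (λ q a b → q :* a :+ q :* b := q :* (a :- :- b))
        refl Q _ η ⟩
      Q * (E N e - z - - η)          ∎)
      where open ≈
    QE≤1 : Q * E N e ≤ 1#
    QE≤1 = ≤-trans (≤-respˡ (*-congˡ (expPartialSum-cong N (+-identityˡ e))) (bound q N ≤-refl))
      (expPartialSum-0 N)

  -- For a ≥ 0 the partial sums increase, so one that exceeded the limit would keep all later ones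
  -- at least that far above it.
  expPartialSum≤exp : ∀ {a z} → 0# ≤ a → IsExp a z → ∀ N → E N a ≤ z
  expPartialSum≤exp {a} {z} 0≤a exp N with E N a ≤? z
  ... | yes E≤z = E≤z
  ... | no  E≰z = contradiction (expPartialSum-monoʳ 0≤a (ℕ.m≤m+n N M)) (<⇒≱ E<E)
    where
    0<η = 0<y-x (≰⇒> E≰z)
    M = proj₁ (exp _ 0<η)
    E<E : E (N ℕ.+ M) a < E N a
    E<E = <-by (0<y-x (proj₂ (proj₂ (exp _ 0<η) (N ℕ.+ M) (ℕ.m≤n+m M N))))
      (solve 3 (λ a b z → b :- a := b :- z :- (a :- z)) refl (E (N ℕ.+ M) a) (E N a) z)

  -- 1 + a + a²/2 at a = 5/4 is 97/32.
  exp≥3 : ∀ {a z} → ⟦ 5 ⟧ ≤ ⟦ 4 ⟧ * a → IsExp a z → ⟦ 3 ⟧ ≤ z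
  exp≥3 {a} {z} 5≤4a exp = ≤-trans (*-cancelˡ-≤ 0<⟦1+ 31 ⟧ 32*3≤32E) (expPartialSum≤exp 0≤a exp 3)
    where
    open ≈
    0≤a : 0# ≤ a
    0≤a = *-cancelˡ-≤ 0<⟦1+ 3 ⟧ (≤-respˡ (sym (zeroʳ _)) (≤-trans 0≤⟦ 5 ⟧ 5≤4a))
    i₁ = ⟦ 1 ⟧ ⁻¹
    i₂ = ⟦ 2 ⟧ ⁻¹
    32E : ⟦ 32 ⟧ * E 3 a ≈ ⟦ 32 ⟧ + ⟦ 32 ⟧ * a + ⟦ 16 ⟧ * (a * a)
    32E = begin
      ⟦ 32 ⟧ * E 3 a
        ≈⟨ solve 3 (λ a i j → # 32 :* (:1 :* i :+ (a :* :1 :* i :+ (a :* (a :* :1) :* j :+ # 0))) :=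
          # 32 :* (# 1 :* i) :+ # 32 :* a :* (# 1 :* i) :+ # 16 :* (a :* a) :* (# 2 :* j)) refl a i₁
          i₂ ⟩
      ⟦ 32 ⟧ * (⟦ 1 ⟧ * i₁) + ⟦ 32 ⟧ * a * (⟦ 1 ⟧ * i₁) + ⟦ 16 ⟧ * (a * a) * (⟦ 2 ⟧ * i₂)
        ≈⟨ +-cong (+-cong (*-congˡ (*-inverseʳ 0<⟦1+ 0 ⟧)) (*-congˡ (*-inverseʳ 0<⟦1+ 0 ⟧)))
          (*-congˡ (*-inverseʳ 0<⟦1+ 1 ⟧)) ⟩
      ⟦ 32 ⟧ * 1# + ⟦ 32 ⟧ * a * 1# + ⟦ 16 ⟧ * (a * a) * 1#
        ≈⟨ solve 1 (λ a → # 32 :* :1 :+ # 32 :* a :* :1 :+ # 16 :* (a :* a) :* :1 := # 32 :+ # 32 :*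
          a :+ # 16 :* (a :* a)) refl a ⟩
      ⟦ 32 ⟧ + ⟦ 32 ⟧ * a + ⟦ 16 ⟧ * (a * a) ∎
    32*3≤32E : ⟦ 32 ⟧ * ⟦ 3 ⟧ ≤ ⟦ 32 ⟧ * E 3 a
    32*3≤32E = ≤-respʳ (sym 32E) (≤-by
      (0≤y-x 5≤4a 0≤* (0≤⟦ 4 ⟧ 0≤* 0≤a 0≤+ 0≤⟦ 13 ⟧) 0≤+ 0≤1)
      (solve 1 (λ a → # 32 :+ # 32 :* a :+ # 16 :* (a :* a) :- # 32 :* # 3 := (# 4 :* a :- # 5) :*
        (# 4 :* a :+ # 13) :+ :1) refl a))

-- Expectations over decision trees and independence.

module Expectation (ℝ : CompleteOrderedField) where

  open Reals ℝ
  open OrderedField ℝ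
  open FiniteSums ℝ
  open Exponential ℝ
  open CompleteOrderedField ℝ using (*-commutativeMonoid)
  open import Algebra.Properties.CommutativeMonoid.Sum *-commutativeMonoid public
    using () renaming (sum to product; ∑-distrib-+ to product-*)
  import Relation.Binary.Reasoning.Setoid setoid as ≈

  product-nonneg : ∀ {n} {f : Fin n → Carrier} → (∀ i → 0# ≤ f i) → 0# ≤ product f
  product-nonneg {zero}  0≤f = 0≤1
  product-nonneg {suc n} 0≤f = 0≤f zero 0≤* product-nonneg (λ i → 0≤f (suc i))

  product-mono-≤ : ∀ {n} {f g : Fin n → Carrier} → (∀ i → 0# ≤ f i) → (∀ i → f i ≤ g i) →
                   product f ≤ product g
  product-mono-≤ {zero}  0≤f f≤g = ≤-refl
  product-mono-≤ {suc n} 0≤f f≤g = *-mono-≤ (0≤f zero)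
    (product-nonneg (λ i → ≤-trans (0≤f (suc i)) (f≤g (suc i)))) (f≤g zero)
    (product-mono-≤ (λ i → 0≤f (suc i)) (λ i → f≤g (suc i)))

  ≼-product : ∀ {n} {Q e : Fin n → Carrier} → (∀ i → Q i ≼exp- e i) → product Q ≼exp- sum e
  ≼-product {zero}  Q≼e = 1≼0
  ≼-product {suc n} Q≼e = ≼-* (Q≼e zero) (≼-product (λ i → Q≼e (suc i)))

  𝔼 : {A : Set} → (A → Carrier) → Rand A → Carrier
  𝔼 f (return a) = f a
  𝔼 f (coin p g) = p * 𝔼 f (g true) + (1# - p) * 𝔼 f (g false)

  -- `Rand` admits arbitrary field elements as coin labels; monotonicity of `𝔼` is a matter of
  -- labels in [0, 1].
  Valid : {A : Set} → Rand A → Set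
  Valid (return _) = ⊤
  Valid (coin p g) = (0# ≤ p × p ≤ 1#) × (∀ h → Valid (g h))

  Pr≈𝔼 : {A : Set} {P : A → Set} (P? : Decidable P) (r : Rand A) →
         Pr P? r ≈ 𝔼 (λ a → 1# when does (P? a)) r
  Pr≈𝔼 P? (return a) = refl
  Pr≈𝔼 P? (coin p g) = +-cong (*-congˡ (Pr≈𝔼 P? (g true))) (*-congˡ (Pr≈𝔼 P? (g false)))

  𝔼-cong : {A : Set} {f g : A → Carrier} → (∀ a → f a ≈ g a) → ∀ r → 𝔼 f r ≈ 𝔼 g r
  𝔼-cong f≈g (return a) = f≈g a
  𝔼-cong f≈g (coin p h) = +-cong (*-congˡ (𝔼-cong f≈g (h true))) (*-congˡ (𝔼-cong f≈g (h false)))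

  -- The invariant `P` of all leaves lets the comparison use what every run guarantees, such as
  -- `C₁ ⊆ C`.
  𝔼-mono : {A : Set} {P : A → Set} {f g : A → Carrier} → (∀ a → P a → f a ≤ g a) →
           ∀ r → Valid r → Always P r → 𝔼 f r ≤ 𝔼 g r
  𝔼-mono f≤g (return a) _ Pa = f≤g a Pa
  𝔼-mono f≤g (coin p h) ((0≤p , p≤1) , v) P = +-mono-≤
    (*-monoʳ-≤ 0≤p (𝔼-mono f≤g (h true) (v true) (P true)))
    (*-monoʳ-≤ (0≤y-x p≤1) (𝔼-mono f≤g (h false) (v false) (P false)))

  𝔼-const : ∀ {A : Set} c (r : Rand A) → 𝔼 (λ _ → c) r ≈ c
  𝔼-const c (return a) = refl
  𝔼-const c (coin p h) = trans
    (+-cong (*-congˡ (𝔼-const c (h true))) (*-congˡ (𝔼-const c (h false))))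
    (solve 2 (λ p c → p :* c :+ (:1 :- p) :* c := c) refl p c)

  𝔼-+ : {A : Set} (f g : A → Carrier) → ∀ r → 𝔼 (λ a → f a + g a) r ≈ 𝔼 f r + 𝔼 g r
  𝔼-+ f g (return a) = refl
  𝔼-+ f g (coin p h) = trans
    (+-cong (*-congˡ (𝔼-+ f g (h true))) (*-congˡ (𝔼-+ f g (h false))))
    (solve 6 (λ p q a b c d → p :* (a :+ b) :+ q :* (c :+ d) := p :* a :+ q :* c :+
      (p :* b :+ q :* d)) refl
      p (1# - p) (𝔼 f (h true)) (𝔼 g (h true)) (𝔼 f (h false)) (𝔼 g (h false)))

  𝔼-* : ∀ {A : Set} c (f : A → Carrier) r → 𝔼 (λ a → c * f a) r ≈ c * 𝔼 f r
  𝔼-* c f (return a) = refl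
  𝔼-* c f (coin p h) = trans
    (+-cong (*-congˡ (𝔼-* c f (h true))) (*-congˡ (𝔼-* c f (h false))))
    (solve 5 (λ p q c a b → p :* (c :* a) :+ q :* (c :* b) := c :* (p :* a :+ q :* b)) refl
      p (1# - p) c (𝔼 f (h true)) (𝔼 f (h false)))

  𝔼-sum : ∀ {A : Set} {n} (f : Fin n → A → Carrier) r → 𝔼 (λ a → sum (λ i → f i a)) r ≈ sum
    (λ i → 𝔼 (f i) r)
  𝔼-sum {n = zero}  f r = 𝔼-const 0# r
  𝔼-sum {n = suc n} f r = trans (𝔼-+ (f zero) (λ a → sum (λ i → f (suc i) a)) r)
                            (+-congˡ (𝔼-sum (λ i → f (suc i)) r))

  𝔼->>= : {A B : Set} (f : B → Carrier) (r : Rand A) (g : A → Rand B) → 𝔼 f (r >>= g) ≈ 𝔼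
    (λ a → 𝔼 f (g a)) r
  𝔼->>= f (return a) g = refl
  𝔼->>= f (coin p h) g = +-cong (*-congˡ (𝔼->>= f (h true) g)) (*-congˡ (𝔼->>= f (h false) g))

  Always->>= : {A B : Set} {P : A → Set} {Q : B → Set} (r : Rand A) {g : A → Rand B} →
               Always P r → (∀ a → P a → Always Q (g a)) → Always Q (r >>= g)
  Always->>= (return a) Pa Qg = Qg a Pa
  Always->>= (coin p h) P  Qg = λ b → Always->>= (h b) (P b) Qg

  Always-map : {A : Set} {P Q : A → Set} → (∀ a → P a → Q a) → ∀ r → Always P r → Always Q r
  Always-map P⇒Q (return a) Pa = P⇒Q a Pa
  Always-map P⇒Q (coin p h) P  = λ b → Always-map P⇒Q (h b) (P b)

  Valid->>= : {A B : Set} (r : Rand A) {g : A → Rand B} → Valid r → (∀ a → Valid (g a)) → Valid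
    (r >>= g)
  Valid->>= (return a) _ vg       = vg a
  Valid->>= (coin p h) (p∈ , v) vg = p∈ , λ b → Valid->>= (h b) (v b) vg

  Valid-sequence : ∀ {A : Set} {n} (r : Fin n → Rand A) → (∀ i → Valid (r i)) → Valid
    (sequence (tabulate r))
  Valid-sequence {n = zero}  r v = tt
  Valid-sequence {n = suc n} r v = Valid->>= (r zero) (v zero) λ _ →
    Valid->>= (sequence (tabulate (λ i → r (suc i))))
      (Valid-sequence (λ i → r (suc i)) (λ i → v (suc i))) λ _ → tt

  Always-sequence : ∀ {A : Set} {n} (P : Fin n → A → Set) (r : Fin n → Rand A) →
    (∀ i → Always (P i) (r i)) →
                    Always (λ as → ∀ i → P i (lookup as i)) (sequence (tabulate r))
  Always-sequence {n = zero}  P r a = λ ()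
  Always-sequence {n = suc n} P r a = Always->>= (r zero) (a zero) λ _ p →
    Always->>= (sequence (tabulate (λ i → r (suc i))))
      (Always-sequence (λ i → P (suc i)) (λ i → r (suc i)) (λ i → a (suc i)))
      λ _ ps → λ { zero → p ; (suc i) → ps i }

  heads : Rand Bool → Carrier
  heads = 𝔼 (1# when_)

  -- In expectation a Boolean tree is one coin of bias `heads r`. This hides the k flips of an edge
  -- of C₂ from the computations with independent edges.
  𝔼-Bool : (f : Bool → Carrier) (r : Rand Bool) → 𝔼 f r ≈ heads r * f true + (1# - heads r) * f
    false
  𝔼-Bool f (return true)  = solve 2 (λ a b → a := :1 :* a :+ (:1 :- :1) :* b) refl (f true)
    (f false)
  𝔼-Bool f (return false) = solve 2 (λ a b → b := # 0 :* a :+ (:1 :- # 0) :* b) refl (f true)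
    (f false)
  𝔼-Bool f (coin p h)     = trans
    (+-cong (*-congˡ (𝔼-Bool f (h true))) (*-congˡ (𝔼-Bool f (h false))))
    (solve 5 (λ p s t a b →
       p :* (s :* a :+ (:1 :- s) :* b) :+ (:1 :- p) :* (t :* a :+ (:1 :- t) :* b) :=
       (p :* s :+ (:1 :- p) :* t) :* a :+ (:1 :- (p :* s :+ (:1 :- p) :* t)) :* b) refl
      p (heads (h true)) (heads (h false)) (f true) (f false))

  heads-bounds : ∀ r → Valid r → 0# ≤ heads r × heads r ≤ 1#
  heads-bounds (return true)  _ = 0≤1 , ≤-refl
  heads-bounds (return false) _ = ≤-refl , 0≤1
  heads-bounds (coin p h) ((0≤p , p≤1) , v) =
    (0≤p 0≤* proj₁ (heads-bounds (h true) (v true)) 0≤+ 0≤y-x p≤1 0≤* proj₁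
      (heads-bounds (h false) (v false))) ,
    ≤-by (0≤p 0≤* 0≤y-x (proj₂ (heads-bounds (h true) (v true))) 0≤+
          0≤y-x p≤1 0≤* 0≤y-x (proj₂ (heads-bounds (h false) (v false))))
      (solve 3 (λ p s t → :1 :- (p :* s :+ (:1 :- p) :* t) := p :* (:1 :- s) :+ (:1 :- p) :*
        (:1 :- t)) refl
        p (heads (h true)) (heads (h false)))

  𝔼-sequence-∷ : ∀ {n} (f : Vec Bool (suc n) → Carrier) (r : Fin (suc n) → Rand Bool) →
    let h = heads (r zero)
        rs = sequence (tabulate (λ i → r (suc i)))
    in 𝔼 f (sequence (tabulate r)) ≈ h * 𝔼 (λ as → f (true ∷ as)) rs + (1# - h) * 𝔼
      (λ as → f (false ∷ as)) rs
  𝔼-sequence-∷ f r = trans (𝔼->>= f (r zero) _)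
    (trans (𝔼-cong (λ a → 𝔼->>= f rs _) (r zero))
      (𝔼-Bool (λ a → 𝔼 (λ as → f (a ∷ as)) rs) (r zero)))
    where rs = sequence (tabulate (λ i → r (suc i)))

  successes : ∀ {n} → Vec Bool n → Carrier
  successes as = sum (λ i → 1# when lookup as i)

  -- Induction on the edges: conditioning on the first one shifts the centre by its outcome, hence
  -- the arbitrary `c`. At the mean the first summand vanishes and the variance remains.
  𝔼-successes² : ∀ {n} (r : Fin n → Rand Bool) c →
    𝔼 (λ as → (successes as - c) * (successes as - c)) (sequence (tabulate r)) ≈
    (sum (λ i → heads (r i)) - c) * (sum (λ i → heads (r i)) - c) + sum
      (λ i → heads (r i) * (1# - heads (r i)))
  𝔼-successes² {zero}  r c = sym (+-identityʳ _)
  𝔼-successes² {suc n} r c = begin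
    𝔼 (λ as → (successes as - c) * (successes as - c)) (sequence (tabulate r))
      ≈⟨ 𝔼-sequence-∷ (λ as → (successes as - c) * (successes as - c)) r ⟩
    h * 𝔼 (λ as → (1# + successes as - c) * (1# + successes as - c)) rs +
    (1# - h) * 𝔼 (λ as → (0# + successes as - c) * (0# + successes as - c)) rs
      ≈⟨ +-cong (*-congˡ (step 1#)) (*-congˡ (step 0#)) ⟩
    h * ((μ - (c - 1#)) * (μ - (c - 1#)) + σ²) + (1# - h) * ((μ - (c - 0#)) * (μ - (c - 0#)) + σ²)
      ≈⟨ solve 4 (λ h μ c σ² →
           h :* ((μ :- (c :- :1)) :* (μ :- (c :- :1)) :+ σ²) :+ (:1 :- h) :*
             ((μ :- (c :- # 0)) :* (μ :- (c :- # 0)) :+ σ²) :=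
           (h :+ μ :- c) :* (h :+ μ :- c) :+ (h :* (:1 :- h) :+ σ²)) refl h μ c σ² ⟩
    (h + μ - c) * (h + μ - c) + (h * (1# - h) + σ²) ∎
    where
    open ≈
    h  = heads (r zero)
    rs = sequence (tabulate (λ i → r (suc i)))
    μ  = sum (λ i → heads (r (suc i)))
    σ² = sum (λ i → heads (r (suc i)) * (1# - heads (r (suc i))))
    step : ∀ x → 𝔼 (λ as → (x + successes as - c) * (x + successes as - c)) rs ≈ (μ - (c - x)) *
      (μ - (c - x)) + σ²
    step x = trans
      (𝔼-cong (λ as → solve 3 (λ x s c → (x :+ s :- c) :* (x :+ s :- c) := (s :- (c :- x)) :*
        (s :- (c :- x))) refl x (successes as) c) rs)
      (𝔼-successes² (λ i → r (suc i)) (c - x))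

  𝔼-product : ∀ {n} (r : Fin n → Rand Bool) (g : Fin n → Bool → Carrier) →
    𝔼 (λ as → product (λ i → g i (lookup as i))) (sequence (tabulate r)) ≈
    product (λ i → heads (r i) * g i true + (1# - heads (r i)) * g i false)
  𝔼-product {zero}  r g = refl
  𝔼-product {suc n} r g = begin
    𝔼 (λ as → product (λ i → g i (lookup as i))) (sequence (tabulate r))
      ≈⟨ 𝔼-sequence-∷ (λ as → product (λ i → g i (lookup as i))) r ⟩
    h * 𝔼 (λ as → g zero true * rest as) rs + (1# - h) * 𝔼 (λ as → g zero false * rest as) rs
      ≈⟨ +-cong (*-congˡ (𝔼-* (g zero true) rest rs)) (*-congˡ (𝔼-* (g zero false) rest rs)) ⟩
    h * (g zero true * 𝔼 rest rs) + (1# - h) * (g zero false * 𝔼 rest rs)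
      ≈⟨ solve 4 (λ h a b e → h :* (a :* e) :+ (:1 :- h) :* (b :* e) := (h :* a :+ (:1 :- h) :* b)
        :* e) refl h (g zero true) (g zero false) (𝔼 rest rs) ⟩
    (h * g zero true + (1# - h) * g zero false) * 𝔼 rest rs
      ≈⟨ *-congˡ (𝔼-product (λ i → r (suc i)) (λ i → g (suc i))) ⟩
    product (λ i → heads (r i) * g i true + (1# - heads (r i)) * g i false) ∎
    where
    open ≈
    h  = heads (r zero)
    rs = sequence (tabulate (λ i → r (suc i)))
    rest : Vec Bool _ → Carrier
    rest as = product (λ i → g (suc i) (lookup as i))

  Valid-anyHeads : ∀ k {p} → 0# ≤ p → p ≤ 1# → Valid (anyHeads k p)
  Valid-anyHeads zero    0≤p p≤1 = tt
  Valid-anyHeads (suc k) 0≤p p≤1 = (0≤p , p≤1) , λ _ →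
    Valid->>= (anyHeads k _) (Valid-anyHeads k 0≤p p≤1) λ _ → tt

  heads-anyHeads : ∀ k p → heads (anyHeads k p) ≈ 1# - (1# - p) ^ k
  heads-anyHeads zero    p = sym (-‿inverseʳ 1#)
  heads-anyHeads (suc k) p = begin
    p * heads (anyHeads k p >>= λ _ → return true) + (1# - p) * heads (anyHeads k p >>= return)
      ≈⟨ +-cong (*-congˡ (trans (𝔼->>= (1# when_) (anyHeads k p) _) (𝔼-const 1# (anyHeads k p))))
        (*-congˡ (𝔼->>= (1# when_) (anyHeads k p) return)) ⟩
    p * 1# + (1# - p) * heads (anyHeads k p)
      ≈⟨ +-congˡ (*-congˡ (heads-anyHeads k p)) ⟩
    p * 1# + (1# - p) * (1# - (1# - p) ^ k)
      ≈⟨ solve 2 (λ p q → p :* :1 :+ (:1 :- p) :* (:1 :- q) := :1 :- (:1 :- p) :* q) refl p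
        ((1# - p) ^ k) ⟩
    1# - (1# - p) ^ suc k ∎
    where open ≈

-- Consequences of optimality for the linear program.

module LinearProgram
  (ℝ : CompleteOrderedField)
  {n m : ℕ} (H : Hypergraph (suc n) m)
  (b : Fin (suc n) → ℕ)
  (2≤b : ∀ v → 2 ℕ.≤ b v)
  (b≤deg-1 : ∀ v → b v ℕ.≤ Hypergraph.degree H v ∸ 1)
  (x : Fin m → Reals.Carrier ℝ)
  (optimal : Reals.IsLPOptimal ℝ H b x)
  where

  open Reals ℝ
  open Hypergraph H
  open OrderedField ℝ
  open FiniteSums ℝ
  import Relation.Binary.Reasoning.Setoid setoid as ≈

  β δ∸1 : ℕ
  β   = minimum b
  δ∸1 = maxDegree ∸ β

  -- δ is the δ of the paper, and D is δ - 1.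
  D δ Opt : Carrier
  D   = ⟦ δ∸1 ⟧
  δ   = ⟦ suc δ∸1 ⟧
  Opt = sum x

  Σ⋆ : Fin (suc n) → (Fin m → Carrier) → Carrier
  Σ⋆ v f = sum (λ j → f j when lookup (edge j) v)

  covers : ∀ v → ⟦ b v ⟧ ≤ Σ⋆ v x
  covers = proj₁ (proj₁ optimal)

  0≤x : ∀ j → 0# ≤ x j
  0≤x j = proj₁ (proj₂ (proj₁ optimal) j)

  x≤1 : ∀ j → x j ≤ 1#
  x≤1 j = proj₂ (proj₂ (proj₁ optimal) j)

  β≤b : ∀ v → β ℕ.≤ b v
  β≤b = All.tabulate⁻ (Extrema.min≤xs (b zero) (List.tabulate b))

  2≤β : 2 ℕ.≤ β
  2≤β = Extrema.v≤min⁺ (2≤b zero) (All.tabulate⁺ 2≤b)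

  degree≤Δ : ∀ v → degree v ℕ.≤ maxDegree
  degree≤Δ = All.tabulate⁻ (Extrema.xs≤max 0 (List.tabulate degree))

  ∣edge∣≤ℓ : ∀ j → ∣ edge j ∣ ℕ.≤ maxEdgeSize
  ∣edge∣≤ℓ = All.tabulate⁻ (Extrema.xs≤max 0 (List.tabulate (λ j → ∣ edge j ∣)))

  b<degree : ∀ v → b v ℕ.< degree v
  b<degree v with degree v | b≤deg-1 v
  -- The hypothesis uses truncated subtraction; degree 0 is excluded by b ≥ 2.
  ... | zero  | b≤0 = contradiction (ℕ.≤-trans (2≤b v) b≤0) λ ()
  ... | suc d | b≤d = s≤s b≤d

  degree≤ : ∀ v → degree v ℕ.≤ δ∸1 ℕ.+ b v
  degree≤ v = ℕ.≤-trans (degree≤Δ v) (ℕ.≤-trans (ℕ.m≤n+m∸n maxDegree β)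
    (ℕ.≤-trans (ℕ.≤-reflexive (ℕ.+-comm β δ∸1)) (ℕ.+-monoʳ-≤ δ∸1 (β≤b v))))

  -- From b < d(v) ≤ (Δ - β) + b at any vertex; hence δ ≥ 2 and the truncated difference is a
  -- genuine one.
  1≤δ∸1 : 1 ℕ.≤ δ∸1
  1≤δ∸1 = ℕ.+-cancelʳ-≤ (b zero) 1 δ∸1 (ℕ.≤-trans (b<degree zero) (degree≤ zero))

  1≤D : 1# ≤ D
  1≤D = ≤-respˡ (+-identityʳ 1#) (⟦⟧-mono-≤ 1≤δ∸1)

  0≤D : 0# ≤ D
  0≤D = 0≤⟦ δ∸1 ⟧

  0<δ : 0# < δ
  0<δ = 0<⟦1+ δ∸1 ⟧

  ⟦degree⟧≤ : ∀ v → ⟦ degree v ⟧ ≤ D + ⟦ b v ⟧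
  ⟦degree⟧≤ v = ≤-respʳ (×-homo-+ 1# δ∸1 (b v)) (⟦⟧-mono-≤ (degree≤ v))

  2≤⟦b⟧ : ∀ v → ⟦ 2 ⟧ ≤ ⟦ b v ⟧
  2≤⟦b⟧ v = ⟦⟧-mono-≤ (2≤b v)

  Σ⋆-mono : ∀ v {f g} → (∀ j → f j ≤ g j) → Σ⋆ v f ≤ Σ⋆ v g
  Σ⋆-mono v {f} {g} f≤g = sum-mono-≤ pointwise
    where
    pointwise : ∀ j → f j when lookup (edge j) v ≤ g j when lookup (edge j) v
    pointwise j with lookup (edge j) v
    ... | true  = f≤g j
    ... | false = ≤-refl

  -- Summands below are written in the shape `s * f j + t * g j` to fit this lemma, whence the
  -- redundant factors `1#` and `- 1#`.
  Σ⋆-linear : ∀ v s f t g → Σ⋆ v (λ j → s * f j + t * g j) ≈ s * Σ⋆ v f + t * Σ⋆ v g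
  Σ⋆-linear v s f t g = trans (sum-cong pointwise)
    (trans (sum-+ (λ j → s * (f j when lookup (edge j) v)) (λ j → t * (g j when lookup (edge j) v)))
      (+-cong (sum-* s (λ j → f j when lookup (edge j) v))
        (sum-* t (λ j → g j when lookup (edge j) v))))
    where
    pointwise : ∀ j → (s * f j + t * g j) when lookup (edge j) v ≈
                      s * (f j when lookup (edge j) v) + t * (g j when lookup (edge j) v)
    pointwise j with lookup (edge j) v
    ... | true  = refl
    ... | false = solve 2 (λ s t → # 0 := s :* # 0 :+ t :* # 0) refl s t

  lookup-star∩ : ∀ v C j → lookup (star v ∩ C) j ≡ lookup (edge j) v ∧ lookup C j
  lookup-star∩ v C j = ≡.trans (lookup-zipWith _∧_ j (star v) C)
    (≡.cong (_∧ lookup C j) (lookup∘tabulate (λ j → lookup (edge j) v) j))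

  ⟦∣star∩∣⟧ : ∀ v C → ⟦ ∣ star v ∩ C ∣ ⟧ ≈ Σ⋆ v (λ j → 1# when lookup C j)
  ⟦∣star∩∣⟧ v C = trans (⟦∣∣⟧ (star v ∩ C)) (sum-cong λ j → reflexive (pointwise j))
    where
    when-∧ : ∀ s t → 1# when (s ∧ t) ≡ (1# when t) when s
    when-∧ true  t = ≡.refl
    when-∧ false t = ≡.refl
    pointwise : ∀ j → 1# when lookup (star v ∩ C) j ≡ (1# when lookup C j) when lookup (edge j) v
    pointwise j = ≡.trans (≡.cong (1# when_) (lookup-star∩ v C j))
      (when-∧ (lookup (edge j) v) (lookup C j))

  ⟦degree⟧ : ∀ v → ⟦ degree v ⟧ ≈ Σ⋆ v (λ _ → 1#)
  ⟦degree⟧ v = trans (⟦∣∣⟧ (star v)) (sum-cong λ j →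
    reflexive (≡.cong (1# when_) (lookup∘tabulate (λ j → lookup (edge j) v) j)))

  Fractional : Fin m → Set
  Fractional j = 0# < x j × x j < 1#

  fractional? : ∀ j → Dec (Fractional j)
  fractional? j = (0# <? x j) ×-dec (x j <? 1#)

  one : Fin m → Bool
  one j = does (1# ≤? x j)

  private
    -- Each coordinate admits a positive step and all shorter ones, so the least of finitely many
    -- steps serves all coordinates.
    commonScale : ∀ {n} (P : Fin n → Carrier → Set) →
                  (∀ i {s t} → s ≤ t → P i t → P i s) →
                  (∀ i → ∃[ t ] 0# < t × P i t) → ∃[ t ] 0# < t × ∀ i → P i t
    commonScale {zero}  P down w = 1# , 0<1 , λ ()
    commonScale {suc n} P down w
      with w zero | commonScale (λ i → P (suc i)) (λ i → down (suc i)) (λ i → w (suc i))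
    ... | s , 0<s , Ps | t , 0<t , Pt with ≤-total s t
    ... | inj₁ s≤t = s , 0<s , λ { zero → Ps ; (suc i) → down (suc i) s≤t (Pt i) }
    ... | inj₂ t≤s = t , 0<t , λ { zero → down zero t≤s Ps ; (suc i) → Pt i }

  -- If d does not decrease the coverage of any vertex that needs fractional
  -- edges, then x + t d is feasible for small t > 0.
  optimal-direction : ∀ (d : Fin m → Carrier) θ → 0# < θ →
    (∀ j → d j ≈ 0# ⊎ Fractional j × - θ ≤ d j × d j ≤ θ) →
    (∀ v → ⟦ b v ⟧ ≤ Σ⋆ v (λ j → 1# when one j) ⊎ 0# ≤ Σ⋆ v d) →
    0# ≤ sum d
  optimal-direction d θ 0<θ dir cov = *-cancelˡ-≤ 0<t
    (≤-respˡ (sym (zeroʳ t)) (≤-by (0≤y-x (proj₂ optimal y y-feasible))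
      (trans (solve 2 (λ a s → a :- # 0 := s :+ a :- s) refl (t * sum d) Opt)
        (+-congʳ (sym sum-y)))))
    where
    -- Since |d j| ≤ θ, a step t with t θ below both x j and 1 - x j cannot leave [0, 1].
    Scale : Fin m → Carrier → Set
    Scale j t = d j ≈ 0# ⊎ t * θ ≤ x j × t * θ ≤ 1# - x j × - θ ≤ d j × d j ≤ θ

    down : ∀ j {s t} → s ≤ t → Scale j t → Scale j s
    down j s≤t (inj₁ d≈0) = inj₁ d≈0
    down j {s} {t} s≤t (inj₂ (p , q , r)) = inj₂ (≤-trans sθ≤tθ p , ≤-trans sθ≤tθ q , r)
      where
      sθ≤tθ : s * θ ≤ t * θ
      sθ≤tθ = ≤-respˡ (*-comm θ s) (≤-respʳ (*-comm θ t) (*-monoʳ-≤ (<⇒≤ 0<θ) s≤t))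

    scale : ∀ j → ∃[ t ] 0# < t × Scale j t
    scale j with dir j
    ... | inj₁ d≈0 = 1# , 0<1 , inj₁ d≈0
    ... | inj₂ ((0<x , x<1) , bounds) with ≤-total (x j) (1# - x j)
    ... | inj₁ x≤1-x = x j / θ , 0<x 0<* 0<⁻¹ 0<θ , inj₂
      (≤-reflexive eq , ≤-trans (≤-reflexive eq) x≤1-x , bounds)
      where eq = trans (*-comm _ θ) (*-/-cancel (x j) 0<θ)
    ... | inj₂ 1-x≤x = (1# - x j) / θ , 0<y-x x<1 0<* 0<⁻¹ 0<θ , inj₂
      (≤-trans (≤-reflexive eq) 1-x≤x , ≤-reflexive eq , bounds)
      where eq = trans (*-comm _ θ) (*-/-cancel (1# - x j) 0<θ)

    scaled = commonScale Scale down scale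
    t : Carrier
    t = proj₁ scaled
    0<t : 0# < t
    0<t = proj₁ (proj₂ scaled)

    y : Fin m → Carrier
    y j = x j + t * d j

    y≈x : ∀ j → d j ≈ 0# → y j ≈ x j
    y≈x j d≈0 = trans (+-congˡ (trans (*-congˡ d≈0) (zeroʳ t))) (+-identityʳ (x j))

    y-bounds : ∀ j → 0# ≤ y j × y j ≤ 1#
    y-bounds j with proj₂ (proj₂ scaled) j
    ... | inj₁ d≈0 = ≤-respʳ (sym (y≈x j d≈0)) (0≤x j) , ≤-respˡ (sym (y≈x j d≈0)) (x≤1 j)
    ... | inj₂ (tθ≤x , tθ≤1-x , -θ≤d , d≤θ) =
      ≤-by (0≤y-x tθ≤x 0≤+ <⇒≤ 0<t 0≤* 0≤y-x -θ≤d)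
        (solve 4 (λ x t θ d → x :+ t :* d :- # 0 := x :- t :* θ :+ t :* (d :- :- θ)) refl (x j) t θ
          (d j)) ,
      ≤-by (0≤y-x tθ≤1-x 0≤+ <⇒≤ 0<t 0≤* 0≤y-x d≤θ)
        (solve 4 (λ x t θ d → :1 :- (x :+ t :* d) := :1 :- x :- t :* θ :+ t :* (θ :- d)) refl (x j)
          t θ (d j))

    -- Edges of value one do not move, so vertices with enough of them stay covered whatever happens
    -- to their fractional edges.
    one≤y : ∀ j → 1# when one j ≤ y j
    one≤y j with 1# ≤? x j
    ... | no  _   = proj₁ (y-bounds j)
    ... | yes 1≤x with dir j
    ...   | inj₁ d≈0 = ≤-respʳ (sym (y≈x j d≈0)) 1≤x
    ...   | inj₂ ((_ , x<1) , _) = contradiction 1≤x (<⇒≱ x<1)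

    Σ⋆-y : ∀ v → Σ⋆ v y ≈ Σ⋆ v x + t * Σ⋆ v d
    Σ⋆-y v = begin
      Σ⋆ v y                              ≈⟨ sum-cong pointwise ⟩
      Σ⋆ v (λ j → 1# * x j + t * d j)     ≈⟨ Σ⋆-linear v 1# x t d ⟩
      1# * Σ⋆ v x + t * Σ⋆ v d            ≈⟨ +-congʳ (*-identityˡ _) ⟩
      Σ⋆ v x + t * Σ⋆ v d                 ∎
      where
      open ≈
      pointwise : ∀ j → y j when lookup (edge j) v ≈ (1# * x j + t * d j) when lookup (edge j) v
      pointwise j with lookup (edge j) v
      ... | true  = +-congʳ (sym (*-identityˡ _))
      ... | false = refl

    y-feasible : IsLPFeasible H b y
    y-feasible = y-covers , y-bounds
      where
      y-covers : ∀ v → ⟦ b v ⟧ ≤ Σ⋆ v y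
      y-covers v with cov v
      ... | inj₁ b≤ones = ≤-trans b≤ones (Σ⋆-mono v one≤y)
      ... | inj₂ 0≤Σd   = ≤-trans (covers v) (≤-by (<⇒≤ 0<t 0≤* 0≤Σd)
        (trans (+-congʳ (Σ⋆-y v)) (solve 2 (λ a b → a :+ b :- a := b) refl (Σ⋆ v x) (t * Σ⋆ v d))))

    sum-y : sum y ≈ Opt + t * sum d
    sum-y = trans (sum-+ x (λ j → t * d j)) (+-congˡ (sum-* t d))

  ones : Subset m
  ones = tabulate one

  support : Subset m
  support = tabulate (λ j → does (0# <? x j))

  ⟦ones⟧ : ⟦ ∣ ones ∣ ⟧ ≈ sum (λ j → 1# when one j)
  ⟦ones⟧ = trans (⟦∣∣⟧ ones) (sum-cong λ j → reflexive (≡.cong (1# when_) (lookup∘tabulate one j)))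

  ⟦support⟧ : ⟦ ∣ support ∣ ⟧ ≈ sum (λ j → 1# when does (0# <? x j))
  ⟦support⟧ = trans (⟦∣∣⟧ support)
    (sum-cong λ j → reflexive (≡.cong (1# when_) (lookup∘tabulate (λ j → does (0# <? x j)) j)))

  fractionalExcess : Carrier → Fin m → Carrier
  fractionalExcess θ j = (θ * x j - 1#) when does (fractional? j)

  -- The direction may move only fractional edges, but the size bound concerns θ Opt - S over all
  -- edges. Elsewhere the summand is constant: 0 at x j = 0 and θ - 1 at x j = 1.
  excess-split : ∀ θ j →
    θ * x j - 1# when does (0# <? x j) ≈ fractionalExcess θ j + (θ - 1#) * (1# when one j)
  excess-split θ j with 0# <? x j | x j <? 1# | 1# ≤? x j
  ... | yes 0<x | yes x<1 | yes 1≤x = contradiction 1≤x (<⇒≱ x<1)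
  ... | yes 0<x | yes x<1 | no  1≰x = solve 2
    (λ θ x → θ :* x :- :1 := θ :* x :- :1 :+ (θ :- :1) :* # 0) refl θ (x j)
  ... | yes 0<x | no  x≮1 | yes 1≤x = trans
    (+-congʳ (trans (*-congˡ (≤-antisym (x≤1 j) 1≤x)) (*-identityʳ θ)))
    (solve 1 (λ θ → θ :- :1 := # 0 :+ (θ :- :1) :* :1) refl θ)
  ... | yes 0<x | no  x≮1 | no  1≰x = contradiction (≰⇒> 1≰x) x≮1
  ... | no  0≮x | _       | yes 1≤x = contradiction (<-≤-trans 0<1 1≤x) 0≮x
  ... | no  0≮x | _       | no  1≰x = trans
    (+-congʳ (trans (*-congˡ (≤-antisym (≮⇒≥ 0≮x) (0≤x j))) (zeroʳ θ)))
    (solve 1 (λ θ → # 0 :- # 0 := # 0 :+ (θ :- :1) :* # 0) refl θ)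

  sum-excess : ∀ θ → θ * Opt - ⟦ ∣ support ∣ ⟧ ≈ sum (fractionalExcess θ) + (θ - 1#) * ⟦ ∣ ones ∣ ⟧
  sum-excess θ = begin
    θ * Opt - ⟦ ∣ support ∣ ⟧
      ≈⟨ +-cong (sym (sum-* θ x)) (-‿cong ⟦support⟧) ⟩
    sum (λ j → θ * x j) - sum (λ j → 1# when does (0# <? x j))
      ≈⟨ sum-- (λ j → θ * x j) (λ j → 1# when does (0# <? x j)) ⟨
    sum (λ j → θ * x j - 1# when does (0# <? x j))
      ≈⟨ sum-cong (excess-split θ) ⟩
    sum (λ j → fractionalExcess θ j + (θ - 1#) * (1# when one j))
      ≈⟨ trans (sum-+ (fractionalExcess θ) (λ j → (θ - 1#) * (1# when one j)))
        (+-congˡ (trans (sum-* (θ - 1#) (λ j → 1# when one j)) (*-congˡ (sym ⟦ones⟧)))) ⟩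
    sum (fractionalExcess θ) + (θ - 1#) * ⟦ ∣ ones ∣ ⟧ ∎
    where open ≈

  -- At a vertex with p < b ones the coverage changes at a rate of at least θ b - d(v) - (θ - 1) p:
  -- edges of value 0 are counted as -1 too, which only lowers the estimate and lets the whole
  -- degree be subtracted.
  0≤fractionalExcess : ∀ θ → 1# ≤ θ →
    (∀ v → ∣ star v ∩ ones ∣ ℕ.< b v →
      ⟦ degree v ⟧ + (θ - 1#) * ⟦ ∣ star v ∩ ones ∣ ⟧ ≤ θ * ⟦ b v ⟧) →
    0# ≤ sum (fractionalExcess θ)
  0≤fractionalExcess θ 1≤θ enough = optimal-direction (fractionalExcess θ) θ (<-≤-trans 0<1 1≤θ) dir
    cov
    where
    dir : ∀ j → fractionalExcess θ j ≈ 0# ⊎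
                Fractional j × - θ ≤ fractionalExcess θ j × fractionalExcess θ j ≤ θ
    dir j with 0# <? x j | x j <? 1#
    ... | no  _   | _       = inj₁ refl
    ... | yes _   | no  _   = inj₁ refl
    ... | yes 0<x | yes x<1 = inj₂ ((0<x , x<1) ,
      ≤-by (0≤y-x 1≤θ 0≤+ 0≤θ 0≤* 0≤x j)
        (solve 2 (λ θ x → θ :* x :- :1 :- :- θ := θ :- :1 :+ θ :* x) refl θ (x j)) ,
      ≤-by (0≤θ 0≤* 0≤y-x (x≤1 j) 0≤+ 0≤1)
        (solve 2 (λ θ x → θ :- (θ :* x :- :1) := θ :* (:1 :- x) :+ :1) refl θ (x j)))
      where 0≤θ = ≤-trans 0≤1 1≤θ

    pointwise : ∀ j → θ * x j + (- 1# * 1# + (1# - θ) * (1# when one j)) ≤ fractionalExcess θ j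
    pointwise j = ≤-by (0≤y-x supp≤1) (begin
      f - (θ * x j + (- 1# * 1# + (1# - θ) * o))
        ≈⟨ solve 4 (λ θ x o f → f :- (θ :* x :+ (:- :1 :* :1 :+ (:1 :- θ) :* o)) := f :+ (θ :- :1)
          :* o :- θ :* x :+ :1) refl θ (x j) o f ⟩
      f + (θ - 1#) * o - θ * x j + 1#
        ≈⟨ +-congʳ (+-congʳ (excess-split θ j)) ⟨
      θ * x j - 1# when does (0# <? x j) - θ * x j + 1#
        ≈⟨ solve 2 (λ a s → a :- s :- a :+ :1 := :1 :- s) refl (θ * x j) (1# when does (0# <? x j))
          ⟩
      1# - 1# when does (0# <? x j) ∎)
      where
      open ≈
      f = fractionalExcess θ j
      o = 1# when one j
      supp≤1 : 1# when does (0# <? x j) ≤ 1#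
      supp≤1 with 0# <? x j
      ... | yes _ = ≤-refl
      ... | no  _ = 0≤1

    cov : ∀ v → ⟦ b v ⟧ ≤ Σ⋆ v (λ j → 1# when one j) ⊎ 0# ≤ Σ⋆ v (fractionalExcess θ)
    cov v with b v ℕ.≤? ∣ star v ∩ ones ∣
    ... | yes b≤p = inj₁ (≤-respʳ (trans (⟦∣star∩∣⟧ v ones) eq) (⟦⟧-mono-≤ b≤p))
      where
      eq : Σ⋆ v (λ j → 1# when lookup ones j) ≈ Σ⋆ v (λ j → 1# when one j)
      eq = sum-cong λ j → reflexive (≡.cong (λ s → (1# when s) when lookup (edge j) v)
        (lookup∘tabulate one j))
    ... | no  b≰p = inj₂ (≤-trans (≤-by
        ((≤-trans 0≤1 1≤θ) 0≤* 0≤y-x (covers v) 0≤+ 0≤y-x (enough v (ℕ.≰⇒> b≰p)))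
        (trans (+-congʳ total)
          (solve 5 (λ θ s d p b → θ :* s :+ (:- :1 :* d :+ (:1 :- θ) :* p) :- # 0 := θ :* (s :- b)
            :+ (θ :* b :- (d :+ (θ :- :1) :* p))) refl
            θ (Σ⋆ v x) ⟦ degree v ⟧ ⟦ ∣ star v ∩ ones ∣ ⟧ ⟦ b v ⟧)))
        (Σ⋆-mono v pointwise))
      where
      open ≈
      total : Σ⋆ v (λ j → θ * x j + (- 1# * 1# + (1# - θ) * (1# when one j))) ≈
              θ * Σ⋆ v x + (- 1# * ⟦ degree v ⟧ + (1# - θ) * ⟦ ∣ star v ∩ ones ∣ ⟧)
      total = begin
        Σ⋆ v (λ j → θ * x j + (- 1# * 1# + (1# - θ) * (1# when one j)))
          ≈⟨ sum-cong (λ j → unit j) ⟩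
        Σ⋆ v (λ j → θ * x j + 1# * (- 1# * 1# + (1# - θ) * (1# when one j)))
          ≈⟨ Σ⋆-linear v θ x 1# (λ j → - 1# * 1# + (1# - θ) * (1# when one j)) ⟩
        θ * Σ⋆ v x + 1# * Σ⋆ v (λ j → - 1# * 1# + (1# - θ) * (1# when one j))
          ≈⟨ +-congˡ (trans (*-identityˡ _)
            (Σ⋆-linear v (- 1#) (λ _ → 1#) (1# - θ) (λ j → 1# when one j))) ⟩
        θ * Σ⋆ v x + (- 1# * Σ⋆ v (λ _ → 1#) + (1# - θ) * Σ⋆ v (λ j → 1# when one j))
          ≈⟨ +-congˡ (+-cong (*-congˡ (sym (⟦degree⟧ v)))
            (*-congˡ (sym (trans (⟦∣star∩∣⟧ v ones) ones≈)))) ⟩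
        θ * Σ⋆ v x + (- 1# * ⟦ degree v ⟧ + (1# - θ) * ⟦ ∣ star v ∩ ones ∣ ⟧) ∎
        where
        ones≈ : Σ⋆ v (λ j → 1# when lookup ones j) ≈ Σ⋆ v (λ j → 1# when one j)
        ones≈ = sum-cong λ j → reflexive
          (≡.cong (λ s → (1# when s) when lookup (edge j) v) (lookup∘tabulate one j))
        unit : ∀ j → (θ * x j + (- 1# * 1# + (1# - θ) * (1# when one j))) when lookup (edge j) v ≈
                     (θ * x j + 1# * (- 1# * 1# + (1# - θ) * (1# when one j))) when lookup (edge j)
                       v
        unit j with lookup (edge j) v
        ... | true  = +-congˡ (sym (*-identityˡ _))
        ... | false = refl

  K : Carrier
  K = δ * Opt - ⟦ ∣ support ∣ ⟧

  δ-excess : K ≈ sum (fractionalExcess δ) + D * ⟦ ∣ ones ∣ ⟧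
  δ-excess = trans (sum-excess δ) (+-congˡ (*-congʳ
    (solve 1 (λ d → :1 :+ d :- :1 := d) refl D)))

  private
    1≤δ : 1# ≤ δ
    1≤δ = ≤-by 0≤D (solve 1 (λ d → :1 :+ d :- :1 := d) refl D)

  -- In the tight case p = b - 1, d(v) = D + b, the coverage condition reads θ - 1 ≥ D. This is the
  -- origin of θ = δ.
  D*ones≤K : D * ⟦ ∣ ones ∣ ⟧ ≤ K
  D*ones≤K = ≤-by (0≤fractionalExcess δ 1≤δ enough)
    (trans (+-congʳ δ-excess) (solve 2 (λ a b → a :+ b :- b := a) refl _ (D * ⟦ ∣ ones ∣ ⟧)))
    where
    enough : ∀ v → ∣ star v ∩ ones ∣ ℕ.< b v →
             ⟦ degree v ⟧ + (δ - 1#) * ⟦ ∣ star v ∩ ones ∣ ⟧ ≤ δ * ⟦ b v ⟧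
    enough v p<b = ≤-by (0≤y-x (⟦degree⟧≤ v) 0≤+ 0≤D 0≤* 0≤y-x (⟦⟧-mono-≤ p<b))
      (solve 4 (λ d deg p b → (:1 :+ d) :* b :- (deg :+ (:1 :+ d :- :1) :* p) := d :+ b :- deg :+ d
        :* (b :- (:1 :+ p))) refl
        D ⟦ degree v ⟧ ⟦ ∣ star v ∩ ones ∣ ⟧ ⟦ b v ⟧)

  -- With p = 0 the coverage condition follows from D + b ≤ θ b, and b ≥ 2 admits θ = (D + 2) / 2.
  -- Then S ≤ θ Opt, and δ - θ = D / 2.
  ones≡0⇒D*Opt≤2K : ∣ ones ∣ ≡ 0 → D * Opt ≤ ⟦ 2 ⟧ * K
  ones≡0⇒D*Opt≤2K o≡0 = ≤-by (0≤⟦ 2 ⟧ 0≤* 0≤θOpt-S) (begin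
      ⟦ 2 ⟧ * K - D * Opt
        ≈⟨ solve 3 (λ d o s → # 2 :* ((:1 :+ d) :* o :- s) :- d :* o := (# 2 :+ d) :* o :- # 2 :* s)
          refl D Opt ⟦ ∣ support ∣ ⟧ ⟩
      (⟦ 2 ⟧ + D) * Opt - ⟦ 2 ⟧ * ⟦ ∣ support ∣ ⟧
        ≈⟨ +-congʳ (*-congʳ 2θ) ⟨
      ⟦ 2 ⟧ * θ * Opt - ⟦ 2 ⟧ * ⟦ ∣ support ∣ ⟧
        ≈⟨ solve 3 (λ t o s → # 2 :* t :* o :- # 2 :* s := # 2 :* (t :* o :- s)) refl θ Opt ⟦ ∣
          support ∣ ⟧ ⟩
      ⟦ 2 ⟧ * (θ * Opt - ⟦ ∣ support ∣ ⟧) ∎)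
    where
    open ≈
    θ : Carrier
    θ = (⟦ 2 ⟧ + D) / ⟦ 2 ⟧
    2θ : ⟦ 2 ⟧ * θ ≈ ⟦ 2 ⟧ + D
    2θ = *-/-cancel (⟦ 2 ⟧ + D) 0<⟦1+ 1 ⟧
    1≤θ : 1# ≤ θ
    1≤θ = l*x≤y⇒x≤y/l 0<⟦1+ 1 ⟧ (≤-by 0≤D (solve 1 (λ d → # 2 :+ d :- # 2 :* :1 := d) refl D))
    ∣star∩ones∣≡0 : ∀ v → ∣ star v ∩ ones ∣ ≡ 0
    ∣star∩ones∣≡0 v = ℕ.n≤0⇒n≡0 (ℕ.≤-trans (∣p∩q∣≤∣q∣ (star v) ones) (ℕ.≤-reflexive o≡0))
    enough : ∀ v → ∣ star v ∩ ones ∣ ℕ.< b v →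
             ⟦ degree v ⟧ + (θ - 1#) * ⟦ ∣ star v ∩ ones ∣ ⟧ ≤ θ * ⟦ b v ⟧
    enough v _ = *-cancelˡ-≤ 0<⟦1+ 1 ⟧
      (≤-by (0≤⟦ 2 ⟧ 0≤* 0≤y-x (⟦degree⟧≤ v) 0≤+ 0≤D 0≤* 0≤y-x (2≤⟦b⟧ v)) (begin
        ⟦ 2 ⟧ * (θ * ⟦ b v ⟧) - ⟦ 2 ⟧ * (⟦ degree v ⟧ + (θ - 1#) * ⟦ ∣ star v ∩ ones ∣ ⟧)
          ≈⟨ +-congˡ (-‿cong (*-congˡ (+-congˡ
            (*-congˡ (reflexive (≡.cong ⟦_⟧ (∣star∩ones∣≡0 v))))))) ⟩
        ⟦ 2 ⟧ * (θ * ⟦ b v ⟧) - ⟦ 2 ⟧ * (⟦ degree v ⟧ + (θ - 1#) * 0#)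
          ≈⟨ solve 3 (λ t b d → # 2 :* (t :* b) :- # 2 :* (d :+ (t :- :1) :* # 0) := # 2 :* t :* b
            :- # 2 :* d) refl θ ⟦ b v ⟧ ⟦ degree v ⟧ ⟩
        ⟦ 2 ⟧ * θ * ⟦ b v ⟧ - ⟦ 2 ⟧ * ⟦ degree v ⟧
          ≈⟨ +-congʳ (*-congʳ 2θ) ⟩
        (⟦ 2 ⟧ + D) * ⟦ b v ⟧ - ⟦ 2 ⟧ * ⟦ degree v ⟧
          ≈⟨ solve 3 (λ d b g → (# 2 :+ d) :* b :- # 2 :* g := # 2 :* (d :+ b :- g) :+ d :*
            (b :- # 2)) refl D ⟦ b v ⟧ ⟦ degree v ⟧ ⟩
        ⟦ 2 ⟧ * (D + ⟦ b v ⟧ - ⟦ degree v ⟧) + D * (⟦ b v ⟧ - ⟦ 2 ⟧) ∎))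
    0≤θOpt-S : 0# ≤ θ * Opt - ⟦ ∣ support ∣ ⟧
    0≤θOpt-S = ≤-respʳ (sym (trans (sum-excess θ)
      (trans (+-congˡ (trans (*-congˡ (reflexive (≡.cong ⟦_⟧ o≡0))) (zeroʳ _))) (+-identityʳ _))))
      (0≤fractionalExcess θ 1≤θ enough)

  -- An empty edge contributes to no constraint, so lowering a positive value on it would improve
  -- the optimum.
  fractional⇒nonempty : ∀ j → Fractional j → ∃[ v ] lookup (edge j) v ≡ true
  fractional⇒nonempty j frac with any? (λ v → lookup (edge j) v Bool.≟ true)
  ... | yes nonempty = nonempty
  ... | no  empty    = contradiction (optimal-direction d 1# 0<1 dir cov)
        (<⇒≱ (<-respʳ-≈ (trans (sum-const {m} 0#) (zeroʳ _)) (sum-mono-< d≤0 j dj<0)))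
    where
    d : Fin m → Carrier
    d i = (- 1#) when does (i ≟ᶠ j)
    -1<0 : - 1# < 0#
    -1<0 = <-by 0<1 (solve 0 (# 0 :- :- :1 := :1) refl)
    dir : ∀ i → d i ≈ 0# ⊎ Fractional i × - 1# ≤ d i × d i ≤ 1#
    dir i with i ≟ᶠ j
    ... | yes ≡.refl = inj₂ (frac , ≤-refl , ≤-trans (<⇒≤ -1<0) 0≤1)
    ... | no  _      = inj₁ refl
    d≤0 : ∀ i → d i ≤ 0#
    d≤0 i with i ≟ᶠ j
    ... | yes _ = <⇒≤ -1<0
    ... | no  _ = ≤-refl
    dj<0 : d j < 0#
    dj<0 with j ≟ᶠ j
    ... | yes _  = -1<0
    ... | no j≢j = contradiction ≡.refl j≢j
    cov : ∀ v → ⟦ b v ⟧ ≤ Σ⋆ v (λ i → 1# when one i) ⊎ 0# ≤ Σ⋆ v d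
    cov v = inj₂ (sum-nonneg pointwise)
      where
      pointwise : ∀ i → 0# ≤ d i when lookup (edge i) v
      pointwise i with lookup (edge i) v in eq | i ≟ᶠ j
      ... | false | _          = ≤-refl
      ... | true  | no _       = ≤-refl
      ... | true  | yes ≡.refl = contradiction (v , eq) empty

  -- D Opt - K = S - Opt is the sum of the gaps 1 - x j over the fractional edges. Each of these is
  -- nonempty, so its gap can be charged to a vertex, and a vertex receives at most d(v) - b ≤ D.
  D*Opt≤K+D*n : D * Opt ≤ K + D * ⟦ suc n ⟧
  D*Opt≤K+D*n = ≤-trans (≤-reflexive D*Opt)
    (≤-trans (+-mono-≤ ≤-refl (sum-mono-≤ gap≤))
      (≤-trans (+-mono-≤ ≤-refl (≤-reflexive (∑-comm (λ j v → (1# - x j) when lookup (edge j) v))))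
      (+-mono-≤ ≤-refl total)))
    where
    open ≈
    gap : Fin m → Carrier
    gap j = (1# - x j) when does (fractional? j)
    pointwise : ∀ j → D * x j ≈ fractionalExcess δ j + D * (1# when one j) + gap j
    pointwise j = begin
      D * x j
        ≈⟨ solve 3 (λ d x s → d :* x := (:1 :+ d) :* x :- s :+ (s :- x)) refl D (x j) s ⟩
      δ * x j - s + (s - x j)
        ≈⟨ +-cong (excess-split δ j) gap-split ⟩
      fractionalExcess δ j + (δ - 1#) * (1# when one j) + gap j
        ≈⟨ +-congʳ (+-congˡ (*-congʳ (solve 1 (λ d → :1 :+ d :- :1 := d) refl D))) ⟩
      fractionalExcess δ j + D * (1# when one j) + gap j ∎
      where
      s = 1# when does (0# <? x j)
      gap-split : s - x j ≈ gap j
      gap-split with 0# <? x j | x j <? 1#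
      ... | yes _   | yes _   = refl
      ... | yes _   | no  x≮1 = trans (+-congˡ (-‿cong (≤-antisym (x≤1 j) (≮⇒≥ x≮1))))
        (-‿inverseʳ 1#)
      ... | no  0≮x | _       = trans (+-congˡ (-‿cong (≤-antisym (≮⇒≥ 0≮x) (0≤x j))))
        (-‿inverseʳ 0#)
    D*Opt : D * Opt ≈ K + sum gap
    D*Opt = begin
      D * Opt                 ≈⟨ sum-* D x ⟨
      sum (λ j → D * x j)     ≈⟨ sum-cong pointwise ⟩
      sum (λ j → fractionalExcess δ j + D * (1# when one j) + gap j)
        ≈⟨ trans (sum-+ (λ j → fractionalExcess δ j + D * (1# when one j)) gap)
          (+-congʳ (sum-+ (fractionalExcess δ) (λ j → D * (1# when one j)))) ⟩
      sum (fractionalExcess δ) + sum (λ j → D * (1# when one j)) + sum gap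
        ≈⟨ +-congʳ (+-congˡ (trans (sum-* D (λ j → 1# when one j)) (*-congˡ (sym ⟦ones⟧)))) ⟩
      sum (fractionalExcess δ) + D * ⟦ ∣ ones ∣ ⟧ + sum gap
        ≈⟨ +-congʳ δ-excess ⟨
      K + sum gap ∎
    0≤incident : ∀ j v → 0# ≤ (1# - x j) when lookup (edge j) v
    0≤incident j v with lookup (edge j) v
    ... | true  = 0≤y-x (x≤1 j)
    ... | false = ≤-refl
    gap≤ : ∀ j → gap j ≤ sum (λ v → (1# - x j) when lookup (edge j) v)
    gap≤ j with 0# <? x j | x j <? 1#
    ... | no  _   | _       = sum-nonneg (0≤incident j)
    ... | yes _   | no  _   = sum-nonneg (0≤incident j)
    ... | yes 0<x | yes x<1 with fractional⇒nonempty j (0<x , x<1)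
    ... | v , v∈j = ≤-trans (≤-reflexive (reflexive (≡.cong ((1# - x j) when_) (≡.sym v∈j))))
      (sum-≥-term (0≤incident j) v)
    slack : ∀ v → Σ⋆ v (λ j → 1# - x j) ≤ D
    slack v = ≤-by (0≤y-x (covers v) 0≤+ 0≤y-x (⟦degree⟧≤ v)) (trans (+-congˡ (-‿cong Σ⋆-gap))
      (solve 4 (λ d g s b → d :- (:1 :* g :+ :- :1 :* s) := s :- b :+ (d :+ b :- g)) refl D ⟦ degree
        v ⟧ (Σ⋆ v x) ⟦ b v ⟧))
      where
      unit : ∀ j → (1# - x j) when lookup (edge j) v ≈ (1# * 1# + - 1# * x j) when lookup (edge j) v
      unit j with lookup (edge j) v
      ... | true  = solve 1 (λ x → :1 :- x := :1 :* :1 :+ :- :1 :* x) refl (x j)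
      ... | false = refl
      Σ⋆-gap : Σ⋆ v (λ j → 1# - x j) ≈ 1# * ⟦ degree v ⟧ + - 1# * Σ⋆ v x
      Σ⋆-gap = trans (sum-cong unit) (trans (Σ⋆-linear v 1# (λ _ → 1#) (- 1#) x)
        (+-congʳ (*-congˡ (sym (⟦degree⟧ v)))))
    total : sum (λ v → Σ⋆ v (λ j → 1# - x j)) ≤ D * ⟦ suc n ⟧
    total = ≤-trans (sum-mono-≤ slack) (≤-reflexive (trans (sum-const {suc n} D) (*-comm _ D)))

  private
    star⊆⇒degree≤ : ∀ v (T : Subset m) → (∀ j → ¬ (lookup (edge j) v ≡ true × lookup T j ≡ false)) →
            degree v ℕ.≤ ∣ star v ∩ T ∣
    star⊆⇒degree≤ v T none = p⊆q⇒∣p∣≤∣q∣ {p = star v} {q = star v ∩ T} λ {j} j∈star →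
      x∈p∩q⁺ {p = star v} {q = T} (j∈star , lookup⇒[]= j T (Bool.¬-not λ Tj≡false →
        none j (≡.trans (≡.sym (lookup∘tabulate (λ j → lookup (edge j) v) j)) ([]=⇒lookup j∈star) ,
          Tj≡false)))

  -- In θ Σ x j over the star, edges of T contribute at most θ each and the others less than 1. A
  -- single edge outside T makes the estimate strict; if there is none, T contains the star.
  threshold-cover : ∀ θ (T : Subset m) → (∀ j → lookup T j ≡ false → θ * x j < 1#) → 1# ≤ θ → ∀ v →
    degree v ℕ.≤ ∣ star v ∩ T ∣ ⊎
    θ * ⟦ b v ⟧ < (θ - 1#) * ⟦ ∣ star v ∩ T ∣ ⟧ + ⟦ degree v ⟧
  threshold-cover θ T θx<1 1≤θ v
    with any? (λ j → (lookup (edge j) v Bool.≟ true) ×-dec (lookup T j Bool.≟ false))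
  ... | no  none = inj₁ (star⊆⇒degree≤ v T λ j p → none (j , p))
  ... | yes (j , j∈star , j∉T) = inj₂ (≤-<-trans (*-monoʳ-≤ 0≤θ (covers v))
          (<-respˡ-≈ (trans (sum-cong θ-out) (sum-* θ (λ i → x i when lookup (edge i) v)))
            (<-respʳ-≈ total (sum-mono-< pointwise j strict))))
    where
    0≤θ = ≤-trans 0≤1 1≤θ
    bound : Fin m → Carrier
    bound i = (θ - 1#) * (1# when lookup T i) + 1# * 1#
    θ-out : ∀ i → (θ * x i) when lookup (edge i) v ≈ θ * (x i when lookup (edge i) v)
    θ-out i with lookup (edge i) v
    ... | true  = refl
    ... | false = sym (zeroʳ θ)
    pointwise : ∀ i → (θ * x i) when lookup (edge i) v ≤ bound i when lookup (edge i) v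
    pointwise i with lookup (edge i) v | lookup T i in eq
    ... | false | _     = ≤-refl
    ... | true  | true  = ≤-by (0≤θ 0≤* 0≤y-x (x≤1 i))
      (solve 2 (λ θ x → (θ :- :1) :* :1 :+ :1 :* :1 :- θ :* x := θ :* (:1 :- x)) refl θ (x i))
    ... | true  | false = ≤-trans (<⇒≤ (θx<1 i eq))
      (≤-reflexive (solve 1 (λ θ → :1 := (θ :- :1) :* # 0 :+ :1 :* :1) refl θ))
    strict : (θ * x j) when lookup (edge j) v < bound j when lookup (edge j) v
    strict rewrite j∈star | j∉T = <-respʳ-≈
      (solve 1 (λ θ → :1 := (θ :- :1) :* # 0 :+ :1 :* :1) refl θ) (θx<1 j j∉T)
    total : Σ⋆ v bound ≈ (θ - 1#) * ⟦ ∣ star v ∩ T ∣ ⟧ + ⟦ degree v ⟧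
    total = trans (Σ⋆-linear v (θ - 1#) (λ i → 1# when lookup T i) 1# (λ _ → 1#))
      (+-cong (*-congˡ (sym (⟦∣star∩∣⟧ v T))) (trans (*-identityˡ _) (sym (⟦degree⟧ v))))

  -- `r` is the tolerated deficit. A larger deficit, b - c ≥ r + 1, turns the strict estimate into
  -- (θ - 1) (r + 1) < D. It is used with r = 1 at the threshold of C₁ and with r = 0 at θ = δ.
  threshold-covers : ∀ θ (T : Subset m) r → (∀ j → lookup T j ≡ false → θ * x j < 1#) → 1# ≤ θ →
    D ≤ (θ - 1#) * ⟦ suc r ⟧ → ∀ v → b v ℕ.≤ r ℕ.+ ∣ star v ∩ T ∣
  threshold-covers θ T r θx<1 1≤θ D≤ v = ℕ.≮⇒≥ λ r+c<b → [ degree≰c r+c<b ,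
    (λ θb< → <⇒≱ θb< (enough r+c<b)) ]′
    (threshold-cover θ T θx<1 1≤θ v)
    where
    c = ∣ star v ∩ T ∣
    degree≰c : r ℕ.+ c ℕ.< b v → ¬ (degree v ℕ.≤ c)
    degree≰c r+c<b deg≤c = ℕ.<-irrefl ≡.refl
      (ℕ.<-trans (ℕ.<-≤-trans (b<degree v) deg≤c) (ℕ.≤-<-trans (ℕ.m≤n+m c r) r+c<b))
    enough : r ℕ.+ c ℕ.< b v → (θ - 1#) * ⟦ c ⟧ + ⟦ degree v ⟧ ≤ θ * ⟦ b v ⟧
    enough r+c<b = ≤-by
      (0≤y-x 1≤θ 0≤* 0≤y-x (≤-respˡ (×-homo-+ 1# (suc r) c) (⟦⟧-mono-≤ r+c<b)) 0≤+ 0≤y-x D≤ 0≤+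
        0≤y-x (⟦degree⟧≤ v))
      (solve 6 (λ t b c d D r → t :* b :- ((t :- :1) :* c :+ d) :=
        (t :- :1) :* (b :- ((:1 :+ r) :+ c)) :+ ((t :- :1) :* (:1 :+ r) :- D) :+ (D :+ b :- d)) refl
        θ ⟦ b v ⟧ ⟦ c ⟧ ⟦ degree v ⟧ D ⟦ r ⟧)

-- Threshold classes and the repairing step.

module Rounding
  (ℝ : CompleteOrderedField)
  {n m : ℕ} (H : Hypergraph (suc n) m)
  (b : Fin (suc n) → ℕ)
  (2≤b : ∀ v → 2 ℕ.≤ b v)
  (b≤deg-1 : ∀ v → b v ℕ.≤ Hypergraph.degree H v ∸ 1)
  (x : Fin m → Reals.Carrier ℝ)
  (optimal : Reals.IsLPOptimal ℝ H b x)
  where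

  open Reals ℝ
  open Hypergraph H
  open OrderedField ℝ
  open FiniteSums ℝ
  open LinearProgram ℝ H b 2≤b b≤deg-1 x optimal
  import Relation.Binary.Reasoning.Setoid setoid as ≈

  ∣p∪q∣≤∣p∣+∣q∣ : ∀ {m} (p q : Subset m) → ∣ p ∪ q ∣ ℕ.≤ ∣ p ∣ ℕ.+ ∣ q ∣
  ∣p∪q∣≤∣p∣+∣q∣ []          []          = z≤n
  ∣p∪q∣≤∣p∣+∣q∣ (false ∷ p) (false ∷ q) = ∣p∪q∣≤∣p∣+∣q∣ p q
  ∣p∪q∣≤∣p∣+∣q∣ (true  ∷ p) (false ∷ q) = s≤s (∣p∪q∣≤∣p∣+∣q∣ p q)
  ∣p∪q∣≤∣p∣+∣q∣ (false ∷ p) (true  ∷ q) = ℕ.≤-trans (s≤s (∣p∪q∣≤∣p∣+∣q∣ p q))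
    (ℕ.≤-reflexive (≡.sym (ℕ.+-suc ∣ p ∣ ∣ q ∣)))
  ∣p∪q∣≤∣p∣+∣q∣ (true  ∷ p) (true  ∷ q) = s≤s
    (ℕ.≤-trans (∣p∪q∣≤∣p∣+∣q∣ p q) (ℕ.+-monoʳ-≤ ∣ p ∣ (ℕ.n≤1+n ∣ q ∣)))

  star∩-mono : ∀ v {C C′} → C ⊆ C′ → star v ∩ C ⊆ star v ∩ C′
  star∩-mono v {C} {C′} C⊆C′ j∈ with x∈p∩q⁻ (star v) C j∈
  ... | j∈star , j∈C = x∈p∩q⁺ (j∈star , C⊆C′ j∈C)

  ∈star : ∀ {v j} → j ∈ star v → lookup (edge j) v ≡ true
  ∈star {v} {j} j∈star = ≡.trans (≡.sym (lookup∘tabulate (λ j → lookup (edge j) v) j))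
    ([]=⇒lookup j∈star)

  star∈ : ∀ {v} j → lookup (edge j) v ≡ true → j ∈ star v
  star∈ {v} j v∈j = lookup⇒[]= j (star v)
    (≡.trans (lookup∘tabulate (λ j → lookup (edge j) v) j) v∈j)

  uncovered : Subset m → Subset (suc n)
  uncovered C = tabulate (λ v → does (∣ star v ∩ C ∣ ℕ.<? b v))

  ∈uncovered⁺ : ∀ {C v} → ∣ star v ∩ C ∣ ℕ.< b v → v ∈ uncovered C
  ∈uncovered⁺ {C} {v} c<b = lookup⇒[]= v (uncovered C)
    (≡.trans (lookup∘tabulate (λ v → does (∣ star v ∩ C ∣ ℕ.<? b v)) v)
      (dec-true (∣ star v ∩ C ∣ ℕ.<? b v) c<b))

  ∈uncovered⁻ : ∀ {C v} → v ∈ uncovered C → ∣ star v ∩ C ∣ ℕ.< b v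
  ∈uncovered⁻ {C} {v} v∈ = decidable-stable (∣ star v ∩ C ∣ ℕ.<? b v) λ c≮b → contradiction
    (≡.trans (≡.sym (dec-false (∣ star v ∩ C ∣ ℕ.<? b v) c≮b))
      (≡.trans (≡.sym (lookup∘tabulate (λ v → does (∣ star v ∩ C ∣ ℕ.<? b v)) v)) ([]=⇒lookup v∈)))
        λ ()

  ∈support⁺ : ∀ {j} → 0# < x j → j ∈ support
  ∈support⁺ {j} 0<x = lookup⇒[]= j support
    (≡.trans (lookup∘tabulate (λ j → does (0# <? x j)) j) (dec-true (0# <? x j) 0<x))

  ¬multicover⇒uncovered : ∀ C → ¬ IsMulticover b C → ∃[ v ] ¬ FullyCovered b C v
  ¬multicover⇒uncovered C notCover with any? (λ v → ¬? (b v ℕ.≤? ∣ star v ∩ C ∣))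
  ... | yes found = found
  ... | no  none  = contradiction (λ v → decidable-stable (b v ℕ.≤? _) (λ ¬cov → none (v , ¬cov)))
    notCover

  uncovered⇒missing-edge : ∀ T C v → FullyCovered b T v → ¬ FullyCovered b C v →
                           ∃[ j ] j ∈ star v × j ∈ T × j ∉ C
  uncovered⇒missing-edge T C v covT ¬covC with any? (λ j → (j ∈? (star v ∩ T)) ×-dec ¬? (j ∈? C))
  ... | yes (j , j∈ , j∉C) = j , proj₁ (x∈p∩q⁻ (star v) T j∈) , proj₂ (x∈p∩q⁻ (star v) T j∈) , j∉C
  ... | no  none = contradiction (ℕ.≤-trans covT
    (p⊆q⇒∣p∣≤∣q∣ {p = star v ∩ T} {q = star v ∩ C} covered)) ¬covC
    where
    covered : star v ∩ T ⊆ star v ∩ C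
    covered {j} j∈ = x∈p∩q⁺ (proj₁ (x∈p∩q⁻ (star v) T j∈) ,
      decidable-stable (j ∈? C) (λ j∉C → none (j , j∈ , j∉C)))

  module Thresholds
    (k : ℕ) (ε α : Carrier)
    (0≤ε : 0# ≤ ε) (ε<1 : ε < 1#)
    (D≤2δε : D ≤ ⟦ 2 ⟧ * δ * ε)
    (2δz≤D : ⟦ 2 ⟧ * δ * ε ^ k ≤ D)
    where

    open SetMulticover H b (suc δ∸1) k ε α x public

    z : Carrier
    z = ε ^ k

    0≤z : 0# ≤ z
    0≤z = 0≤^ k 0≤ε

    z≤1 : z ≤ 1#
    z≤1 = ^-≤1 k 0≤ε (<⇒≤ ε<1)

    0<λ₁ : 0# < λ₁
    0<λ₁ = (0<δ 0<+≤ 0≤1) 0<* 0<⁻¹ 0<⟦1+ 1 ⟧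

    2λ₁ : ⟦ 2 ⟧ * λ₁ ≈ ⟦ 2 ⟧ + D
    2λ₁ = trans (*-/-cancel (δ + 1#) 0<⟦1+ 1 ⟧) (solve 1 (λ d → :1 :+ d :+ :1 := # 2 :+ d) refl D)

    2λ₁* : ∀ t → ⟦ 2 ⟧ * (λ₁ * t) ≈ (⟦ 2 ⟧ + D) * t
    2λ₁* t = trans (sym (*-assoc _ _ _)) (*-congʳ 2λ₁)

    1≤λ₁ : 1# ≤ λ₁
    1≤λ₁ = *-cancelˡ-≤ 0<⟦1+ 1 ⟧ (≤-by 0≤D (trans (+-congʳ 2λ₁)
      (solve 1 (λ d → # 2 :+ d :- # 2 :* :1 := d) refl D)))

    -- The four membership patterns that occur, with thresholds cleared of denominators: x j ≥ 1/λ
    -- reads 2 ≤ (2 + D) x j, because 2 λ = δ + 1 = D + 2.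
    data Class (j : Fin m) : Bool → Bool → Bool → Set where
      in₁ : ⟦ 2 ⟧ ≤ (⟦ 2 ⟧ + D) * x j → Class j true false false
      in₂ : (⟦ 2 ⟧ + D) * x j < ⟦ 2 ⟧ → 1# ≤ δ * x j → Class j false true false
      in₃ : 0# < x j → δ * x j < 1# → Class j false false true
      out : x j ≈ 0# → Class j false false false

    classify : ∀ j → Class j (lookup C₁ j) (lookup C₂ j) (lookup C₃ j)
    classify j = transport (lookup∘tabulate _ j) (lookup∘tabulate _ j) (lookup∘tabulate _ j)
      (class (1# / λ₁ ≤? x j) (x j <? 1# / λ₁) (1# / δ ≤? x j) (0# <? x j) (x j <? 1# / δ))
      where
      transport : ∀ {a b c a′ b′ c′} → a ≡ a′ → b ≡ b′ → c ≡ c′ → Class j a′ b′ c′ → Class j a b c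
      transport ≡.refl ≡.refl ≡.refl c = c

      large : 1# / λ₁ ≤ x j → ⟦ 2 ⟧ ≤ (⟦ 2 ⟧ + D) * x j
      large p = ≤-respˡ (*-identityʳ ⟦ 2 ⟧)
        (≤-respʳ (2λ₁* (x j)) (*-monoʳ-≤ 0≤⟦ 2 ⟧ (y/l≤x⇒y≤l*x 0<λ₁ p)))

      notLarge : ¬ (1# / λ₁ ≤ x j) → (⟦ 2 ⟧ + D) * x j < ⟦ 2 ⟧
      notLarge p = ≰⇒> λ 2≤ → p (y≤l*x⇒y/l≤x 0<λ₁ (*-cancelˡ-≤ 0<⟦1+ 1 ⟧
        (≤-respˡ (sym (*-identityʳ ⟦ 2 ⟧)) (≤-respʳ (sym (2λ₁* (x j))) 2≤))))

      large⇒1/δ≤x : 1# / λ₁ ≤ x j → 1# / δ ≤ x j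
      large⇒1/δ≤x p = y≤l*x⇒y/l≤x 0<δ (*-cancelˡ-≤ 0<⟦1+ 1 ⟧
        (≤-by (0≤y-x (large p) 0≤+ 0≤D 0≤* 0≤x j)
          (solve 2 (λ d x → # 2 :* ((:1 :+ d) :* x) :- # 2 :* :1 := (# 2 :+ d) :* x :- # 2 :+ d :*
            x) refl D (x j))))

      class : ∀ (d₁ : Dec (1# / λ₁ ≤ x j)) (d₂ : Dec (x j < 1# / λ₁)) (d₃ : Dec (1# / δ ≤ x j))
                (d₄ : Dec (0# < x j)) (d₅ : Dec (x j < 1# / δ)) →
              Class j (does d₁) (does (d₂ ×-dec d₃)) (does (d₄ ×-dec d₅))
      class (yes p) (yes q) _       _       _       = contradiction p (<⇒≱ q)
      class (yes p) (no _)  _       (no _)  _       = in₁ (large p)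
      class (yes p) (no _)  _       (yes _) (no _)  = in₁ (large p)
      class (yes p) (no _)  _       (yes _) (yes t) = contradiction (large⇒1/δ≤x p) (<⇒≱ t)
      class (no p)  (no q)  _       _       _       = contradiction (≰⇒> p) q
      class (no p)  (yes _) (yes r) (no _)  _       = in₂ (notLarge p) (y/l≤x⇒y≤l*x 0<δ r)
      class (no p)  (yes _) (yes r) (yes _) (no _)  = in₂ (notLarge p) (y/l≤x⇒y≤l*x 0<δ r)
      class (no p)  (yes _) (yes r) (yes _) (yes t) = contradiction r (<⇒≱ t)
      class (no p)  (yes _) (no r)  (yes s) (yes _) = in₃ s (y/l≰x⇒l*x<y 0<δ r)
      class (no p)  (yes _) (no r)  (yes _) (no t)  = contradiction (≰⇒> r) t
      class (no p)  (yes _) (no r)  (no s)  _       = out (≤-antisym (≮⇒≥ s) (0≤x j))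

    C₁₂ : Subset m
    C₁₂ = C₁ ∪ C₂

    lookup-C₁₂ : ∀ j → lookup C₁₂ j ≡ lookup C₁ j ∨ lookup C₂ j
    lookup-C₁₂ j = lookup-zipWith _∨_ j C₁ C₂

    private
      δ*0<1 : ∀ {t} → t ≈ 0# → δ * t < 1#
      δ*0<1 t≈0 = <-respˡ-≈ (sym (trans (*-congˡ t≈0) (zeroʳ δ))) 0<1

      small : ∀ {j} → δ * x j < 1# → (⟦ 2 ⟧ + D) * x j < ⟦ 2 ⟧
      small {j} δx<1 = <-by ((0<⟦1+ 1 ⟧ 0<* 0<y-x δx<1) 0<+≤ (0≤D 0≤* 0≤x j))
        (solve 2 (λ d x → # 2 :- (# 2 :+ d) :* x := # 2 :* (:1 :- (:1 :+ d) :* x) :+ d :* x) refl D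
          (x j))

      ∉C₁⇒ : ∀ {j c₁ c₂ c₃} → Class j c₁ c₂ c₃ → c₁ ≡ false → (⟦ 2 ⟧ + D) * x j < ⟦ 2 ⟧
      ∉C₁⇒ (in₁ _) ()
      ∉C₁⇒ (in₂ p _) _ = p
      ∉C₁⇒ (in₃ _ q) _ = small q
      ∉C₁⇒ (out p) _ = small (δ*0<1 p)

      ∉C₁₂⇒ : ∀ {j c₁ c₂ c₃} → Class j c₁ c₂ c₃ → c₁ ∨ c₂ ≡ false → δ * x j < 1#
      ∉C₁₂⇒ (in₁ _) ()
      ∉C₁₂⇒ (in₂ _ _) ()
      ∉C₁₂⇒ (in₃ _ q) _ = q
      ∉C₁₂⇒ (out p) _ = δ*0<1 p

    -- The identity D = 2 (λ - 1) explains the choice of λ: it is the threshold at which the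
    -- counting argument leaves a deficit of at most one.
    C₁-covers : ∀ v → b v ℕ.≤ suc ∣ star v ∩ C₁ ∣
    C₁-covers = threshold-covers λ₁ C₁ 1 λ₁x<1 1≤λ₁ (≤-reflexive D≈)
      where
      λ₁x<1 : ∀ j → lookup C₁ j ≡ false → λ₁ * x j < 1#
      λ₁x<1 j j∉C₁ = *-cancelˡ-< 0≤⟦ 2 ⟧
        (<-respˡ-≈ (sym (2λ₁* (x j))) (<-respʳ-≈ (sym (*-identityʳ ⟦ 2 ⟧))
          (∉C₁⇒ (classify j) j∉C₁)))
      D≈ : D ≈ (λ₁ - 1#) * ⟦ 2 ⟧
      D≈ = begin
        D                         ≈⟨ solve 1 (λ d → d := # 2 :+ d :- # 2) refl D ⟩
        ⟦ 2 ⟧ + D - ⟦ 2 ⟧         ≈⟨ +-congʳ 2λ₁ ⟨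
        ⟦ 2 ⟧ * λ₁ - ⟦ 2 ⟧        ≈⟨ solve 1 (λ l → # 2 :* l :- # 2 := (l :- :1) :* # 2) refl λ₁ ⟩
        (λ₁ - 1#) * ⟦ 2 ⟧         ∎
        where open ≈

    C₁₂-covers : ∀ v → b v ℕ.≤ ∣ star v ∩ C₁₂ ∣
    C₁₂-covers = threshold-covers δ C₁₂ 0 δx<1
      (≤-by 0≤D (solve 1 (λ d → :1 :+ d :- :1 := d) refl D))
      (≤-reflexive (solve 1 (λ d → d := (:1 :+ d :- :1) :* (:1 :+ # 0)) refl D))
      where
      δx<1 : ∀ j → lookup C₁₂ j ≡ false → δ * x j < 1#
      δx<1 j j∉ = ∉C₁₂⇒ (classify j) (≡.trans (≡.sym (lookup-C₁₂ j)) j∉)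

    -- C₁ and C₂ together cover everything, so an uncovered vertex has an edge of their union
    -- missing from C; as C contains C₁, it lies in C₂.
    repairNeverStuck : RepairNeverStuck
    repairNeverStuck C C₁⊆C notCover = C ∪ ⁅ j ⁆ , v , j , ¬cov , lookup⇒[]= v (edge j)
      (∈star j∈star) ,
      [ (λ j∈C₁ → contradiction (C₁⊆C j∈C₁) j∉C) , (λ j∈C₂ → j∈C₂) ]′ (x∈p∪q⁻ C₁ C₂ j∈C₁₂) , j∉C ,
        ≡.refl
      where
      found = ¬multicover⇒uncovered C notCover
      v     = proj₁ found
      ¬cov  = proj₂ found
      missing = uncovered⇒missing-edge C₁₂ C v (C₁₂-covers v) ¬cov
      j       = proj₁ missing
      j∈star  = proj₁ (proj₂ missing)
      j∈C₁₂   = proj₁ (proj₂ (proj₂ missing))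
      j∉C     = proj₂ (proj₂ (proj₂ missing))

    C₁⇒0<x : ∀ {j c₁ c₂ c₃} → Class j c₁ c₂ c₃ → c₁ ≡ true → 0# < x j
    C₁⇒0<x {j} (in₁ 2≤) _ = ≰⇒> λ x≤0 → <⇒≱ (small (δ*0<1 (≤-antisym x≤0 (0≤x j)))) 2≤
    C₁⇒0<x (in₂ _ _) ()
    C₁⇒0<x (in₃ _ _) ()
    C₁⇒0<x (out _) ()

    C₂⇒0<x : ∀ {j c₁ c₂ c₃} → Class j c₁ c₂ c₃ → c₂ ≡ true → 0# < x j
    C₂⇒0<x {j} (in₂ _ 1≤δx) _ = ≰⇒> λ x≤0 → <⇒≱ (δ*0<1 (≤-antisym x≤0 (0≤x j))) 1≤δx
    C₂⇒0<x (in₁ _) ()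
    C₂⇒0<x (in₃ _ _) ()
    C₂⇒0<x (out _) ()

    C₁⊆support : C₁ ⊆ support
    C₁⊆support {j} j∈C₁ = ∈support⁺ (C₁⇒0<x (classify j) ([]=⇒lookup j∈C₁))

    C₂⊆support : C₂ ⊆ support
    C₂⊆support {j} j∈C₂ = ∈support⁺ (C₂⇒0<x (classify j) ([]=⇒lookup j∈C₂))

    -- Every vertex is covered by C₁ at least b v - 1 times, so each repairing
    -- edge makes some uncovered vertex fully covered.
    repairStep-potential : ∀ {C C′} → C₁ ⊆ C → RepairStep C C′ →
      C₁ ⊆ C′ × ∣ C′ ∣ ℕ.+ ∣ uncovered C′ ∣ ℕ.≤ ∣ C ∣ ℕ.+ ∣ uncovered C ∣
    repairStep-potential {C} C₁⊆C (v , j , ¬cov , v∈j , _ , j∉C , ≡.refl) = (λ p → C⊆C′ (C₁⊆C p)) ,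
      (begin
      ∣ C′ ∣ ℕ.+ ∣ uncovered C′ ∣        ≤⟨ ℕ.+-monoˡ-≤ ∣ uncovered C′ ∣ (∣p∪q∣≤∣p∣+∣q∣ C ⁅ j ⁆) ⟩
      ∣ C ∣ ℕ.+ ∣ ⁅ j ⁆ ∣ ℕ.+ ∣ uncovered C′ ∣
        ≡⟨ ≡.cong (λ s → ∣ C ∣ ℕ.+ s ℕ.+ ∣ uncovered C′ ∣) (∣⁅x⁆∣≡1 j) ⟩
      ∣ C ∣ ℕ.+ 1 ℕ.+ ∣ uncovered C′ ∣   ≡⟨ ℕ.+-assoc (∣ C ∣) 1 (∣ uncovered C′ ∣) ⟩
      ∣ C ∣ ℕ.+ suc ∣ uncovered C′ ∣
        ≤⟨ ℕ.+-monoʳ-≤ ∣ C ∣ (p⊂q⇒∣p∣<∣q∣ {p = uncovered C′} {q = uncovered C} fewer) ⟩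
      ∣ C ∣ ℕ.+ ∣ uncovered C ∣          ∎)
      where
      open ℕ.≤-Reasoning
      C′ = C ∪ ⁅ j ⁆
      C⊆C′ : C ⊆ C′
      C⊆C′ = p⊆p∪q ⁅ j ⁆
      j∈C′ : j ∈ C′
      j∈C′ = x∈p∪q⁺ {p = C} {q = ⁅ j ⁆} (inj₂ (x∈⁅x⁆ j))
      j∈star : j ∈ star v
      j∈star = star∈ j ([]=⇒lookup v∈j)
      covered : b v ℕ.≤ ∣ star v ∩ C′ ∣
      covered = ℕ.≤-trans (C₁-covers v) (ℕ.≤-trans
        (s≤s (p⊆q⇒∣p∣≤∣q∣ {p = star v ∩ C₁} {q = star v ∩ C} (star∩-mono v C₁⊆C)))
        (p⊂q⇒∣p∣<∣q∣ {p = star v ∩ C} {q = star v ∩ C′}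
          (star∩-mono v C⊆C′ , j , x∈p∩q⁺ (j∈star , j∈C′) , λ j∈ → j∉C
            (proj₂ (x∈p∩q⁻ (star v) C j∈)))))
      fewer : uncovered C′ ⊂ uncovered C
      fewer = (λ {u} u∈ → ∈uncovered⁺ (ℕ.≤-<-trans
                  (p⊆q⇒∣p∣≤∣q∣ {p = star u ∩ C} {q = star u ∩ C′} (star∩-mono u C⊆C′))
                    (∈uncovered⁻ u∈))) ,
              v , ∈uncovered⁺ (ℕ.≰⇒> ¬cov) , λ v∈ → ℕ.<⇒≱ (∈uncovered⁻ v∈) covered

    repair-size : ∀ {C C′} → C₁ ⊆ C → Star RepairStep C C′ → ∣ C′ ∣ ℕ.≤ ∣ C ∣ ℕ.+ ∣ uncovered C ∣
    repair-size {C} C₁⊆C Star.ε            = ℕ.m≤m+n ∣ C ∣ _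
    repair-size C₁⊆C (step Star.◅ steps) =
      ℕ.≤-trans (repair-size (proj₁ (repairStep-potential C₁⊆C step)) steps)
        (proj₂ (repairStep-potential C₁⊆C step))

    repair-support : ∀ {C C′} → C ⊆ support → Star RepairStep C C′ → C′ ⊆ support
    repair-support C⊆S Star.ε = C⊆S
    repair-support {C} C⊆S ((v , j , _ , _ , j∈C₂ , _ , ≡.refl) Star.◅ steps) = repair-support added
      steps
      where
      added : C ∪ ⁅ j ⁆ ⊆ support
      added {i} i∈ = [ C⊆S , (λ i∈j → ≡.subst (_∈ support) (≡.sym (x∈⁅y⁆⇒x≡y j i∈j))
        (C₂⊆support j∈C₂)) ]′
        (x∈p∪q⁻ C ⁅ j ⁆ i∈)

-- Inequalities for powers and a second-moment estimate.

module PowerBounds (ℝ : CompleteOrderedField) where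

  open Reals ℝ
  open OrderedField ℝ

  1-xⁿ≤n[1-x] : ∀ {x} n → 0# ≤ x → x ≤ 1# → 1# - x ^ n ≤ ⟦ n ⟧ * (1# - x)
  1-xⁿ≤n[1-x] {x} zero 0≤x x≤1 = ≤-reflexive (solve 1 (λ x → :1 :- :1 := # 0 :* (:1 :- x)) refl x)
  1-xⁿ≤n[1-x] {x} (suc n) 0≤x x≤1 = ≤-by
    (0≤y-x (1-xⁿ≤n[1-x] n 0≤x x≤1) 0≤+ 0≤y-x x≤1 0≤* 0≤y-x (^-≤1 n 0≤x x≤1))
    (solve 3 (λ x n p → (:1 :+ n) :* (:1 :- x) :- (:1 :- x :* p) := n :* (:1 :- x) :- (:1 :- p) :+
      (:1 :- x) :* (:1 :- p)) refl
      x ⟦ n ⟧ (x ^ n))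

  -- The quotient (1 - uⁿ) / (1 - u) = 1 + u + ⋯ + uⁿ⁻¹ is increasing in u.
  1-uⁿ-secant : ∀ {u x} n → 0# ≤ u → u ≤ x → x ≤ 1# →
                (1# - x) * (1# - u ^ n) ≤ (1# - u) * (1# - x ^ n)
  1-uⁿ-secant {u} {x} zero 0≤u u≤x x≤1 = ≤-reflexive
    (solve 2 (λ u x → (:1 :- x) :* (:1 :- :1) := (:1 :- u) :* (:1 :- :1)) refl u x)
  1-uⁿ-secant {u} {x} (suc n) 0≤u u≤x x≤1 = ≤-by
    (0≤y-x (1-uⁿ-secant n 0≤u u≤x x≤1) 0≤+
     0≤y-x x≤1 0≤* 0≤y-x (≤-trans u≤x x≤1) 0≤* 0≤y-x (^-monoˡ-≤ n 0≤u u≤x))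
    (solve 4 (λ u x p q → (:1 :- u) :* (:1 :- x :* q) :- (:1 :- x) :* (:1 :- u :* p) :=
       (:1 :- u) :* (:1 :- q) :- (:1 :- x) :* (:1 :- p) :+ (:1 :- x) :* (:1 :- u) :* (q :- p)) refl
         u x (u ^ n) (x ^ n))

  -- Merges Chebyshev with Markov: w is the margin, y the deviation from the mean, r the number of
  -- repairs. The bound is linear in r. For r ≤ w it comes from squaring w - r ≤ y, for w ≤ r from
  -- w² ≤ w r.
  deviation : ∀ {w y r} → 0# ≤ w → 0# ≤ r → w ≤ y + r → w * w ≤ y * y + ⟦ 2 ⟧ * w * r
  deviation {w} {y} {r} 0≤w 0≤r w≤y+r with ≤-total r w
  ... | inj₂ w≤r = ≤-by (0≤x² y 0≤+ 0≤w 0≤* 0≤y-x w≤r 0≤+ 0≤w 0≤* 0≤r)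
    (solve 3 (λ w y r → y :* y :+ # 2 :* w :* r :- w :* w := y :* y :+ w :* (r :- w) :+ w :* r) refl
      w y r)
  ... | inj₁ r≤w = ≤-by (0≤y-x w≤y+r 0≤* (0≤y-x w≤y+r 0≤+ 0≤⟦ 2 ⟧ 0≤* 0≤y-x r≤w) 0≤+ 0≤x² r)
    (solve 3 (λ w y r → y :* y :+ # 2 :* w :* r :- w :* w := (y :+ r :- w) :*
      (y :+ r :- w :+ # 2 :* (w :- r)) :+ r :* r) refl w y r)

-- Distribution of the random rounding.

module RandomRounding
  (ℝ : CompleteOrderedField)
  {n m : ℕ} (H : Hypergraph (suc n) m)
  (b : Fin (suc n) → ℕ)
  (2≤b : ∀ v → 2 ℕ.≤ b v)
  (b≤deg-1 : ∀ v → b v ℕ.≤ Hypergraph.degree H v ∸ 1)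
  (x : Fin m → Reals.Carrier ℝ)
  (optimal : Reals.IsLPOptimal ℝ H b x)
  where

  open Reals ℝ
  open Hypergraph H
  open OrderedField ℝ
  open PowerBounds ℝ
  open FiniteSums ℝ
  open Exponential ℝ
  open Expectation ℝ
  open LinearProgram ℝ H b 2≤b b≤deg-1 x optimal
  open Rounding ℝ H b 2≤b b≤deg-1 x optimal
  import Relation.Binary.Reasoning.Setoid setoid as ≈

  module Run
    (k : ℕ) (ε α : Carrier)
    (0≤ε : 0# ≤ ε) (ε<1 : ε < 1#)
    (D≤2δε : D ≤ ⟦ 2 ⟧ * δ * ε)
    (2δz≤D : ⟦ 2 ⟧ * δ * ε ^ k ≤ D)
    where

    open Thresholds k ε α 0≤ε ε<1 D≤2δε 2δz≤D

    includeClass : Bool → Bool → Bool → Carrier → Rand Bool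
    includeClass c₁ c₂ c₃ t =
      if c₁ then return inside
      else if c₂ then anyHeads k (λ₀ * t)
      else if c₃ then flip ((1# - z) * δ * t)
      else return outside

    private
      0<1-ε : 0# < 1# - ε
      0<1-ε = 0<y-x ε<1

      0≤1-ε : 0# ≤ 1# - ε
      0≤1-ε = <⇒≤ 0<1-ε

      0≤1-z : 0# ≤ 1# - z
      0≤1-z = 0≤y-x z≤1

      0≤λ₀x : ∀ j → 0# ≤ λ₀ * x j
      0≤λ₀x j = 0≤1-ε 0≤* <⇒≤ 0<δ 0≤* 0≤x j

      -- D ≤ 2 δ ε is equivalent to λ₀ ≤ λ, so the lower bound on ε makes this label a probability
      -- outside C₁.
      λ₀x≤1 : ∀ j → (⟦ 2 ⟧ + D) * x j < ⟦ 2 ⟧ → λ₀ * x j ≤ 1#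
      λ₀x≤1 j small = *-cancelˡ-≤ 0<⟦1+ 1 ⟧ (≤-by
        (0≤y-x (<⇒≤ small) 0≤+ 0≤y-x D≤2δε 0≤* 0≤x j)
        (solve 3 (λ D x ε → # 2 :* :1 :- # 2 :* ((:1 :- ε) :* (:1 :+ D) :* x) :=
          # 2 :- (# 2 :+ D) :* x :+ (# 2 :* (:1 :+ D) :* ε :- D) :* x) refl D (x j) ε))

      0≤qδx : ∀ j → 0# ≤ (1# - z) * δ * x j
      0≤qδx j = 0≤1-z 0≤* <⇒≤ 0<δ 0≤* 0≤x j

      qδx≤1 : ∀ j → δ * x j < 1# → (1# - z) * δ * x j ≤ 1#
      qδx≤1 j δx<1 = ≤-by (0≤y-x (<⇒≤ δx<1) 0≤+ 0≤z 0≤* (<⇒≤ 0<δ 0≤* 0≤x j))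
        (solve 3 (λ z d x → :1 :- (:1 :- z) :* d :* x := :1 :- d :* x :+ z :* (d :* x)) refl z δ
          (x j))

      heads-flip : ∀ p → heads (flip p) ≈ p
      heads-flip p = solve 1 (λ p → p :* :1 :+ (:1 :- p) :* # 0 := p) refl p

      valid-class : ∀ {j c₁ c₂ c₃} → Class j c₁ c₂ c₃ → Valid (includeClass c₁ c₂ c₃ (x j))
      valid-class {j} (in₁ _)   = tt
      valid-class {j} (in₂ p _) = Valid-anyHeads k (0≤λ₀x j) (λ₀x≤1 j p)
      valid-class {j} (in₃ _ q) = (0≤qδx j , qδx≤1 j q) , λ _ → tt
      valid-class {j} (out _)   = tt

      Outcome : Fin m → Bool → Bool → Set
      Outcome j c₁ h = (c₁ ≡ true → h ≡ true) × (h ≡ true → 0# < x j)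

      Always-all : ∀ {A : Set} {P : A → Set} → (∀ a → P a) → ∀ r → Always P r
      Always-all all (return a) = all a
      Always-all all (coin p f) = λ h → Always-all all (f h)

      outcome-class : ∀ {j c₁ c₂ c₃} → Class j c₁ c₂ c₃ → Always (Outcome j c₁)
        (includeClass c₁ c₂ c₃ (x j))
      outcome-class {j} c@(in₁ _)   = (λ _ → ≡.refl) , λ _ → C₁⇒0<x c ≡.refl
      outcome-class {j} c@(in₂ _ _) = Always-all (λ _ → (λ ()) , λ _ → C₂⇒0<x c ≡.refl)
        (anyHeads k (λ₀ * x j))
      outcome-class {j} (in₃ 0<x _) = Always-all (λ _ → (λ ()) , λ _ → 0<x)
        (flip ((1# - z) * δ * x j))
      outcome-class {j} (out _)     = (λ ()) , λ ()

      -- 2 δ z ≤ D is equivalent to λ ≤ (1 - z) δ. So the upper bound on ε lets even the certain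
      -- edges obey the estimate of the mean.
      1≤qδx : ∀ j → ⟦ 2 ⟧ ≤ (⟦ 2 ⟧ + D) * x j → 1# ≤ (1# - z) * (δ * x j)
      1≤qδx j large = *-cancelˡ-≤ 0<⟦1+ 1 ⟧ (≤-by
        (0≤y-x large 0≤+ 0≤y-x 2δz≤D 0≤* 0≤x j)
        (solve 3 (λ D x z → # 2 :* ((:1 :- z) :* ((:1 :+ D) :* x)) :- # 2 :* :1 :=
          (# 2 :+ D) :* x :- # 2 :+ (D :- # 2 :* (:1 :+ D) :* z) :* x) refl D (x j) z))

      -- One bound for all classes makes the mean at most a multiple of Opt. On C₂ a flip fails with
      -- probability u ≤ ε because δ x j ≥ 1, and the secant inequality compares 1 - uᵏ with 1 - εᵏ.
      heads≤-class : ∀ {j c₁ c₂ c₃} → Class j c₁ c₂ c₃ →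
                     heads (includeClass c₁ c₂ c₃ (x j)) ≤ (1# - z) * (δ * x j)
      heads≤-class {j} (in₁ large) = 1≤qδx j large
      heads≤-class {j} (in₂ small 1≤δx) = ≤-respˡ (sym (heads-anyHeads k (λ₀ * x j)))
        (*-cancelˡ-≤ 0<1-ε (≤-trans
          (1-uⁿ-secant k (0≤y-x (λ₀x≤1 j small))
            (≤-by (0≤1-ε 0≤* 0≤y-x 1≤δx)
              (solve 3 (λ ε d x → ε :- (:1 :- (:1 :- ε) :* d :* x) := (:1 :- ε) :* (d :* x :- :1))
              refl ε δ (x j)))
            (<⇒≤ ε<1))
          (≤-reflexive (solve 4 (λ ε d x z → (:1 :- (:1 :- (:1 :- ε) :* d :* x)) :* (:1 :- z) :=
            (:1 :- ε) :* ((:1 :- z) :* (d :* x))) refl ε δ (x j) z))))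
      heads≤-class {j} (in₃ _ _) = ≤-reflexive (trans (heads-flip _) (*-assoc _ _ _))
      heads≤-class {j} (out _)   = 0≤1-z 0≤* (<⇒≤ 0<δ 0≤* 0≤x j)

      -- On the support the two sides differ by (1 - π)². Summation gives variance at most S - μ,
      -- which is how K enters the second moment.
      variance-class : ∀ {j c₁ c₂ c₃} → Class j c₁ c₂ c₃ →
        let π = heads (includeClass c₁ c₂ c₃ (x j))
        in π * (1# - π) ≤ 1# when does (0# <? x j) - π
      variance-class {j} {c₁} {c₂} {c₃} c = [ positive , null ]′ (support-or-null c)
        where
        r = includeClass c₁ c₂ c₃ (x j)
        π = heads r
        support-or-null : ∀ {c₁ c₂ c₃} → Class j c₁ c₂ c₃ →
          0# < x j ⊎ heads (includeClass c₁ c₂ c₃ (x j)) ≈ 0#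
        support-or-null c@(in₁ _)   = inj₁ (C₁⇒0<x c ≡.refl)
        support-or-null c@(in₂ _ _) = inj₁ (C₂⇒0<x c ≡.refl)
        support-or-null (in₃ 0<x _) = inj₁ 0<x
        support-or-null (out _)     = inj₂ refl
        positive : 0# < x j → π * (1# - π) ≤ 1# when does (0# <? x j) - π
        positive 0<x = ≤-by (0≤x² (1# - π)) (trans
          (+-congʳ (+-congʳ (reflexive (≡.cong (1# when_) (dec-true (0# <? x j) 0<x)))))
          (solve 1 (λ p → :1 :- p :- p :* (:1 :- p) := (:1 :- p) :* (:1 :- p)) refl π))
        0≤supp : ∀ s → 0# ≤ 1# when s
        0≤supp true  = 0≤1
        0≤supp false = ≤-refl
        null : π ≈ 0# → π * (1# - π) ≤ 1# when does (0# <? x j) - π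
        null π≈0 = ≤-by (0≤supp (does (0# <? x j))) (trans
          (+-cong (+-congˡ (-‿cong π≈0)) (-‿cong (*-congʳ π≈0)))
          (solve 2 (λ s p → s :- # 0 :- # 0 :* p := s) refl (1# when does (0# <? x j)) (1# - π)))

    π : Fin m → Carrier
    π j = heads (include j)

    run : Rand (Subset m)
    run = sequence (tabulate include)

    valid-run : Valid run
    valid-run = Valid-sequence include (λ j → valid-class (classify j))

    run-outcome : Always (λ C → C₁ ⊆ C × C ⊆ support) run
    run-outcome = Always-map
      (λ C outcomes →
        (λ {j} j∈C₁ → lookup⇒[]= j C (proj₁ (outcomes j) ([]=⇒lookup j∈C₁))) ,
        (λ {j} j∈C → ∈support⁺ (proj₂ (outcomes j) ([]=⇒lookup j∈C))))
      run (Always-sequence (λ j → Outcome j (lookup C₁ j)) include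
        (λ j → outcome-class (classify j)))

    μ : Carrier
    μ = sum π

    μ≤ : μ ≤ (1# - z) * (δ * Opt)
    μ≤ = ≤-trans (sum-mono-≤ {g = λ j → (1# - z) * (δ * x j)} (λ j → heads≤-class (classify j)))
      (≤-reflexive (trans (sum-* (1# - z) (λ j → δ * x j)) (*-congˡ (sum-* δ x))))

    variance≤ : sum (λ j → π j * (1# - π j)) ≤ ⟦ ∣ support ∣ ⟧ - μ
    variance≤ = ≤-trans (sum-mono-≤ {g = λ j → 1# when does (0# <? x j) - π j}
      (λ j → variance-class (classify j)))
      (≤-reflexive (trans (sum-- (λ j → 1# when does (0# <? x j)) π) (+-congʳ (sym ⟦support⟧))))

    κ q half : Carrier
    κ    = ⟦ k ⟧ * (1# - ε)
    q    = 1# - z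
    half = ⟦ 2 ⟧ ⁻¹

    q≤κ : q ≤ κ
    q≤κ = 1-xⁿ≤n[1-x] k 0≤ε (<⇒≤ ε<1)

    -- The factor contributed by an edge to the event that no edge outside C₁
    -- at a given vertex is chosen.
    missed : Bool → Bool → Carrier
    missed relevant h = if relevant then 1# when not h else 1#

    allMissed : Fin (suc n) → Subset m → Carrier
    allMissed v C = product (λ j → missed (lookup (edge j) v ∧ not (lookup C₁ j)) (lookup C j))

    -- Whether C₁ covers v is deterministic; the random part is a product over edges, so its
    -- expectation factorises.
    uncoveredBound : Fin (suc n) → Subset m → Carrier
    uncoveredBound v C = allMissed v C when does (∣ star v ∩ C₁ ∣ ℕ.<? b v)

    private
      product-one : ∀ {n} {f : Fin n → Carrier} → (∀ i → f i ≡ 1#) → product f ≈ 1#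
      product-one {zero}  f≡1 = refl
      product-one {suc n} f≡1 = trans (*-cong (reflexive (f≡1 zero))
        (product-one (λ i → f≡1 (suc i)))) (*-identityˡ 1#)

      0≤missed : ∀ s h → 0# ≤ missed s h
      0≤missed true  true  = ≤-refl
      0≤missed true  false = 0≤1
      0≤missed false _     = 0≤1

      missed≡1 : ∀ s₁ s₂ h → ¬ (s₁ ≡ true × s₂ ≡ false × h ≡ true) → missed (s₁ ∧ not s₂) h ≡ 1#
      missed≡1 false s₂    h     _ = ≡.refl
      missed≡1 true  true  h     _ = ≡.refl
      missed≡1 true  false false _ = ≡.refl
      missed≡1 true  false true  ¬all = contradiction (≡.refl , ≡.refl , ≡.refl) ¬all

    0≤uncoveredBound : ∀ v C → 0# ≤ uncoveredBound v C
    0≤uncoveredBound v C = nonneg (does (∣ star v ∩ C₁ ∣ ℕ.<? b v))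
      where
      nonneg : ∀ s → 0# ≤ allMissed v C when s
      nonneg true  = product-nonneg (λ j → 0≤missed (lookup (edge j) v ∧ not (lookup C₁ j))
        (lookup C j))
      nonneg false = ≤-refl

    -- C₁ lacks at most one edge at v, so any further chosen edge would cover v.
    uncovered≤ : ∀ {C} → C₁ ⊆ C → ∀ v → 1# when lookup (uncovered C) v ≤ uncoveredBound v C
    uncovered≤ {C} C₁⊆C v = by-cases (lookup (uncovered C) v) ≡.refl
      where
      by-cases : ∀ s → lookup (uncovered C) v ≡ s → 1# when s ≤ uncoveredBound v C
      by-cases false _ = 0≤uncoveredBound v C
      by-cases true v∈ = ≤-reflexive (trans (sym (product-one all-one))
          (reflexive (≡.cong (allMissed v C when_)
            (≡.sym (dec-true (∣ star v ∩ C₁ ∣ ℕ.<? b v) c₁<b)))))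
        where
        c<b : ∣ star v ∩ C ∣ ℕ.< b v
        c<b = ∈uncovered⁻ (lookup⇒[]= v (uncovered C) v∈)
        c₁<b : ∣ star v ∩ C₁ ∣ ℕ.< b v
        c₁<b = ℕ.≤-<-trans (p⊆q⇒∣p∣≤∣q∣ {p = star v ∩ C₁} {q = star v ∩ C} (star∩-mono v C₁⊆C)) c<b
        all-one : ∀ j → missed (lookup (edge j) v ∧ not (lookup C₁ j)) (lookup C j) ≡ 1#
        all-one j = missed≡1 (lookup (edge j) v) (lookup C₁ j) (lookup C j) λ (v∈j , j∉C₁ , j∈C) →
          ℕ.<⇒≱ c<b (ℕ.≤-trans (C₁-covers v) (p⊂q⇒∣p∣<∣q∣ {p = star v ∩ C₁} {q = star v ∩ C}
            (star∩-mono v C₁⊆C , j , x∈p∩q⁺ (star∈ j v∈j , lookup⇒[]= j C j∈C) ,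
             λ j∈ → contradiction (≡.trans (≡.sym ([]=⇒lookup (proj₂ (x∈p∩q⁻ (star v) C₁ j∈))))
               j∉C₁) λ ())))

    2half : ⟦ 2 ⟧ * half ≈ 1#
    2half = *-inverseʳ 0<⟦1+ 1 ⟧

    0≤half : 0# ≤ half
    0≤half = <⇒≤ (0<⁻¹ 0<⟦1+ 1 ⟧)

    1-p≤[1-p/2]² : ∀ p → 1# - p ≤ (1# - p * half) * (1# - p * half)
    1-p≤[1-p/2]² p = ≤-by (0≤x² (p * half)) (begin
      (1# - p * half) * (1# - p * half) - (1# - p)
        ≈⟨ solve 2 (λ p h → (:1 :- p :* h) :* (:1 :- p :* h) :- (:1 :- p) := p :* h :* (p :* h) :+ p
          :* (:1 :- # 2 :* h)) refl p half ⟩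
      p * half * (p * half) + p * (1# - ⟦ 2 ⟧ * half)
        ≈⟨ +-congˡ (*-congˡ (+-congˡ (-‿cong 2half))) ⟩
      p * half * (p * half) + p * (1# - 1#)
        ≈⟨ solve 2 (λ p y → y :* y :+ p :* (:1 :- :1) := y :* y) refl p (p * half) ⟩
      p * half * (p * half) ∎)
      where open ≈

    p/2≤1 : ∀ {p} → 0# ≤ p → p ≤ 1# → p * half ≤ 1#
    p/2≤1 {p} 0≤p p≤1 = *-cancelˡ-≤ 0<⟦1+ 1 ⟧ (≤-by (0≤y-x p≤1 0≤+ 0≤1) (begin
      ⟦ 2 ⟧ * 1# - ⟦ 2 ⟧ * (p * half)   ≈⟨ solve 2
        (λ p h → # 2 :* :1 :- # 2 :* (p :* h) := # 2 :- p :* (# 2 :* h)) refl p half ⟩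
      ⟦ 2 ⟧ - p * (⟦ 2 ⟧ * half)        ≈⟨ +-congˡ (-‿cong (*-congˡ 2half)) ⟩
      ⟦ 2 ⟧ - p * 1#                    ≈⟨ solve 1 (λ p → # 2 :- p :* :1 := :1 :- p :+ :1) refl p ⟩
      1# - p + 1#                       ∎))
      where open ≈

    private
      exponent : Bool → Bool → Bool → Carrier → Carrier
      exponent s c₂ c₃ t = ((κ when c₂ + q when c₃) * (δ * t) * half) when s

      factor : Bool → Carrier → Carrier
      factor s p = p * missed s true + (1# - p) * missed s false

      -- Q bounds the square root of the failure factor. Halving the exponents lets their sum be
      -- compared with a, where exp is given, instead of 2a.
      Failing : Carrier → Carrier → Set
      Failing f e = ∃[ Q ] f ≤ Q * Q × Q ≼exp- e

      trivial : ∀ {f e} → f ≈ 1# → e ≈ 0# → Failing f e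
      trivial f≈1 e≈0 = 1# , ≤-reflexive (trans f≈1 (sym (*-identityˡ 1#))) ,
        ≼-weaken (≤-reflexive (sym e≈0)) (≤-reflexive e≈0) 1≼0

      failing-class : ∀ {j c₁ c₂ c₃} → Class j c₁ c₂ c₃ → ∀ s →
        Failing (factor (s ∧ not c₁) (heads (includeClass c₁ c₂ c₃ (x j)))) (exponent s c₂ c₃ (x j))
      failing-class {j} {c₁} {c₂} {c₃} _ false = trivial
        (solve 1 (λ p → p :* :1 :+ (:1 :- p) :* :1 := :1) refl
          (heads (includeClass c₁ c₂ c₃ (x j)))) refl
      failing-class {j} (in₁ _) true = trivial
        (solve 0 (:1 :* :1 :+ (:1 :- :1) :* :1 := :1) refl)
        (solve 2 (λ d h → (# 0 :+ # 0) :* d :* h := # 0) refl (δ * x j) half)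
      failing-class {j} (out _) true = trivial
        (solve 0 (# 0 :* # 0 :+ (:1 :- # 0) :* :1 := :1) refl)
        (solve 2 (λ d h → (# 0 :+ # 0) :* d :* h := # 0) refl (δ * x j) half)
      failing-class {j} (in₂ small _) true = (1# - y) ^ k ,
        ≤-respˡ (sym f≈) (≤-trans (^-monoˡ-≤ k (0≤y-x (λ₀x≤1 j small)) (1-p≤[1-p/2]² p))
          (≤-reflexive (^-distrib-* (1# - y) (1# - y) k))) ,
        ≼-weaken (≤-respʳ (sym e≈) (0≤⟦ k ⟧ 0≤* 0≤y)) (≤-reflexive e≈)
          (≼-^ k (1-y≼ 0≤y (p/2≤1 (0≤λ₀x j) (λ₀x≤1 j small))))
        where
        p = λ₀ * x j
        y = p * half
        0≤y : 0# ≤ y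
        0≤y = 0≤λ₀x j 0≤* 0≤half
        f≈ : factor true (heads (anyHeads k p)) ≈ (1# - p) ^ k
        f≈ = trans (solve 1 (λ h → h :* # 0 :+ (:1 :- h) :* :1 := :1 :- h) refl
          (heads (anyHeads k p)))
          (trans (+-congˡ (-‿cong (heads-anyHeads k p)))
            (solve 1 (λ u → :1 :- (:1 :- u) := u) refl ((1# - p) ^ k)))
        e≈ : (κ + 0#) * (δ * x j) * half ≈ ⟦ k ⟧ * y
        e≈ = solve 5 (λ n e d x h → (n :* (:1 :- e) :+ # 0) :* (d :* x) :* h := n :*
          ((:1 :- e) :* d :* x :* h)) refl ⟦ k ⟧ ε δ (x j) half
      failing-class {j} (in₃ _ δx<1) true = 1# - y ,
        ≤-respˡ (sym f≈) (1-p≤[1-p/2]² p) ,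
        ≼-weaken (≤-respʳ (sym e≈) 0≤y) (≤-reflexive e≈) (1-y≼ 0≤y (p/2≤1 (0≤qδx j) (qδx≤1 j δx<1)))
        where
        p = (1# - z) * δ * x j
        y = p * half
        0≤y : 0# ≤ y
        0≤y = 0≤qδx j 0≤* 0≤half
        f≈ : factor true (heads (flip p)) ≈ 1# - p
        f≈ = trans (solve 1 (λ h → h :* # 0 :+ (:1 :- h) :* :1 := :1 :- h) refl (heads (flip p)))
          (+-congˡ (-‿cong (heads-flip p)))
        e≈ : (0# + q) * (δ * x j) * half ≈ y
        e≈ = solve 4 (λ q d x h → (# 0 :+ q) :* (d :* x) :* h := q :* d :* x :* h) refl q δ (x j)
          half

      -- A minorant of the rate that sums to two coverage counts. The slack is q δ (1 - x j) on C₁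
      -- and (κ - q) (δ x j - 1) on C₂; on the other edges there is equality.
      exponent≥ : ∀ {j c₁ c₂ c₃} → Class j c₁ c₂ c₃ →
        (κ - q) * (1# * (1# when (c₁ ∨ c₂)) + - 1# * (1# when c₁)) + q * δ *
          (1# * x j + - 1# * (1# when c₁)) ≤
        (κ when c₂ + q when c₃) * (δ * x j)
      exponent≥ {j} (in₁ _) = ≤-by (0≤1-z 0≤* <⇒≤ 0<δ 0≤* 0≤y-x (x≤1 j))
        (solve 4 (λ κ q d x → (# 0 :+ # 0) :* (d :* x) :-
          ((κ :- q) :* (:1 :* :1 :+ :- :1 :* :1) :+ q :* d :* (:1 :* x :+ :- :1 :* :1)) := q :* d :*
          (:1 :- x)) refl κ q δ (x j))
      exponent≥ {j} (in₂ _ 1≤δx) = ≤-by (0≤y-x q≤κ 0≤* 0≤y-x 1≤δx)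
        (solve 4 (λ κ q d x → (κ :+ # 0) :* (d :* x) :-
          ((κ :- q) :* (:1 :* :1 :+ :- :1 :* # 0) :+ q :* d :* (:1 :* x :+ :- :1 :* # 0)) :=
          (κ :- q) :* (d :* x :- :1)) refl κ q δ (x j))
      exponent≥ {j} (in₃ _ _) = ≤-reflexive
        (solve 4 (λ κ q d x → (κ :- q) :* (:1 :* # 0 :+ :- :1 :* # 0) :+ q :* d :*
          (:1 :* x :+ :- :1 :* # 0) := (# 0 :+ q) :* (d :* x)) refl κ q δ (x j))
      exponent≥ {j} (out x≈0) = ≤-reflexive (trans
        (solve 4 (λ κ q d x → (κ :- q) :* (:1 :* # 0 :+ :- :1 :* # 0) :+ q :* d :*
          (:1 :* x :+ :- :1 :* # 0) := q :* d :* x) refl κ q δ (x j))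
        (trans (*-congˡ x≈0) (solve 4 (λ κ q d x → q :* d :* # 0 := (# 0 :+ # 0) :* (d :* x)) refl κ
          q δ (x j))))

    -- Twice the exponent a of the paper.
    2a : Carrier
    2a = κ + D * q

    private
      edgeExponent : Fin (suc n) → Fin m → Carrier
      edgeExponent v j = exponent (lookup (edge j) v) (lookup C₂ j) (lookup C₃ j) (x j)

      -- C₁ fails the demand b v, while C₁₂ and x meet it. So the differences |star ∩ C₁₂| - |star ∩
      -- C₁| and Σ x j - |star ∩ C₁| are both at least 1, and their weights add up to (κ - q) + q δ
      -- = κ + D q.
      2a≤exponents : ∀ v → ∣ star v ∩ C₁ ∣ ℕ.< b v → 2a ≤ ⟦ 2 ⟧ * sum (edgeExponent v)
      2a≤exponents v c₁<b = ≤-trans (≤-by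
          (0≤y-x q≤κ 0≤* 0≤y-x 1≤f 0≤+ (0≤1-z 0≤* <⇒≤ 0<δ) 0≤* 0≤y-x 1≤g)
          (solve 5 (λ κ q D f g → (κ :- q) :* f :+ q :* (:1 :+ D) :* g :- (κ :+ D :* q) := (κ :- q)
            :* (f :- :1) :+ q :* (:1 :+ D) :* (g :- :1)) refl κ q D (Σ⋆ v f) (Σ⋆ v g)))
        (≤-trans (≤-reflexive (sym (Σ⋆-linear v (κ - q) f (q * δ) g)))
          (≤-trans (Σ⋆-mono v {g = rate} pointwise) (≤-reflexive (sym total))))
        where
        open ≈
        f g rate : Fin m → Carrier
        f j = 1# * (1# when lookup C₁₂ j) + - 1# * (1# when lookup C₁ j)
        g j = 1# * x j + - 1# * (1# when lookup C₁ j)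
        rate j = (κ when lookup C₂ j + q when lookup C₃ j) * (δ * x j)
        pointwise : ∀ j → (κ - q) * f j + q * δ * g j ≤ rate j
        pointwise j = ≤-respˡ (+-congʳ (*-congˡ
          (+-congʳ (*-congˡ (reflexive (≡.cong (1# when_) (≡.sym (lookup-C₁₂ j))))))))
          (exponent≥ (classify j))
        1≤f : 1# ≤ Σ⋆ v f
        1≤f = ≤-respʳ (sym (Σ⋆-linear v 1# (λ j → 1# when lookup C₁₂ j) (- 1#)
          (λ j → 1# when lookup C₁ j)))
          (≤-respʳ (+-cong (*-congˡ (⟦∣star∩∣⟧ v C₁₂)) (*-congˡ (⟦∣star∩∣⟧ v C₁)))
            (≤-by (0≤y-x (⟦⟧-mono-≤ (ℕ.≤-trans c₁<b (C₁₂-covers v))))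
              (solve 2 (λ c d → :1 :* c :+ :- :1 :* d :- :1 := c :- (:1 :+ d)) refl ⟦ ∣ star v ∩ C₁₂
                ∣ ⟧ ⟦ ∣ star v ∩ C₁ ∣ ⟧)))
        1≤g : 1# ≤ Σ⋆ v g
        1≤g = ≤-respʳ (sym (Σ⋆-linear v 1# x (- 1#) (λ j → 1# when lookup C₁ j)))
          (≤-respʳ (+-congˡ (*-congˡ (⟦∣star∩∣⟧ v C₁)))
            (≤-by (0≤y-x (covers v) 0≤+ 0≤y-x (⟦⟧-mono-≤ c₁<b))
              (solve 3 (λ s c b → :1 :* s :+ :- :1 :* c :- :1 := s :- b :+ (b :- (:1 :+ c))) refl
                (Σ⋆ v x) ⟦ ∣ star v ∩ C₁ ∣ ⟧ ⟦ b v ⟧)))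
        halve : ∀ s r → ⟦ 2 ⟧ * ((r * half) when s) ≈ r when s
        halve false r = zeroʳ ⟦ 2 ⟧
        halve true  r = trans (solve 2 (λ r h → # 2 :* (r :* h) := r :* (# 2 :* h)) refl r half)
          (trans (*-congˡ 2half) (*-identityʳ r))
        total : ⟦ 2 ⟧ * sum (edgeExponent v) ≈ Σ⋆ v rate
        total = begin
          ⟦ 2 ⟧ * sum (edgeExponent v)             ≈⟨ sum-* ⟦ 2 ⟧ (edgeExponent v) ⟨
          sum (λ j → ⟦ 2 ⟧ * edgeExponent v j)
            ≈⟨ sum-cong (λ j → halve (lookup (edge j) v) (rate j)) ⟩
          Σ⋆ v rate                                ∎

      𝔼-allMissed : ∀ v → ∣ star v ∩ C₁ ∣ ℕ.< b v → ∀ {a e} → 2a ≈ ⟦ 2 ⟧ * a → IsExp a e →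
                    ∃[ Q ] 𝔼 (allMissed v) run ≤ Q * Q × 0# ≤ Q × Q * e ≤ 1#
      𝔼-allMissed v c₁<b {a} {e} 2a≈ exp = product Q ,
        ≤-respˡ (sym (𝔼-product include (λ j → missed (relevant j))))
          (≤-trans (product-mono-≤ 0≤factor (λ j → proj₁ (proj₂ (fails j))))
            (≤-reflexive (product-* Q Q))) ,
        0≤base Q≼ , ≼-IsExp Q≼ exp
        where
        relevant : Fin m → Bool
        relevant j = lookup (edge j) v ∧ not (lookup C₁ j)
        fails : ∀ j → Failing (factor (relevant j) (π j)) (edgeExponent v j)
        fails j = failing-class (classify j) (lookup (edge j) v)
        Q : Fin m → Carrier
        Q j = proj₁ (fails j)
        0≤factor : ∀ j → 0# ≤ factor (relevant j) (π j)
        0≤factor j = proj₁ (heads-bounds (include j) (valid-class (classify j))) 0≤* 0≤missed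
          (relevant j) true 0≤+
          0≤y-x (proj₂ (heads-bounds (include j) (valid-class (classify j)))) 0≤* 0≤missed
            (relevant j) false
        0≤a : 0# ≤ a
        0≤a = *-cancelˡ-≤ 0<⟦1+ 1 ⟧ (≤-respˡ (sym (zeroʳ ⟦ 2 ⟧))
          (≤-respʳ 2a≈ (0≤⟦ k ⟧ 0≤* 0≤1-ε 0≤+ 0≤D 0≤* 0≤1-z)))
        Q≼ : product Q ≼exp- a
        Q≼ = ≼-weaken 0≤a (*-cancelˡ-≤ 0<⟦1+ 1 ⟧ (≤-respˡ 2a≈ (2a≤exponents v c₁<b)))
          (≼-product (λ j → proj₂ (proj₂ (fails j))))

    -- Of the two factors e available from (e Q)² ≤ 1, one is traded for the constant 3; the other
    -- will cancel against `6n<eG`.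
    𝔼-uncoveredBound : ∀ {a e} → 2a ≈ ⟦ 2 ⟧ * a → IsExp a e → ⟦ 3 ⟧ ≤ e → ∀ v →
                       ⟦ 3 ⟧ * e * 𝔼 (uncoveredBound v) run ≤ 1#
    𝔼-uncoveredBound {a} {e} 2a≈ exp 3≤e v = by-cases (∣ star v ∩ C₁ ∣ ℕ.<? b v)
      where
      0≤e : 0# ≤ e
      0≤e = ≤-trans 0≤⟦ 3 ⟧ 3≤e
      by-cases : (d : Dec (∣ star v ∩ C₁ ∣ ℕ.< b v)) → ⟦ 3 ⟧ * e * 𝔼
        (λ C → allMissed v C when does d) run ≤ 1#
      by-cases (no  _)    = ≤-respˡ (sym (trans (*-congˡ (𝔼-const 0# run)) (zeroʳ _))) 0≤1
      by-cases (yes c₁<b) = ≤-trans (*-monoʳ-≤ (0≤⟦ 3 ⟧ 0≤* 0≤e) (proj₁ (proj₂ missAll)))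
        (≤-trans (≤-by (0≤y-x 3≤e 0≤* 0≤e 0≤* (0≤x² Q))
            (solve 3 (λ e q t → e :* q :* (e :* q) :- t :* e :* (q :* q) := (e :- t) :* e :*
              (q :* q)) refl e Q ⟦ 3 ⟧))
          (≤-respʳ (*-identityˡ 1#) (*-mono-≤ (0≤e 0≤* 0≤Q) 0≤1 eQ≤1 eQ≤1)))
        where
        missAll = 𝔼-allMissed v c₁<b 2a≈ exp
        Q = proj₁ missAll
        0≤Q = proj₁ (proj₂ (proj₂ missAll))
        eQ≤1 : e * Q ≤ 1#
        eQ≤1 = ≤-respˡ (*-comm Q e) (proj₂ (proj₂ (proj₂ missAll)))

-- Size guarantee and failure probability.

module Analysis
  (ℝ : CompleteOrderedField)
  {n m : ℕ} (H : Hypergraph (suc n) m)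
  (b : Fin (suc n) → ℕ)
  (2≤b : ∀ v → 2 ℕ.≤ b v)
  (b≤deg-1 : ∀ v → b v ℕ.≤ Hypergraph.degree H v ∸ 1)
  (x : Fin m → Reals.Carrier ℝ)
  (optimal : Reals.IsLPOptimal ℝ H b x)
  where

  open Reals ℝ
  open Hypergraph H
  open OrderedField ℝ
  open FiniteSums ℝ
  open PowerBounds ℝ
  open Exponential ℝ
  open Expectation ℝ
  open LinearProgram ℝ H b 2≤b b≤deg-1 x optimal
  open Rounding ℝ H b 2≤b b≤deg-1 x optimal
  open RandomRounding ℝ H b 2≤b b≤deg-1 x optimal
  import Relation.Binary.Reasoning.Setoid setoid as ≈

  0<Opt : 0# < Opt
  0<Opt = <-≤-trans 0<⟦1+ 1 ⟧ (≤-trans (2≤⟦b⟧ zero) (≤-trans (covers zero) (sum-mono-≤ incident≤)))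
    where
    incident≤ : ∀ j → x j when lookup (edge j) zero ≤ x j
    incident≤ j with lookup (edge j) zero
    ... | true  = ≤-refl
    ... | false = 0≤x j

  nonempty⇒one : ∣ ones ∣ ≢ 0 → ∃[ j ] 1# ≤ x j
  nonempty⇒one o≢0 with nonempty? ones
  ... | no  empty      = contradiction (≡.trans (≡.cong ∣_∣ (Empty-unique empty)) (∣⊥∣≡0 m)) o≢0
  ... | yes (j , j∈) = j , decidable-stable (1# ≤? x j) λ 1≰x → contradiction
    (≡.trans (≡.sym (dec-false (1# ≤? x j) 1≰x))
      (≡.trans (≡.sym (lookup∘tabulate one j)) ([]=⇒lookup j∈))) λ ()

  ℓ : Carrier
  ℓ = ⟦ maxEdgeSize ⟧

  -- α and the ratio divide by ℓ, and `0# ⁻¹` is unspecified. Vertex `zero` has positive degree, so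
  -- some edge is nonempty.
  0<ℓ : 0# < ℓ
  0<ℓ with nonempty? (star zero)
  ... | no empty = contradiction (b<degree zero)
        (ℕ.<-asym (ℕ.≤-trans (ℕ.≤-reflexive
          (≡.cong suc (≡.trans (≡.cong ∣_∣ (Empty-unique empty)) (∣⊥∣≡0 m))))
          (ℕ.≤-trans (s≤s z≤n) (2≤b zero))))
  ... | yes (j , j∈star) = <-≤-trans 0<⟦1+ 0 ⟧ (⟦⟧-mono-≤ {1} {maxEdgeSize} (ℕ.≤-trans
        (ℕ.≤-trans (ℕ.≤-reflexive (≡.sym (∣⁅x⁆∣≡1 {suc n} zero)))
          (p⊆q⇒∣p∣≤∣q∣ {suc n} {p = ⁅ zero ⁆} {q = edge j} zero∈edge)) (∣edge∣≤ℓ j)))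
    where
    zero∈edge : ⁅ zero ⁆ ⊆ edge j
    zero∈edge v∈ = ≡.subst (_∈ edge j) (≡.sym (x∈⁅y⁆⇒x≡y zero v∈))
      (lookup⇒[]= zero (edge j) (∈star j∈star))

  module Guarantee
    (k : ℕ) (ε α : Carrier)
    (0≤ε : 0# ≤ ε) (ε<1 : ε < 1#)
    (D≤2δε : D ≤ ⟦ 2 ⟧ * δ * ε)
    (2δz≤D : ⟦ 2 ⟧ * δ * ε ^ k ≤ D)
    (a e : Carrier)
    (2a≈ : ⟦ k ⟧ * (1# - ε) + D * (1# - ε ^ k) ≈ ⟦ 2 ⟧ * a)
    (exp : IsExp a e)
    (6ℓα≈ : ⟦ 6 ⟧ * ⟦ maxEdgeSize ⟧ * α ≈ (⟦ β ⟧ - 1#) * δ * ε ^ k * e)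
    where

    open Thresholds k ε α 0≤ε ε<1 D≤2δε 2δz≤D
    open Run k ε α 0≤ε ε<1 D≤2δε 2δz≤D

    G n′ : Carrier
    G  = z * (δ * Opt)
    n′ = ⟦ suc n ⟧

    private
      0<D : 0# < D
      0<D = <-≤-trans 0<1 1≤D

      0<DOpt : 0# < D * Opt
      0<DOpt = 0<D 0<* 0<Opt

      0<β-1 : 0# < ⟦ β ⟧ - 1#
      0<β-1 = <-≤-trans 0<1 (≤-by (0≤y-x (⟦⟧-mono-≤ {2} {β} 2≤β))
        (solve 1 (λ b → b :- :1 :- :1 := b :- # 2) refl ⟦ β ⟧))

      0≤a : 0# ≤ a
      0≤a = *-cancelˡ-≤ 0<⟦1+ 1 ⟧ (≤-respˡ (sym (zeroʳ ⟦ 2 ⟧)) (≤-respʳ 2a≈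
        (0≤⟦ k ⟧ 0≤* 0≤y-x (<⇒≤ ε<1) 0≤+ 0≤D 0≤* 0≤y-x z≤1)))

      0<e : 0# < e
      0<e = <-≤-trans 0<1 (≤-trans (≤-reflexive 1≈E₁) (expPartialSum≤exp 0≤a exp 1))
        where
        1≈E₁ : 1# ≈ expPartialSum a 1
        1≈E₁ = trans (sym (*-inverseʳ 0<⟦1+ 0 ⟧))
          (solve 1 (λ i → (:1 :+ # 0) :* i := :1 :* i :+ # 0) refl (⟦ 1 ⟧ ⁻¹))

    -- Incidences of vertices with C₁, counted from both sides: a vertex has at least β - 1, an edge
    -- at most ℓ.
    [β-1]n≤ℓ∣C₁∣ : (⟦ β ⟧ - 1#) * n′ ≤ ℓ * ⟦ ∣ C₁ ∣ ⟧
    [β-1]n≤ℓ∣C₁∣ = ≤-trans (≤-reflexive (trans (*-comm _ n′)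
      (sym (sum-const {suc n} (⟦ β ⟧ - 1#)))))
      (≤-trans (sum-mono-≤ {f = λ _ → ⟦ β ⟧ - 1#} {g = λ v → Σ⋆ v (λ j → 1# when lookup C₁ j)} β-1≤)
      (≤-trans (≤-reflexive (sym (∑-comm (λ j v → (1# when lookup C₁ j) when lookup (edge j) v))))
      (≤-trans (sum-mono-≤ {g = λ j → ℓ * (1# when lookup C₁ j)} (λ j → edge≤ j (lookup C₁ j)))
      (≤-reflexive (trans (sum-* ℓ (λ j → 1# when lookup C₁ j)) (*-congˡ (sym (⟦∣∣⟧ C₁))))))))
      where
      β-1≤ : ∀ v → ⟦ β ⟧ - 1# ≤ Σ⋆ v (λ j → 1# when lookup C₁ j)
      β-1≤ v = ≤-respʳ (⟦∣star∩∣⟧ v C₁) (≤-by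
        (0≤y-x (⟦⟧-mono-≤ {β} {suc ∣ star v ∩ C₁ ∣} (ℕ.≤-trans (β≤b v) (C₁-covers v))))
        (solve 2 (λ c b → c :- (b :- :1) := :1 :+ c :- b) refl ⟦ ∣ star v ∩ C₁ ∣ ⟧ ⟦ β ⟧))
      edge≤ : ∀ j s → sum (λ v → (1# when s) when lookup (edge j) v) ≤ ℓ * (1# when s)
      edge≤ j true  = ≤-trans (≤-reflexive (sym (⟦∣∣⟧ (edge j))))
        (≤-trans (⟦⟧-mono-≤ {∣ edge j ∣} {maxEdgeSize} (∣edge∣≤ℓ j))
          (≤-reflexive (sym (*-identityʳ ℓ))))
      edge≤ j false = ≤-reflexive (trans (sum-cong (λ v → when-0 (lookup (edge j) v)))
        (trans (sum-const {suc n} 0#) (trans (zeroʳ n′) (sym (zeroʳ ℓ)))))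
        where
        when-0 : ∀ s → 0# when s ≈ 0#
        when-0 true  = refl
        when-0 false = refl

    thr₁ thr₂ ω : Carrier
    ω    = ((⟦ β ⟧ - 1#) * z) / (⟦ 18 ⟧ * ℓ) * e
    thr₁ = (1# - 1# / ⟦ 2 ⟧ * (1# - ε) * z) * δ * Opt
    thr₂ = (1# - ω) * δ * Opt

    2thr₁ : ⟦ 2 ⟧ * thr₁ ≈ ⟦ 2 ⟧ * (δ * Opt) - (1# - ε) * G
    2thr₁ = begin
      ⟦ 2 ⟧ * thr₁
        ≈⟨ solve 5 (λ i f z d o → # 2 :* ((:1 :- :1 :* i :* f :* z) :* d :* o) := # 2 :* (d :* o) :-
          # 2 :* i :* (f :* (z :* (d :* o)))) refl half (1# - ε) z δ Opt ⟩
      ⟦ 2 ⟧ * (δ * Opt) - ⟦ 2 ⟧ * half * ((1# - ε) * G)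
        ≈⟨ +-congˡ (-‿cong (trans (*-congʳ (*-inverseʳ 0<⟦1+ 1 ⟧)) (*-identityˡ _))) ⟩
      ⟦ 2 ⟧ * (δ * Opt) - (1# - ε) * G ∎
      where open ≈

    private
      0<6ℓ : 0# < ⟦ 6 ⟧ * ℓ
      0<6ℓ = 0<⟦1+ 5 ⟧ 0<* 0<ℓ

      -- Ties the branching threshold to the second term of the maximum: each edge of C₁ saves 1/3,
      -- so |C₁| ≥ α Opt saves ω δ Opt.
      α≈3ωδ : α ≈ ⟦ 3 ⟧ * ω * δ
      α≈3ωδ = ≤-antisym (*-cancelˡ-≤ 0<6ℓ (≤-reflexive eq))
        (*-cancelˡ-≤ 0<6ℓ (≤-reflexive (sym eq)))
        where
        open ≈
        ω′ = ((⟦ β ⟧ - 1#) * z) / (⟦ 18 ⟧ * ℓ)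
        eq : ⟦ 6 ⟧ * ℓ * α ≈ ⟦ 6 ⟧ * ℓ * (⟦ 3 ⟧ * ω * δ)
        eq = begin
          ⟦ 6 ⟧ * ℓ * α                      ≈⟨ 6ℓα≈ ⟩
          (⟦ β ⟧ - 1#) * δ * z * e
            ≈⟨ solve 4 (λ b d z e → b :* d :* z :* e := b :* z :* e :* d) refl (⟦ β ⟧ - 1#) δ z e ⟩
          (⟦ β ⟧ - 1#) * z * e * δ
            ≈⟨ *-congʳ (*-congʳ (*-/-cancel _ (0<⟦1+ 17 ⟧ 0<* 0<ℓ))) ⟨
          ⟦ 18 ⟧ * ℓ * ω′ * e * δ
            ≈⟨ solve 4 (λ l w e d → # 18 :* l :* w :* e :* d := # 6 :* l :* (# 3 :* (w :* e) :* d))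
            refl ℓ ω′ e δ ⟩
          ⟦ 6 ⟧ * ℓ * (⟦ 3 ⟧ * ω * δ)        ∎

    3thr₂ : ⟦ 3 ⟧ * thr₂ ≈ ⟦ 3 ⟧ * (δ * Opt) - α * Opt
    3thr₂ = trans (solve 3 (λ w d o → # 3 :* ((:1 :- w) :* d :* o) := # 3 :* (d :* o) :- # 3 :* w :*
      d :* o) refl ω δ Opt)
      (+-congˡ (-‿cong (*-congʳ (sym α≈3ωδ))))

    support<thr₁ : (1# - ε) * G < ⟦ 2 ⟧ * K → ⟦ ∣ support ∣ ⟧ < thr₁
    support<thr₁ G<2K = *-cancelˡ-< 0≤⟦ 2 ⟧ (<-respʳ-≈ (sym 2thr₁) (<-by (0<y-x G<2K)
      (solve 3 (λ w g s → # 2 :* w :- g :- # 2 :* s := # 2 :* (w :- s) :- g) refl (δ * Opt)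
        ((1# - ε) * G) ⟦ ∣ support ∣ ⟧)))

    -- The case of small excess, 2 K ≤ (1 - ε) G.

    module SmallExcess (2K≤ : ⟦ 2 ⟧ * K ≤ (1# - ε) * G) where

      private
        2G≤DOpt : ⟦ 2 ⟧ * G ≤ D * Opt
        2G≤DOpt = ≤-by (0≤y-x 2δz≤D 0≤* <⇒≤ 0<Opt)
          (solve 4 (λ D d z o → D :* o :- # 2 :* (z :* (d :* o)) := (D :- # 2 :* d :* z) :* o) refl
            D δ z Opt)

        4K≤DOpt : ⟦ 4 ⟧ * K ≤ (1# - ε) * (D * Opt)
        4K≤DOpt = ≤-by (0≤⟦ 2 ⟧ 0≤* 0≤y-x 2K≤ 0≤+ 0≤y-x (<⇒≤ ε<1) 0≤* 0≤y-x 2G≤DOpt)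
          (solve 4 (λ k f g w → f :* w :- # 4 :* k := # 2 :* (f :* g :- # 2 :* k) :+ f :*
            (w :- # 2 :* g)) refl K (1# - ε) G (D * Opt))

      ones≢0 : ∣ ones ∣ ≢ 0
      ones≢0 o≡0 = <⇒≱ 0<DOpt (≤-by (0≤⟦ 2 ⟧ 0≤* 0≤y-x (ones≡0⇒D*Opt≤2K o≡0) 0≤+ 0≤y-x 4K≤DOpt 0≤+
        0≤ε 0≤* <⇒≤ 0<DOpt)
        (solve 3 (λ k ε w → # 0 :- w := # 2 :* (# 2 :* k :- w) :+ ((:1 :- ε) :* w :- # 4 :* k) :+ ε
          :* w) refl K ε (D * Opt)))

      -- 4 D Opt ≤ 4 K + 4 D n, and 4 K ≤ D Opt by `4K≤DOpt`.
      3Opt≤4n : ⟦ 3 ⟧ * Opt ≤ ⟦ 4 ⟧ * n′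
      3Opt≤4n = *-cancelˡ-≤ 0<D (≤-by
        (0≤⟦ 4 ⟧ 0≤* 0≤y-x D*Opt≤K+D*n 0≤+ 0≤y-x 4K≤DOpt 0≤+ 0≤ε 0≤* <⇒≤ 0<DOpt)
        (solve 5 (λ d n o k ε → d :* (# 4 :* n) :- d :* (# 3 :* o) :=
          # 4 :* (k :+ d :* n :- d :* o) :+ ((:1 :- ε) :* (d :* o) :- # 4 :* k) :+ ε :* (d :* o))
            refl D n′ Opt K ε))

      1≤ones : 1 ℕ.≤ ∣ ones ∣
      1≤ones = ℕ.n≢0⇒n>0 ones≢0

      D≤K : D ≤ K
      D≤K = ≤-trans (≤-reflexive (sym (*-identityʳ D))) (≤-trans
        (*-monoʳ-≤ 0≤D (≤-respˡ (+-identityʳ 1#) (⟦⟧-mono-≤ {1} {∣ ones ∣} 1≤ones))) D*ones≤K)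

      -- Each edge pays 3 δ x j. Membership in C₁₂ costs 3, and membership in C₁ one more,
      -- affordable as δ x j ≥ 2 δ / (δ + 1) ≥ 4/3 for δ ≥ 2. An edge of value one pays at least 6
      -- for a cost of at most 4, which makes the total strict.
      C₁₂<thr₂ : α * Opt ≤ ⟦ ∣ C₁ ∣ ⟧ → ⟦ ∣ C₁₂ ∣ ⟧ < thr₂
      C₁₂<thr₂ αOpt≤ = *-cancelˡ-< 0≤⟦ 3 ⟧
        (<-respʳ-≈ (sym 3thr₂) (<-by (0<y-x total<  0<+≤ 0≤y-x αOpt≤)
        (solve 4 (λ w α c₁ c → # 3 :* w :- α :- # 3 :* c := # 3 :* w :- (# 3 :* c :+ c₁) :+
          (c₁ :- α)) refl (δ * Opt) (α * Opt) ⟦ ∣ C₁ ∣ ⟧ ⟦ ∣ C₁₂ ∣ ⟧)))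
        where
        used : Bool → Bool → Carrier
        used c₁₂ c₁ = ⟦ 3 ⟧ * (1# when c₁₂) + 1# when c₁
        used≤ : ∀ {j c₁ c₂ c₃} → Class j c₁ c₂ c₃ → used (c₁ ∨ c₂) c₁ ≤ ⟦ 3 ⟧ * (δ * x j)
        used≤ {j} (in₁ large) = ≤-by (0≤⟦ 2 ⟧ 0≤* 0≤y-x large 0≤+ 0≤y-x 1≤D 0≤* 0≤x j)
          (solve 2 (λ D x → # 3 :* ((:1 :+ D) :* x) :- (# 3 :* :1 :+ :1) := # 2 :*
            ((# 2 :+ D) :* x :- # 2) :+ (D :- :1) :* x) refl D (x j))
        used≤ {j} (in₂ _ 1≤δx) = ≤-by (0≤⟦ 3 ⟧ 0≤* 0≤y-x 1≤δx)
          (solve 1 (λ w → # 3 :* w :- (# 3 :* :1 :+ # 0) := # 3 :* (w :- :1)) refl (δ * x j))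
        used≤ {j} (in₃ _ _) = ≤-by (0≤⟦ 3 ⟧ 0≤* (<⇒≤ 0<δ 0≤* 0≤x j))
          (solve 1 (λ w → # 3 :* w :- (# 3 :* # 0 :+ # 0) := # 3 :* w) refl (δ * x j))
        used≤ {j} (out _) = ≤-by (0≤⟦ 3 ⟧ 0≤* (<⇒≤ 0<δ 0≤* 0≤x j))
          (solve 1 (λ w → # 3 :* w :- (# 3 :* # 0 :+ # 0) := # 3 :* w) refl (δ * x j))
        used≤4 : ∀ s t → used s t ≤ ⟦ 4 ⟧
        used≤4 s t = ≤-by (0≤⟦ 3 ⟧ 0≤* 0≤y-x (bit s) 0≤+ 0≤y-x (bit t))
          (solve 2 (λ s t → # 4 :- (# 3 :* s :+ t) := # 3 :* (:1 :- s) :+ (:1 :- t)) refl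
            (1# when s) (1# when t))
          where
          bit : ∀ s → 1# when s ≤ 1#
          bit true  = ≤-refl
          bit false = 0≤1
        big : Fin m
        big = proj₁ (nonempty⇒one ones≢0)
        4<3δx : ⟦ 4 ⟧ < ⟦ 3 ⟧ * (δ * x big)
        4<3δx = <-by (0<⟦1+ 1 ⟧ 0<+≤ 0≤⟦ 3 ⟧ 0≤* 0≤y-x 1≤D 0<+≤ 0≤⟦ 3 ⟧ 0≤* <⇒≤ 0<δ 0≤* 0≤y-x
          (proj₂ (nonempty⇒one ones≢0)))
          (solve 2 (λ D x → # 3 :* ((:1 :+ D) :* x) :- # 4 := # 2 :+ # 3 :* (D :- :1) :+ # 3 :*
            (:1 :+ D) :* (x :- :1)) refl D (x big))
        usedAt : Fin m → Carrier
        usedAt j = used (lookup C₁₂ j) (lookup C₁ j)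
        usedAt≤ : ∀ j → usedAt j ≤ ⟦ 3 ⟧ * (δ * x j)
        usedAt≤ j = ≤-respˡ (+-congʳ (*-congˡ
          (reflexive (≡.cong (1# when_) (≡.sym (lookup-C₁₂ j)))))) (used≤ (classify j))
        total< : ⟦ 3 ⟧ * ⟦ ∣ C₁₂ ∣ ⟧ + ⟦ ∣ C₁ ∣ ⟧ < ⟦ 3 ⟧ * (δ * Opt)
        total< = <-respˡ-≈ (trans (sum-+ (λ j → ⟦ 3 ⟧ * (1# when lookup C₁₂ j))
          (λ j → 1# when lookup C₁ j))
            (+-cong (trans (sum-* ⟦ 3 ⟧ (λ j → 1# when lookup C₁₂ j)) (*-congˡ (sym (⟦∣∣⟧ C₁₂))))
              (sym (⟦∣∣⟧ C₁))))
          (<-respʳ-≈ (trans (sum-* ⟦ 3 ⟧ (λ j → δ * x j)) (*-congˡ (sum-* δ x)))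
            (sum-mono-< {f = usedAt} usedAt≤ big
              (≤-<-trans (used≤4 (lookup C₁₂ big) (lookup C₁ big)) 4<3δx)))

      -- Small excess with few edges in C₁: the randomised branch.

      module FewLarge (∣C₁∣<αOpt : ⟦ ∣ C₁ ∣ ⟧ < α * Opt) where

        -- The factors β - 1 and 1/ℓ of α are those of the incidence count, so both cancel.
        6n<eG : ⟦ 6 ⟧ * n′ < e * G
        6n<eG = *-cancelˡ-< (<⇒≤ 0<β-1) (≤-<-trans
          (≤-by (0≤⟦ 6 ⟧ 0≤* 0≤y-x [β-1]n≤ℓ∣C₁∣)
            (solve 4 (λ b n l c → # 6 :* l :* c :- b :* (# 6 :* n) := # 6 :* (l :* c :- b :* n))
              refl (⟦ β ⟧ - 1#) n′ ℓ ⟦ ∣ C₁ ∣ ⟧))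
          (<-respʳ-≈ (begin
              ⟦ 6 ⟧ * ℓ * (α * Opt)                ≈⟨ *-assoc _ _ _ ⟨
              ⟦ 6 ⟧ * ℓ * α * Opt                  ≈⟨ *-congʳ 6ℓα≈ ⟩
              (⟦ β ⟧ - 1#) * δ * z * e * Opt
                ≈⟨ solve 5 (λ b d z e o → b :* d :* z :* e :* o := b :* (e :* (z :* (d :* o)))) refl
                (⟦ β ⟧ - 1#) δ z e Opt ⟩
              (⟦ β ⟧ - 1#) * (e * G)               ∎)
            (<-by (0<6ℓ 0<* 0<y-x ∣C₁∣<αOpt)
              (solve 3 (λ l a c → l :* a :- l :* c := l :* (a :- c)) refl (⟦ 6 ⟧ * ℓ) (α * Opt) ⟦ ∣
                C₁ ∣ ⟧))))
          where open ≈

        -- From 9 Opt ≤ 12 n < 2 e G. Opt cancels and leaves a condition on the parameters alone.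
        9<2δez : ⟦ 9 ⟧ < ⟦ 2 ⟧ * (δ * e * z)
        9<2δez = *-cancelˡ-< (<⇒≤ 0<Opt)
          (<-by (0<⟦1+ 1 ⟧ 0<* 0<y-x 6n<eG 0<+≤ 0≤⟦ 3 ⟧ 0≤* 0≤y-x 3Opt≤4n)
          (solve 5 (λ o d e z n → o :* (# 2 :* (d :* e :* z)) :- o :* # 9 :=
            # 2 :* (e :* (z :* (d :* o)) :- # 6 :* n) :+ # 3 :* (# 4 :* n :- # 3 :* o)) refl Opt δ e
              z n′))

        private
          ^-antimono : ∀ {y} → 0# ≤ y → y ≤ 1# → ∀ {i j} → i ℕ.≤ j → y ^ j ≤ y ^ i
          ^-antimono 0≤y y≤1 {j = j} z≤n = ^-≤1 j 0≤y y≤1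
          ^-antimono 0≤y y≤1 (s≤s i≤j)   = *-monoʳ-≤ 0≤y (^-antimono 0≤y y≤1 i≤j)

        -- For δ ≤ 3 the bound exp(a) ≤ (2/(1+ε))ᵏ (2/(1+z))^(δ-1), together with
        -- ε ≤ ((1+ε)/2)², contradicts 9 < 2 δ z exp(a).
        3≤D : ⟦ 3 ⟧ ≤ D
        3≤D = ⟦⟧-mono-≤ {3} {δ∸1} (ℕ.≮⇒≥ {δ∸1} λ { (s≤s δ∸1≤2) → <-irrefl refl (impossible δ∸1≤2) })
          where
          y₁ y₂ u v : Carrier
          y₁ = (1# - ε) * half
          y₂ = (1# - z) * half
          u  = (1# - y₁) ^ k
          v  = 1# - y₂
          0≤1-ε = 0≤y-x (<⇒≤ ε<1)
          0≤1-z = 0≤y-x z≤1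
          1-p≤1 : ∀ {p} → 0# ≤ p → 1# - p ≤ 1#
          1-p≤1 {p} 0≤p = ≤-by 0≤p (solve 1 (λ p → :1 :- (:1 :- p) := p) refl p)
          y₁≤1 : y₁ ≤ 1#
          y₁≤1 = p/2≤1 0≤1-ε (1-p≤1 0≤ε)
          y₂≤1 : y₂ ≤ 1#
          y₂≤1 = p/2≤1 0≤1-z (1-p≤1 0≤z)
          0≤y₁ = 0≤1-ε 0≤* 0≤half
          0≤y₂ = 0≤1-z 0≤* 0≤half
          0≤u : 0# ≤ u
          0≤u = 0≤^ k (0≤y-x y₁≤1)
          0≤v : 0# ≤ v
          0≤v = 0≤y-x y₂≤1
          bound-a : u * v ^ δ∸1 ≼exp- a
          bound-a = ≼-weaken 0≤a (≤-reflexive a≈)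
            (≼-* (≼-^ k (1-y≼ 0≤y₁ y₁≤1)) (≼-^ δ∸1 (1-y≼ 0≤y₂ y₂≤1)))
            where
            open ≈
            a≈ : a ≈ ⟦ k ⟧ * y₁ + ⟦ δ∸1 ⟧ * y₂
            a≈ = begin
              a                            ≈⟨ *-identityˡ a ⟨
              1# * a                       ≈⟨ *-congʳ (*-inverseʳ 0<⟦1+ 1 ⟧) ⟨
              ⟦ 2 ⟧ * half * a
                ≈⟨ solve 2 (λ h a → # 2 :* h :* a := h :* (# 2 :* a)) refl half a ⟩
              half * (⟦ 2 ⟧ * a)           ≈⟨ *-congˡ 2a≈ ⟨
              half * (⟦ k ⟧ * (1# - ε) + D * (1# - z))
                ≈⟨ solve 5 (λ h k e d z → h :* (k :* e :+ d :* z) := k :* (e :* h) :+ d :* (z :* h))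
                  refl half ⟦ k ⟧ (1# - ε) D (1# - z) ⟩
              ⟦ k ⟧ * y₁ + ⟦ δ∸1 ⟧ * y₂    ∎
          -- As v ≤ 1, the exponent δ - 1 can be replaced by its largest value 2.
          uv²e≤1 : δ∸1 ℕ.≤ 2 → u * (v * v) * e ≤ 1#
          uv²e≤1 δ∸1≤2 = ≤-trans (*-mono-≤ (0≤u 0≤* (0≤v 0≤* 0≤v)) (<⇒≤ 0<e)
            (*-monoʳ-≤ 0≤u (≤-respˡ (*-congˡ (*-identityʳ v)) (^-antimono 0≤v (1-p≤1 0≤y₂) δ∸1≤2)))
              ≤-refl)
            (≼-IsExp bound-a exp)
          z≤u² : z ≤ u * u
          z≤u² = ≤-trans (^-monoˡ-≤ k 0≤ε
            (≤-respˡ (solve 1 (λ ε → :1 :- (:1 :- ε) := ε) refl ε) (1-p≤[1-p/2]² (1# - ε))))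
            (≤-reflexive (^-distrib-* (1# - y₁) (1# - y₁) k))
          2v : ⟦ 2 ⟧ * v ≈ 1# + z
          2v = trans (solve 2 (λ z h → # 2 :* (:1 :- (:1 :- z) :* h) := # 2 :- (:1 :- z) :*
            (# 2 :* h)) refl z half)
            (trans (+-congˡ (-‿cong (*-congˡ (*-inverseʳ 0<⟦1+ 1 ⟧))))
              (solve 1 (λ z → # 2 :- (:1 :- z) :* :1 := :1 :+ z) refl z))
          module _ (δ∸1≤2 : δ∸1 ℕ.≤ 2) where
            open ≈
            f = e * z
            0≤f : 0# ≤ f
            0≤f = <⇒≤ 0<e 0≤* 0≤z
            3<2f : ⟦ 3 ⟧ < ⟦ 2 ⟧ * f
            3<2f = *-cancelˡ-< 0≤⟦ 3 ⟧ (<-≤-trans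
              (<-respˡ-≈ (solve 0 (# 9 := # 3 :* # 3) refl) 9<2δez)
              (≤-by (0≤⟦ 2 ⟧ 0≤* 0≤f 0≤* 0≤y-x (⟦⟧-mono-≤ {δ∸1} {2} δ∸1≤2))
                (solve 3 (λ D e z → # 3 :* (# 2 :* (e :* z)) :- # 2 :* ((:1 :+ D) :* e :* z) := # 2
                  :* (e :* z) :* (# 2 :- D)) refl D e z)))
            w = v * v
            g = u * w * e
            zw²e²≤1 : z * (w * w) * (e * e) ≤ 1#
            zw²e²≤1 = ≤-trans (≤-by (0≤y-x z≤u² 0≤* (0≤x² w 0≤* 0≤x² e))
                (solve 4 (λ z u w e → u :* w :* e :* (u :* w :* e) :- z :* (w :* w) :* (e :* e) :=
                  (u :* u :- z) :* (w :* w :* (e :* e))) refl z u w e))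
              (≤-respʳ (*-identityˡ 1#) (*-mono-≤ (0≤u 0≤* (0≤v 0≤* 0≤v) 0≤* <⇒≤ 0<e) 0≤1
                (uv²e≤1 δ∸1≤2) (uv²e≤1 δ∸1≤2)))
            -- Squaring 3 < 2 e z and using z w² e² ≤ 1 eliminates e.
            9w²≤4z : ⟦ 9 ⟧ * (w * w) ≤ ⟦ 4 ⟧ * z
            9w²≤4z = ≤-trans (≤-by (0≤x² w 0≤* (0≤y-x (<⇒≤ 3<2f) 0≤* (0≤⟦ 2 ⟧ 0≤* 0≤f 0≤+ 0≤⟦ 3 ⟧)))
                (solve 3 (λ e z w → # 4 :* z :* (z :* (w :* w) :* (e :* e)) :- # 9 :* (w :* w) :=
                  w :* w :* ((# 2 :* (e :* z) :- # 3) :* (# 2 :* (e :* z) :+ # 3))) refl e z w))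
              (≤-respʳ (*-identityʳ _) (*-monoʳ-≤ (0≤⟦ 4 ⟧ 0≤* 0≤z) zw²e²≤1))
            16w² : ⟦ 16 ⟧ * (w * w) ≈ (1# + z) * (1# + z) * ((1# + z) * (1# + z))
            16w² = begin
              ⟦ 16 ⟧ * (w * w)  ≈⟨ solve 1
                (λ v → # 16 :* (v :* v :* (v :* v)) := # 2 :* v :* (# 2 :* v) :*
                (# 2 :* v :* (# 2 :* v))) refl v ⟩
              ⟦ 2 ⟧ * v * (⟦ 2 ⟧ * v) * (⟦ 2 ⟧ * v * (⟦ 2 ⟧ * v))
                ≈⟨ *-cong (*-cong 2v 2v) (*-cong 2v 2v) ⟩
              (1# + z) * (1# + z) * ((1# + z) * (1# + z)) ∎
            -- With 2 v = 1 + z the previous bound becomes 9 (1 + z)⁴ ≤ 64 z, but 9 (1 + z)⁴ - 64 z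
            -- = 5 + (2 - 7 z)² + 5 z² + 9 z³ (4 + z) is positive.
            impossible : 0# < 0#
            impossible = <-≤-trans
              (0<⟦1+ 4 ⟧ 0<+≤ 0≤x² (⟦ 2 ⟧ - ⟦ 7 ⟧ * z) 0<+≤ 0≤⟦ 5 ⟧ 0≤* 0≤x² z 0<+≤
                0≤⟦ 9 ⟧ 0≤* (0≤z 0≤* 0≤z 0≤* 0≤z 0≤* (⟦4⟧+z)))
              (≤-by (0≤⟦ 16 ⟧ 0≤* 0≤y-x 9w²≤4z) (begin
                0# - (⟦ 5 ⟧ + (⟦ 2 ⟧ - ⟦ 7 ⟧ * z) * (⟦ 2 ⟧ - ⟦ 7 ⟧ * z) + ⟦ 5 ⟧ * (z * z) + ⟦ 9 ⟧ *
                  (z * z * z * (⟦ 4 ⟧ + z)))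
                  ≈⟨ solve 1 (λ z → # 0 :- (# 5 :+ (# 2 :- # 7 :* z) :* (# 2 :- # 7 :* z) :+ # 5 :*
                    (z :* z) :+ # 9 :* (z :* z :* z :* (# 4 :+ z))) :=
                       # 64 :* z :- # 9 :* ((:1 :+ z) :* (:1 :+ z) :* ((:1 :+ z) :* (:1 :+ z))))
                         refl z ⟩
                ⟦ 64 ⟧ * z - ⟦ 9 ⟧ * ((1# + z) * (1# + z) * ((1# + z) * (1# + z)))
                  ≈⟨ +-congˡ (-‿cong (*-congˡ 16w²)) ⟨
                ⟦ 64 ⟧ * z - ⟦ 9 ⟧ * (⟦ 16 ⟧ * (w * w))
                  ≈⟨ solve 2 (λ z t → # 64 :* z :- # 9 :* (# 16 :* t) := # 16 :*
                    (# 4 :* z :- # 9 :* t)) refl z (w * w) ⟩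
                ⟦ 16 ⟧ * (⟦ 4 ⟧ * z - ⟦ 9 ⟧ * (w * w)) ∎))
              where
              ⟦4⟧+z : 0# ≤ ⟦ 4 ⟧ + z
              ⟦4⟧+z = 0≤⟦ 4 ⟧ 0≤+ 0≤z

        private
          3≤K : ⟦ 3 ⟧ ≤ K
          3≤K = ≤-trans 3≤D D≤K

          -- ε ≥ D / (2 (D + 1)), which is at least 3/8 for D ≥ 3.
          3≤8ε : ⟦ 3 ⟧ ≤ ⟦ 8 ⟧ * ε
          3≤8ε = *-cancelˡ-≤ 0<δ (≤-by (0≤⟦ 4 ⟧ 0≤* 0≤y-x D≤2δε 0≤+ 0≤y-x 3≤D)
            (solve 2 (λ D ε → (:1 :+ D) :* (# 8 :* ε) :- (:1 :+ D) :* # 3 := # 4 :*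
              (# 2 :* (:1 :+ D) :* ε :- D) :+ (D :- # 3)) refl D ε))

          -- 4 a = 2 (κ + D q) ≥ 2 δ (1 - z) ≥ D + 2 ≥ 5, by Bernoulli's inequality q ≤ κ and 2 δ z
          -- ≤ D.
          3≤e : ⟦ 3 ⟧ ≤ e
          3≤e = exp≥3 (≤-respʳ (trans (*-congˡ 2a≈)
            (solve 1 (λ a → # 2 :* (# 2 :* a) := # 4 :* a) refl a))
            (≤-by (0≤⟦ 2 ⟧ 0≤* 0≤y-x q≤κ 0≤+ 0≤y-x 2δz≤D 0≤+ 0≤y-x 3≤D)
              (solve 3 (λ κ D z → # 2 :* (κ :+ D :* (:1 :- z)) :- # 5 :=
                # 2 :* (κ :- (:1 :- z)) :+ (D :- # 2 :* (:1 :+ D) :* z) :+ (D :- # 3)) refl κ D z)))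
                  exp

          0<G : 0# < G
          0<G = *-cancelˡ-< (<⇒≤ 0<e) (≤-<-trans (≤-reflexive (zeroʳ e))
            (≤-<-trans (0≤⟦ 6 ⟧ 0≤* 0≤⟦ suc n ⟧) 6n<eG))

          -- `W` bounds the expected number of repairs, `A` is the margin above the mean, `V` the
          -- variance before repairing.
          W A V : Carrier
          W = sum (λ v → 𝔼 (uncoveredBound v) run)
          A = thr₁ - μ
          V = sum (λ j → π j * (1# - π j))

          18W≤G : ⟦ 18 ⟧ * W ≤ G
          18W≤G = *-cancelˡ-≤ 0<e (≤-trans
            (≤-by (0≤⟦ 6 ⟧ 0≤* 0≤y-x 3eW≤n)
              (solve 3 (λ e w n → # 6 :* n :- e :* (# 18 :* w) := # 6 :* (n :- # 3 :* e :* w)) refl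
                e W n′))
            (<⇒≤ 6n<eG))
            where
            3eW≤n : ⟦ 3 ⟧ * e * W ≤ n′
            3eW≤n = ≤-trans (≤-reflexive (sym (sum-* (⟦ 3 ⟧ * e) (λ v → 𝔼 (uncoveredBound v) run))))
              (≤-trans (sum-mono-≤ {g = λ _ → 1#} (𝔼-uncoveredBound 2a≈ exp 3≤e))
                (≤-reflexive (trans (sum-const {suc n} 1#) (*-identityʳ n′))))

          -- A ≥ (1 + ε) G / 2, since the mean is at most δ Opt - G; and (1 + 3/8) / 2 = 11/16.
          11G≤16A : ⟦ 11 ⟧ * G ≤ ⟦ 16 ⟧ * A
          11G≤16A = ≤-by (0≤⟦ 16 ⟧ 0≤* 0≤y-x μ≤ 0≤+ 0≤y-x 3≤8ε 0≤* <⇒≤ 0<G) (begin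
            ⟦ 16 ⟧ * (thr₁ - μ) - ⟦ 11 ⟧ * G
              ≈⟨ solve 3 (λ t μ g → # 16 :* (t :- μ) :- # 11 :* g := # 8 :* (# 2 :* t) :- # 16 :* μ
                :- # 11 :* g) refl thr₁ μ G ⟩
            ⟦ 8 ⟧ * (⟦ 2 ⟧ * thr₁) - ⟦ 16 ⟧ * μ - ⟦ 11 ⟧ * G
              ≈⟨ +-congʳ (+-congʳ (*-congˡ 2thr₁)) ⟩
            ⟦ 8 ⟧ * (⟦ 2 ⟧ * (δ * Opt) - (1# - ε) * G) - ⟦ 16 ⟧ * μ - ⟦ 11 ⟧ * G
              ≈⟨ solve 4 (λ ε μ z w → # 8 :* (# 2 :* w :- (:1 :- ε) :* (z :* w)) :- # 16 :* μ :- #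
                11 :* (z :* w) :=
                   # 16 :* ((:1 :- z) :* w :- μ) :+ (# 8 :* ε :- # 3) :* (z :* w)) refl ε μ z
                     (δ * Opt) ⟩
            ⟦ 16 ⟧ * ((1# - z) * (δ * Opt) - μ) + (⟦ 8 ⟧ * ε - ⟦ 3 ⟧) * G ∎)
            where open ≈

          0<A : 0# < A
          0<A = *-cancelˡ-< 0≤⟦ 16 ⟧ (≤-<-trans (≤-reflexive (zeroʳ _))
            (<-≤-trans (0<⟦1+ 10 ⟧ 0<* 0<G) 11G≤16A))

          -- S - μ = A + (1 - ε) G / 2 - K, where (1 - ε) / 2 ≤ 5/16 and K ≥ 3 gives 48 = 16 · 3.
          16V≤ : ⟦ 16 ⟧ * V ≤ ⟦ 16 ⟧ * A + ⟦ 5 ⟧ * G - ⟦ 48 ⟧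
          16V≤ = ≤-by (0≤⟦ 16 ⟧ 0≤* 0≤y-x variance≤ 0≤+ 0≤⟦ 16 ⟧ 0≤* 0≤y-x 3≤K 0≤+ 0≤y-x 3≤8ε 0≤*
            <⇒≤ 0<G) (begin
            ⟦ 16 ⟧ * (thr₁ - μ) + ⟦ 5 ⟧ * G - ⟦ 48 ⟧ - ⟦ 16 ⟧ * V
              ≈⟨ solve 4 (λ t μ g v → # 16 :* (t :- μ) :+ # 5 :* g :- # 48 :- # 16 :* v :=
                   # 8 :* (# 2 :* t) :- # 16 :* μ :+ # 5 :* g :- # 48 :- # 16 :* v) refl thr₁ μ G V
                     ⟩
            ⟦ 8 ⟧ * (⟦ 2 ⟧ * thr₁) - ⟦ 16 ⟧ * μ + ⟦ 5 ⟧ * G - ⟦ 48 ⟧ - ⟦ 16 ⟧ * V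
              ≈⟨ +-congʳ (+-congʳ (+-congʳ (+-congʳ (*-congˡ 2thr₁)))) ⟩
            ⟦ 8 ⟧ * (⟦ 2 ⟧ * (δ * Opt) - (1# - ε) * G) - ⟦ 16 ⟧ * μ + ⟦ 5 ⟧ * G - ⟦ 48 ⟧ - ⟦ 16 ⟧ *
              V
              ≈⟨ solve 6 (λ w ε g μ v s → # 8 :* (# 2 :* w :- (:1 :- ε) :* g) :- # 16 :* μ :+ # 5 :*
                g :- # 48 :- # 16 :* v :=
                   # 16 :* (s :- μ :- v) :+ # 16 :* (w :- s :- # 3) :+ (# 8 :* ε :- # 3) :* g) refl
                     (δ * Opt) ε G μ V ⟦ ∣ support ∣ ⟧ ⟩
            ⟦ 16 ⟧ * (⟦ ∣ support ∣ ⟧ - μ - V) + ⟦ 16 ⟧ * (K - ⟦ 3 ⟧) + (⟦ 8 ⟧ * ε - ⟦ 3 ⟧) * G ∎)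
            where open ≈

          -- 11 V ≤ 16 A - 33 ≤ 2 A², since 2 A² - 16 A + 32 = 2 (A - 4)².
          11V≤2A² : ⟦ 11 ⟧ * V ≤ ⟦ 2 ⟧ * (A * A)
          11V≤2A² = *-cancelˡ-≤ 0<⟦1+ 15 ⟧ (≤-by
            (0≤⟦ 11 ⟧ 0≤* 0≤y-x 16V≤ 0≤+ 0≤⟦ 5 ⟧ 0≤* 0≤y-x 11G≤16A 0≤+ 0≤⟦ 16 ⟧ 0≤*
              (0≤⟦ 2 ⟧ 0≤* 0≤x² (A - ⟦ 4 ⟧) 0≤+ 0≤1))
            (solve 3 (λ a v g → # 16 :* (# 2 :* (a :* a)) :- # 16 :* (# 11 :* v) :=
              # 11 :* (# 16 :* a :+ # 5 :* g :- # 48 :- # 16 :* v) :+ # 5 :*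
                (# 16 :* a :- # 11 :* g) :+ # 16 :* (# 2 :* ((a :- # 4) :* (a :- # 4)) :+ :1)) refl
                A V G))

          -- V ≤ 18 A² / 99, and 2 A W ≤ A G / 9 ≤ 16 A² / 99.
          99[V+2AW]≤34A² : ⟦ 99 ⟧ * (V + ⟦ 2 ⟧ * A * W) ≤ ⟦ 34 ⟧ * (A * A)
          99[V+2AW]≤34A² = ≤-by
            (0≤⟦ 9 ⟧ 0≤* 0≤y-x 11V≤2A² 0≤+ (0≤⟦ 11 ⟧ 0≤* <⇒≤ 0<A) 0≤* 0≤y-x 18W≤G 0≤+ <⇒≤ 0<A 0≤*
              0≤y-x 11G≤16A)
            (solve 4 (λ a v w g → # 34 :* (a :* a) :- # 99 :* (v :+ # 2 :* a :* w) :=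
              # 9 :* (# 2 :* (a :* a) :- # 11 :* v) :+ # 11 :* a :* (g :- # 18 :* w) :+ a :*
                (# 16 :* a :- # 11 :* g)) refl A V W G)

        failure≤34/99 : ∀ {ρ} → thr₁ ≤ ρ → ∀ repair → IsRepair repair →
          ⟦ 99 ⟧ * (1# - 𝔼 (λ C → 1# when does (⟦ ∣ repair C ∣ ⟧ <? ρ)) run) ≤ ⟦ 34 ⟧
        failure≤34/99 {ρ} thr₁≤ρ repair isRepair = *-cancelˡ-≤ (0<A 0<* 0<A) (≤-trans
          (≤-trans (≤-reflexive (solve 2
            (λ a p → a :* (# 99 :* (:1 :- p)) := # 99 :* (a :+ :- a :* p)) refl (A * A)
            (𝔼 good run)))
            (*-monoʳ-≤ 0≤⟦ 99 ⟧ markov))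
          (≤-trans 99[V+2AW]≤34A² (≤-reflexive (*-comm _ _))))
          where
          good sq total : Subset m → Carrier
          good C  = 1# when does (⟦ ∣ repair C ∣ ⟧ <? ρ)
          sq C    = (successes C - μ) * (successes C - μ)
          total C = sum (λ v → uncoveredBound v C)

          0≤total : ∀ C → 0# ≤ total C
          0≤total C = sum-nonneg (λ v → 0≤uncoveredBound v C)

          repair≤ : ∀ C → C₁ ⊆ C → ⟦ ∣ repair C ∣ ⟧ ≤ successes C + total C
          repair≤ C C₁⊆C = ≤-trans (⟦⟧-mono-≤ {∣ repair C ∣}
            (repair-size C₁⊆C (proj₁ (isRepair C C₁⊆C))))
            (≤-trans (≤-reflexive (trans (×-homo-+ 1# (∣ C ∣) (∣ uncovered C ∣))
              (+-cong (⟦∣∣⟧ C) (⟦∣∣⟧ (uncovered C)))))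
              (+-mono-≤ ≤-refl (sum-mono-≤ {f = λ v → 1# when lookup (uncovered C) v}
                (uncovered≤ C₁⊆C))))

          -- The left side is 0 on success and A² on failure, where the deviation plus the number of
          -- repairs reaches A and `deviation` applies.
          pointwise : ∀ C → C₁ ⊆ C × C ⊆ support → A * A + - (A * A) * good C ≤ sq C + ⟦ 2 ⟧ * A *
            total C
          pointwise C (C₁⊆C , _) = by-cases (⟦ ∣ repair C ∣ ⟧ <? ρ)
            where
            by-cases : (d : Dec (⟦ ∣ repair C ∣ ⟧ < ρ)) → A * A + - (A * A) * (1# when does d) ≤ sq
              C + ⟦ 2 ⟧ * A * total C
            by-cases (yes _)  = ≤-respˡ (solve 1 (λ a → # 0 := a :+ :- a :* :1) refl (A * A))
              (0≤x² (successes C - μ) 0≤+ 0≤⟦ 2 ⟧ 0≤* <⇒≤ 0<A 0≤* 0≤total C)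
            by-cases (no bad) = ≤-respˡ (solve 1 (λ a → a := a :+ :- a :* # 0) refl (A * A))
              (deviation (<⇒≤ 0<A) (0≤total C)
                (≤-by (0≤y-x (≤-trans thr₁≤ρ (≤-trans (≮⇒≥ bad) (repair≤ C C₁⊆C))))
                (solve 4 (λ s μ r t → s :- μ :+ r :- (t :- μ) := s :+ r :- t) refl (successes C) μ
                  (total C) thr₁)))

          markov : A * A + - (A * A) * 𝔼 good run ≤ V + ⟦ 2 ⟧ * A * W
          markov = ≤-trans (≤-reflexive (sym
            (trans (𝔼-+ (λ _ → A * A) (λ C → - (A * A) * good C) run)
              (+-cong (𝔼-const (A * A) run) (𝔼-* (- (A * A)) good run)))))
            (≤-trans (𝔼-mono pointwise run valid-run run-outcome) (≤-reflexive
              (trans (𝔼-+ sq (λ C → ⟦ 2 ⟧ * A * total C) run)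
                (+-cong (trans (𝔼-successes² include μ)
                  (solve 2 (λ μ v → (μ :- μ) :* (μ :- μ) :+ v := v) refl μ V))
                  (trans (𝔼-* (⟦ 2 ⟧ * A) total run) (*-congˡ (𝔼-sum uncoveredBound run)))))))

    private
      -- 34/99 < 7/20, because 20 · 34 = 680 and 99 · 7 = 693.
      65%< : ∀ {p} → ⟦ 99 ⟧ * (1# - p) ≤ ⟦ 34 ⟧ → ⟦ 65 ⟧ / ⟦ 100 ⟧ < p
      65%< {p} 99y≤34 = *-cancelˡ-< 0≤⟦ 100 ⟧ (<-respˡ-≈ (sym (*-/-cancel ⟦ 65 ⟧ 0<⟦1+ 99 ⟧))
        (<-by (0<⟦1+ 4 ⟧ 0<* 0<y-x 20y<7)
          (solve 1 (λ p → # 100 :* p :- # 65 := # 5 :* (# 7 :- # 20 :* (:1 :- p))) refl p)))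
        where
        20y<7 : ⟦ 20 ⟧ * (1# - p) < ⟦ 7 ⟧
        20y<7 = *-cancelˡ-< 0≤⟦ 99 ⟧ (<-by (0≤⟦ 20 ⟧ 0≤* 0≤y-x 99y≤34 0≤+< 0<⟦1+ 12 ⟧)
          (solve 1 (λ y → # 99 :* # 7 :- # 99 :* (# 20 :* y) := # 20 :* (# 34 :- # 99 :* y) :+ # 13)
            refl (1# - p)))

      65%<1 : ∀ {p} → 1# ≤ p → ⟦ 65 ⟧ / ⟦ 100 ⟧ < p
      65%<1 {p} 1≤p = 65%< (≤-by (0≤⟦ 99 ⟧ 0≤* 0≤y-x 1≤p 0≤+ 0≤⟦ 34 ⟧)
        (solve 1 (λ p → # 34 :- # 99 :* (:1 :- p) := # 99 :* (p :- :1) :+ # 34) refl p))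

      C₁₂⊆support : C₁₂ ⊆ support
      C₁₂⊆support j∈ = [ C₁⊆support , C₂⊆support ]′ (x∈p∪q⁻ C₁ C₂ j∈)

    algorithm-multicover : ∀ repair → IsRepair repair → Always (IsMulticover b) (algorithm repair)
    algorithm-multicover repair isRepair = by-cases (does (α * Opt ≤? ⟦ ∣ C₁ ∣ ⟧))
      where
      by-cases : ∀ s → Always (IsMulticover b)
        (if s then return C₁₂ else (run >>= λ C → return (repair C)))
      by-cases true  = C₁₂-covers
      by-cases false = Always->>= run run-outcome λ C (C₁⊆C , _) → proj₂ (isRepair C C₁⊆C)

    algorithm-size : ∀ ρ → thr₁ ≤ ρ → thr₂ ≤ ρ → ∀ repair → IsRepair repair →
                     ⟦ 65 ⟧ / ⟦ 100 ⟧ < Pr (λ C → ⟦ ∣ C ∣ ⟧ <? ρ) (algorithm repair)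
    algorithm-size ρ thr₁≤ρ thr₂≤ρ repair isRepair =
      by-cases (α * Opt ≤? ⟦ ∣ C₁ ∣ ⟧) ((1# - ε) * G <? ⟦ 2 ⟧ * K)
      where
      good? : ∀ C → Dec (⟦ ∣ C ∣ ⟧ < ρ)
      good? C = ⟦ ∣ C ∣ ⟧ <? ρ

      Pr-run : Pr good? (run >>= λ C → return (repair C)) ≈ 𝔼
        (λ C → 1# when does (good? (repair C))) run
      Pr-run = trans (Pr≈𝔼 good? (run >>= λ C → return (repair C)))
        (𝔼->>= (λ C → 1# when does (good? C)) run (λ C → return (repair C)))

      Pr-certain : ∀ {C} → ⟦ ∣ C ∣ ⟧ < ρ → 1# ≤ 1# when does (good? C)
      Pr-certain {C} good = ≤-reflexive (reflexive
        (≡.cong (1# when_) (≡.sym (dec-true (good? C) good))))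

      ⊆support⇒good : (1# - ε) * G < ⟦ 2 ⟧ * K → ∀ C → C ⊆ support → ⟦ ∣ C ∣ ⟧ < ρ
      ⊆support⇒good G<2K C C⊆S = ≤-<-trans
        (⟦⟧-mono-≤ {∣ C ∣} (p⊆q⇒∣p∣≤∣q∣ {p = C} {q = support} C⊆S))
        (<-≤-trans (support<thr₁ G<2K) thr₁≤ρ)

      by-cases : (d : Dec (α * Opt ≤ ⟦ ∣ C₁ ∣ ⟧)) → Dec ((1# - ε) * G < ⟦ 2 ⟧ * K) →
        ⟦ 65 ⟧ / ⟦ 100 ⟧ < Pr good? (if does d then return C₁₂ else
          (run >>= λ C → return (repair C)))
      by-cases (yes _) (yes G<2K) = 65%<1 (Pr-certain {C₁₂} (⊆support⇒good G<2K C₁₂ C₁₂⊆support))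
      by-cases (yes αOpt≤) (no G≮2K) = 65%<1
        (Pr-certain {C₁₂} (<-≤-trans (SmallExcess.C₁₂<thr₂ (≮⇒≥ G≮2K) αOpt≤) thr₂≤ρ))
      by-cases (no _) (yes G<2K) = 65%<1
        (≤-respʳ (sym Pr-run) (≤-trans (≤-reflexive (sym (𝔼-const 1# run)))
        (𝔼-mono {f = λ _ → 1#} (λ C (C₁⊆C , C⊆S) → Pr-certain {repair C}
          (⊆support⇒good G<2K (repair C) (repair-support C⊆S (proj₁ (isRepair C C₁⊆C))))) run
            valid-run run-outcome)))
      by-cases (no αOpt≰) (no G≮2K) = <-respʳ-≈ (sym Pr-run)
        (65%< (SmallExcess.FewLarge.failure≤34/99 (≮⇒≥ G≮2K) (≰⇒> αOpt≰) thr₁≤ρ repair isRepair))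

-- The approximation guarantee and its parameter ranges.

theorem5 :
  (ℝ : CompleteOrderedField) → let open Reals ℝ in
  ∀ {n m : ℕ} (H : Hypergraph (suc n) m) (b : Fin (suc n) → ℕ) →
  let open Hypergraph H
      Δ  = maxDegree
      ℓ  = maxEdgeSize
      β  = minimum b
      δ  = suc (Δ ∸ β)
  in
  (∀ i → 2 ℕ.≤ b i) →
  (∀ i → b i ℕ.≤ degree i ∸ 1) →
  ∀ (k : ℕ) → 2 ℕ.≤ k →
  ∀ (ε : Carrier) →
  let c = (⟦ δ ⟧ - 1#) / (⟦ 2 ⟧ * ⟦ δ ⟧)
      a = (⟦ k ⟧ * (1# - ε) + (⟦ δ ⟧ - 1#) * (1# - ε ^ k)) / ⟦ 2 ⟧
  in
  c ≤ ε →
  ∀ (c^1/k : Carrier) → IsRoot k c c^1/k → ε ≤ c^1/k →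
  ∀ (exp[a] : Carrier) → IsExp a exp[a] →
  ∀ (x* : Fin m → Carrier) → IsLPOptimal H b x* →
  let α = ((⟦ β ⟧ - 1#) * ⟦ δ ⟧ * ε ^ k) / (⟦ 6 ⟧ * ⟦ ℓ ⟧) * exp[a]
      open SetMulticover H b δ k ε α x*
      ratio = ((1# - 1# / ⟦ 2 ⟧ * (1# - ε) * ε ^ k) * ⟦ δ ⟧)
            ⊔ ((1# - ((⟦ β ⟧ - 1#) * ε ^ k) / (⟦ 18 ⟧ * ⟦ ℓ ⟧) * exp[a]) * ⟦ δ ⟧)
  in
  RepairNeverStuck ×
  (∀ repair → IsRepair repair →
    Always (IsMulticover b) (algorithm repair) ×
    ⟦ 65 ⟧ / ⟦ 100 ⟧ < Pr (λ C → ⟦ ∣ C ∣ ⟧ <? ratio * Opt*) (algorithm repair))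
theorem5 ℝ {n} {m} H b 2≤b b≤deg-1 k 2≤k ε c≤ε c^1/k (0≤r , r^k≈c) ε≤r exp[a] isExp x* optimal =
  repairNeverStuck , λ repair isRepair →
    algorithm-multicover repair isRepair ,
    algorithm-size (ratio * Opt) (ratio-mono (x≤x⊔y R₁ R₂)) (ratio-mono (x≤y⊔x R₁ R₂)) repair
      isRepair
  where
  open Reals ℝ
  open OrderedField ℝ
  open LinearProgram ℝ H b 2≤b b≤deg-1 x* optimal
  open Rounding ℝ H b 2≤b b≤deg-1 x* optimal
  open Analysis ℝ H b 2≤b b≤deg-1 x* optimal
  open import Algebra.Construct.NaturalChoice.Max totalOrder using (maxOperator)
  open import Algebra.Construct.NaturalChoice.MaxOp maxOperator using (x≤x⊔y; x≤y⊔x)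

  z α R₁ R₂ ratio : Carrier
  z     = ε ^ k
  α     = ((⟦ β ⟧ - 1#) * δ * z) / (⟦ 6 ⟧ * ℓ) * exp[a]
  R₁    = (1# - 1# / ⟦ 2 ⟧ * (1# - ε) * z) * δ
  R₂    = (1# - ((⟦ β ⟧ - 1#) * z) / (⟦ 18 ⟧ * ℓ) * exp[a]) * δ
  ratio = R₁ ⊔ R₂

  ratio-mono : ∀ {R} → R ≤ ratio → R * Opt ≤ ratio * Opt
  ratio-mono {R} R≤ratio = ≤-by (0≤y-x R≤ratio 0≤* <⇒≤ 0<Opt)
    (solve 3 (λ r R o → r :* o :- R :* o := (r :- R) :* o) refl ratio R Opt)

  δ-1≈D : δ - 1# ≈ D
  δ-1≈D = solve 1 (λ d → :1 :+ d :- :1 := d) refl D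

  0<2δ : 0# < ⟦ 2 ⟧ * δ
  0<2δ = 0<⟦1+ 1 ⟧ 0<* 0<δ

  0≤ε : 0# ≤ ε
  0≤ε = ≤-trans (0≤/ (≤-respʳ (sym δ-1≈D) 0≤D) 0<2δ) c≤ε

  D≤2δε : D ≤ ⟦ 2 ⟧ * δ * ε
  D≤2δε = ≤-respˡ δ-1≈D (y/l≤x⇒y≤l*x 0<2δ c≤ε)

  -- Raising the upper bound on ε to the k-th power removes the root: εᵏ ≤ (δ - 1) / (2 δ).
  2δz≤D : ⟦ 2 ⟧ * δ * z ≤ D
  2δz≤D = ≤-trans (*-monoʳ-≤ (<⇒≤ 0<2δ) (≤-trans (^-monoˡ-≤ k 0≤ε ε≤r) (≤-reflexive r^k≈c)))
    (≤-reflexive (trans (*-/-cancel (δ - 1#) 0<2δ) δ-1≈D))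

  -- ε ≥ 1 would give εᵏ ≥ 1, against εᵏ ≤ (δ - 1) / (2 δ) < 1.
  ε<1 : ε < 1#
  ε<1 = ≰⇒> λ 1≤ε → <⇒≱ D<2δ (≤-trans
    (≤-by (<⇒≤ 0<2δ 0≤* 0≤y-x (1≤^ k 1≤ε))
      (solve 2 (λ d z → d :* z :- d := d :* (z :- :1)) refl (⟦ 2 ⟧ * δ) z)) 2δz≤D)
    where
    D<2δ : D < ⟦ 2 ⟧ * δ
    D<2δ = <-by (0<⟦1+ 1 ⟧ 0<+≤ 0≤D) (solve 1 (λ d → # 2 :* (:1 :+ d) :- d := # 2 :+ d) refl D)

  2a≈ : ⟦ k ⟧ * (1# - ε) + D * (1# - z) ≈ ⟦ 2 ⟧ * ((⟦ k ⟧ * (1# - ε) + (δ - 1#) * (1# - z)) / ⟦ 2 ⟧)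
  2a≈ = trans (+-congˡ (*-congʳ (sym δ-1≈D))) (sym (*-/-cancel _ 0<⟦1+ 1 ⟧))

  6ℓα≈ : ⟦ 6 ⟧ * ℓ * α ≈ (⟦ β ⟧ - 1#) * δ * z * exp[a]
  6ℓα≈ = trans (sym (*-assoc _ _ _)) (*-congʳ (*-/-cancel _ (0<⟦1+ 5 ⟧ 0<* 0<ℓ)))

  open Thresholds k ε α 0≤ε ε<1 D≤2δε 2δz≤D using (repairNeverStuck)
  open Guarantee k ε α 0≤ε ε<1 D≤2δε 2δz≤D _ exp[a] 2a≈ isExp 6ℓα≈ using (algorithm-multicover; algorithm-size)
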